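{- Let $c$, $k$ and $t$ be positive integers with $c\ge 6$ and $k\ge t+3$. Suppose $\mathcal{F}$ and $\mathcal{G}$ are cross $t$-intersecting subfamilies of $U^{[ck]}_{c,k}$ such that both $|\bigcap_{F\in\mathcal{F}}F|$ and $|\bigcap_{G\in\mathcal{G}}G|$ are less than $t$. If $c\ge 4\log_2 t+7$ or $k\ge 2t+3$, and $|\mathcal{F}||\mathcal{G}|$ takes the maximum value among all such pairs, then one of the following holds: (i) $\mathcal{F}=\mathcal{N}_1(T,L,M)$ and $\mathcal{G}=\mathcal{N}_1(T,M,L)$ for some $T\in U^{[ck]}_{c,t}$ and $L,M\in U^{[ck]}_{c,k-1}$ with $T\subseteq L\cap M$ and $|L\cap M|\ge t+\min\{t,2\}$; (ii) $\mathcal{F}=\mathcal{G}=\mathcal{N}_2(Z)$ for some $Z\in U^{[ck]}_{c,t+2}$; (iii) $\mathcal{F}=\mathcal{N}_3(A_1,A_2,C)$ and $\mathcal{G}=\mathcal{N}_3(B_1,B_2,C)$ for some $A_1=\{e_1,e_2\}$, $A_2=\{e_3,e_4\}$, $B_1=\{e_1,e_3\}$, $B_2=\{e_2,e_4\}$, $C=\{e_1,e_4\}\in U^{[ck]}_{c,2}$. Moreover, if $(k,t)\in\{(4,1),(5,1)\}$, then (i), (ii) or (iii) holds; if $k=t+3$ and $t\ge 2$, then (i) or (ii) holds; if $t+4\le k\le 2t+3$ with $(k,t)\ne(5,1)$, then (ii) holds; if $k\ge 2t+4$, then (i) holds.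
   Context: For positive integers $c,k,\ell$, $U^{[ck]}_{c,\ell}$ denotes the set of all families of $\ell$ pairwise disjoint $c$-subsets ("blocks") of $[ck]$; $U^{[ck]}_{c,k}$ is the set of $c$-uniform partitions of $[ck]$. Members are regarded as sets of blocks: $A\cap B$ is the set of common blocks, $A\subseteq B$ means every block of $A$ is a block of $B$, and $\bigcap_{F\in\mathcal{F}}F$ is the set of blocks common to all members of $\mathcal{F}$. Families $\mathcal{A},\mathcal{B}$ are cross $t$-intersecting if $|A\cap B|\ge t$ for all $A\in\mathcal{A}$, $B\in\mathcal{B}$. For $T\in U^{[ck]}_{c,t}$ and $L,M\in U^{[ck]}_{c,k-1}$ with $T\subseteq L\cap M$: $\mathcal{N}_1(T,L,M)=\{F\in U^{[ck]}_{c,k}: T\subseteq F,\ |F\cap L|\ge t+1\}\cup\{F\in U^{[ck]}_{c,k}: T\not\subseteq F,\ |F\cap M|=k-2\}$. For $Z\in U^{[ck]}_{c,t+2}$: $\mathcal{N}_2(Z)=\{F\in U^{[ck]}_{c,k}: |F\cap Z|\ge t+1\}$. For $c$-subsets $e_1,e_2,e_3,e_4$ of $[ck]$ such that $\{e_1,e_2\},\{e_3,e_4\},\{e_1,e_3\},\{e_2,e_4\},\{e_1,e_4\}$ all lie in $U^{[ck]}_{c,2}$, and $X,Y,W$ among these pairs: $\mathcal{N}_3(X,Y,W)=\{F\in U^{[ck]}_{c,k}: X\subseteq F \text{ or } Y\subseteq F\text{ or } W\subseteq F\}$. -}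

module Defs where

open import Data.Nat using (ℕ; zero; suc; _+_; _*_; _∸_; _≤_; _<_; _⊔_; _⊓_)
open import Data.Fin using (Fin)
open import Data.Fin.Subset using (Subset; _∈_; _⊆_; _∩_; _∪_; ⁅_⁆; ∣_∣; Empty)
open import Data.Vec using (Vec; []; _∷_; _++_; map; lookup)
open import Data.Bool using (Bool; true; false)
open import Data.Product using (Σ; _×_; ∃-syntax)
open import Data.Sum using (_⊎_)
open import Relation.Nullary using (¬_)
open import Relation.Binary.PropositionalEquality using (_≡_; _≢_)
open import Function.Bundles using (_↔_; _⇔_)

-- Encoding.
-- The ground set is [n] = Fin n (n = c * k later).
-- Every subset of [n] is a candidate block; the 2^n subsets of [n] are
-- enumerated (without repetition) by  allSubsets n : Vec (Subset n) (pow2 n).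
-- A set of blocks ("member") is a Subset of the index set Fin (pow2 n):
-- index j in A means that the block  blk j = lookup (allSubsets n) j
-- belongs to A.  With this canonical encoding, A ∩ B (common blocks),
-- A ⊆ B (every block of A is a block of B) and ∣ A ∣ (number of blocks)
-- are literally the library's subset operations.

pow2 : ℕ → ℕ
pow2 zero    = 1
pow2 (suc n) = pow2 n + pow2 n

allSubsets : (n : ℕ) → Vec (Subset n) (pow2 n)
allSubsets zero    = [] ∷ []
allSubsets (suc n) = map (false ∷_) (allSubsets n) ++ map (true ∷_) (allSubsets n)

blk : {n : ℕ} → Fin (pow2 n) → Subset n
blk {n} j = lookup (allSubsets n) j

record Member (n : ℕ) : Set where
  constructor ⟨_⟩
  field
    blocks : Subset (pow2 n)
open Member public

_∩ᴹ_ : {n : ℕ} → Member n → Member n → Member n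
A ∩ᴹ B = ⟨ blocks A ∩ blocks B ⟩

_⊆ᴹ_ : {n : ℕ} → Member n → Member n → Set
A ⊆ᴹ B = blocks A ⊆ blocks B

#_ : {n : ℕ} → Member n → ℕ
# A = ∣ blocks A ∣

_∈ᴹ_ : {n : ℕ} → Fin (pow2 n) → Member n → Set
j ∈ᴹ A = j ∈ blocks A

InU : {n : ℕ} → (c ℓ : ℕ) → Member n → Set
InU {n} c ℓ A =
  (∀ j → j ∈ᴹ A → ∣ blk {n} j ∣ ≡ c) ×
  (∀ i j → i ∈ᴹ A → j ∈ᴹ A → i ≢ j → Empty (blk {n} i ∩ blk {n} j)) ×
  # A ≡ ℓ

-- a family of members (decidable membership, as every family of a finite set)
Family : ℕ → Set
Family n = Member n → Bool

_∈ᶠ_ : {n : ℕ} → Member n → Family n → Set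
A ∈ᶠ 𝓕 = 𝓕 A ≡ true

FamilyOfU : {n : ℕ} → (c k : ℕ) → Family n → Set
FamilyOfU c k 𝓕 = ∀ A → A ∈ᶠ 𝓕 → InU c k A

HasSize : {n : ℕ} → Family n → ℕ → Set
HasSize {n} 𝓕 m = Fin m ↔ Σ (Member n) (λ A → A ∈ᶠ 𝓕)

IsCommonBlocks : {n : ℕ} → Family n → Member n → Set
IsCommonBlocks {n} 𝓕 S = ∀ j → (j ∈ᴹ S) ⇔ (∀ A → A ∈ᶠ 𝓕 → j ∈ᴹ A)

CrossInt : {n : ℕ} → ℕ → Family n → Family n → Set
CrossInt t 𝓕 𝓖 = ∀ A B → A ∈ᶠ 𝓕 → B ∈ᶠ 𝓖 → t ≤ # (A ∩ᴹ B)

Admissible : (c k t : ℕ) → Family (c * k) → Family (c * k) → Set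
Admissible c k t 𝓕 𝓖 =
  FamilyOfU c k 𝓕 × FamilyOfU c k 𝓖 × CrossInt t 𝓕 𝓖 ×
  (∀ S → IsCommonBlocks 𝓕 S → # S < t) ×
  (∀ S → IsCommonBlocks 𝓖 S → # S < t)

_≐_ : {n : ℕ} → Family n → (Member n → Set) → Set
𝓕 ≐ P = ∀ A → (A ∈ᶠ 𝓕) ⇔ P A

InN₁ : {n : ℕ} → (c k t : ℕ) → Member n → Member n → Member n → Member n → Set
InN₁ c k t T L M F =
  InU c k F ×
  ((T ⊆ᴹ F × suc t ≤ # (F ∩ᴹ L)) ⊎ (¬ (T ⊆ᴹ F) × # (F ∩ᴹ M) ≡ k ∸ 2))

InN₂ : {n : ℕ} → (c k t : ℕ) → Member n → Member n → Set
InN₂ c k t Z F = InU c k F × suc t ≤ # (F ∩ᴹ Z)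

InN₃ : {n : ℕ} → (c k : ℕ) → Member n → Member n → Member n → Member n → Set
InN₃ c k X Y W F = InU c k F × (X ⊆ᴹ F ⊎ Y ⊆ᴹ F ⊎ W ⊆ᴹ F)

pair : (n : ℕ) → Fin (pow2 n) → Fin (pow2 n) → Member n
pair n i j = ⟨ ⁅ i ⁆ ∪ ⁅ j ⁆ ⟩

Case1 : (c k t : ℕ) → Family (c * k) → Family (c * k) → Set
Case1 c k t 𝓕 𝓖 = Σ (Member (c * k)) λ T → Σ (Member (c * k)) λ L → Σ (Member (c * k)) λ M →
  (InU c t T × InU c (k ∸ 1) L × InU c (k ∸ 1) M × T ⊆ᴹ (L ∩ᴹ M) ×
   t + (t ⊓ 2) ≤ # (L ∩ᴹ M) ×
   𝓕 ≐ InN₁ c k t T L M × 𝓖 ≐ InN₁ c k t T M L)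

Case2 : (c k t : ℕ) → Family (c * k) → Family (c * k) → Set
Case2 c k t 𝓕 𝓖 = Σ (Member (c * k)) λ Z → (InU c (t + 2) Z × 𝓕 ≐ InN₂ c k t Z × 𝓖 ≐ InN₂ c k t Z)

Case3 : (c k t : ℕ) → Family (c * k) → Family (c * k) → Set
Case3 c k t 𝓕 𝓖 = Σ (Fin (pow2 (c * k))) λ e₁ → Σ (Fin (pow2 (c * k))) λ e₂ →
  Σ (Fin (pow2 (c * k))) λ e₃ → Σ (Fin (pow2 (c * k))) λ e₄ →
  (InU c 2 (pair (c * k) e₁ e₂) × InU c 2 (pair (c * k) e₃ e₄) × InU c 2 (pair (c * k) e₁ e₃) ×
   InU c 2 (pair (c * k) e₂ e₄) × InU c 2 (pair (c * k) e₁ e₄) ×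
   𝓕 ≐ InN₃ c k (pair (c * k) e₁ e₂) (pair (c * k) e₃ e₄) (pair (c * k) e₁ e₄) ×
   𝓖 ≐ InN₃ c k (pair (c * k) e₁ e₃) (pair (c * k) e₂ e₄) (pair (c * k) e₁ e₄))

{-# OPTIONS --safe #-}
-- Let n = k - t - 1 and let u i be the number of c-uniform partitions of c i points, so that
-- u i = r i * u (i - 1) with r i = C(c i - 1, c - 1). A set of k - i disjoint blocks lies in exactly
-- u i partitions, and this is the only fact about partitions that is used: everything else is about
-- k-cliques of the compatibility graph on blocks.
--
-- Let (F, G) be a maximum pair. A t-cover of G is a set of blocks sharing at least t blocks with every
-- member of G; each member of F is one. Branching from a smallest t-cover bounds |F| |G|, and since
-- r n exceeds a suitable polynomial in k and t, the product is too small unless both families have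
-- t-covers of size t + 1. Call a (t+1)-clique that is a t-cover of G a generator of F (all partitions
-- through it lie in F), and let F have a and G have b generators. Up to lower order terms
-- |F| = a * u n and |G| = b * u n, and comparison with 𝒩₁ and 𝒩₂ gives a b ≥ max(t+2, n)².
-- The generators of F and of G are cross t-intersecting (t+1)-sets, and at most n of them contain a
-- given t-set (a block outside a partition meets at least two of its blocks). Hence a b = max(t+2, n)²
-- and the generators are either all sets T ∪ {x} with x in a fixed n-set (𝒩₁), all (t+1)-subsets of a
-- (t+2)-set (𝒩₂), or t = 1 and they form the six edges of (iii). Each type determines F and G.
-- When k = 2t + 3 the leading terms of |𝒩₁| and |𝒩₂| agree and the next ones are compared.
module Submission where

open import Axiom.UniquenessOfIdentityProofs using (module Decidable⇒UIP)
open import Data.Bool using (Bool; true; false; if_then_else_)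
import Data.Bool as Bool
open import Data.Empty using (⊥; ⊥-elim)
open import Data.Fin using (Fin; zero; suc; _↑ˡ_; _↑ʳ_)
import Data.Fin as Fin using (splitAt)
open import Data.Fin.Permutation using (↔⇒≡)
import Data.Fin.Properties as Fin
open import Data.Fin.Subset using (Subset; inside; outside; _∈_; _∉_; _⊆_; _∩_; _∪_; _-_; _─_; ∁; ⁅_⁆; ∣_∣; Empty; Nonempty) renaming (⊥ to ∅; ⊤ to full)
open import Data.Fin.Subset.Properties
open import Data.List using (List; []; _∷_; map; _++_; allFin; tabulate; length)
open import Data.List.Membership.Propositional using () renaming (_∈_ to _∈ˡ_)
open import Data.List.Membership.Propositional.Properties using (∈-allFin; ∈-map⁺; ∈-map⁻; ∈-++⁺ˡ; ∈-++⁺ʳ)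
open import Data.List.Relation.Unary.All using (All; []; _∷_)
open import Data.List.Relation.Unary.AllPairs using ([]; _∷_)
open import Data.List.Relation.Unary.Any using (here; there)
open import Data.List.Relation.Unary.Unique.Propositional using (Unique)
import Data.List.Relation.Unary.Unique.Propositional.Properties as Uniq
open import Data.Nat using (ℕ; zero; suc; _+_; _*_; _∸_; _^_; _≤_; _<_; z≤n; s≤s; _⊔_; _⊓_; >-nonZero)
open import Data.Nat.Properties
open import Data.Nat.Tactic.RingSolver using (solve-∀)
open import Data.Product using (Σ; ∃; _×_; _,_; proj₁; proj₂)
open import Data.Sum using (_⊎_; inj₁; inj₂; [_,_]′)
open import Data.Sum.Function.Propositional using (_⊎-↔_)
open import Data.Vec using ([]; _∷_; here; there)
import Data.Vec as Vec
open import Data.Vec.Properties using (∷-injectiveʳ; lookup⇒[]=; []=⇒lookup; lookup∘tabulate; lookup-++ˡ; lookup-++ʳ; lookup-map)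
import Data.Vec.Properties as Vec
open import Function using (_∘_; id; case_of_)
open import Function.Bundles using (_↔_; mk↔ₛ′; mk⇔; Equivalence)
open import Function.Construct.Composition using (_↔-∘_)
open import Function.Construct.Symmetry using (↔-sym)
open import Relation.Binary.PropositionalEquality using (_≡_; _≢_; refl; sym; trans; cong; cong₂; subst; module ≡-Reasoning)
open import Relation.Nullary using (¬_; Dec; yes; no; does; contradiction)
open import Relation.Nullary.Decidable using (¬?; _×-dec_; _⊎-dec_; _→-dec_; dec-true; dec-false; map′; decidable-stable)
open import Relation.Unary using (Decidable)

open import Defs using (pow2; allSubsets; blk)

-- The generator counts decide only if all errors together stay below one unit of a b, so r n must
-- beat an explicit polynomial. This is where the two hypotheses act. If k ≥ 2t + 3, then n > t and
-- the main polynomial has degree five in n, while r m ≥ 10 m⁵ already for c = 6. If k is smaller, n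
-- may be as small as 2 and only the block size makes r large: r 2 = C(2c - 1, c - 1) ≥ 1716 · 3^(c
-- - 7), and t⁴ ≤ 2^(c - 7) gives t⁶ ≤ 3^(c - 7).
--
-- Maximality acts in two ways. It saturates the pair: a partition that is a t-cover of one family
-- belongs to the other. Hence the generators cross-intersect, and 𝒩₂ and (iii) are recovered
-- exactly. For 𝒩₁ this does not work, because 𝒩₁(T,L,M) and 𝒩₁(T,M,L) need not be cross
-- t-intersecting. Their size, however, is independent of L and M, so comparison with the admissible
-- choice L = M forces equality, and the condition on the overlap of L and M is read off afterwards
-- from the cross-intersection.

-- Counting by decidable predicates

ind : {P : Set} → Dec P → ℕ
ind d = if does d then 1 else 0

ind-yes : {P : Set} (d : Dec P) → P → ind d ≡ 1
ind-yes d p rewrite dec-true d p = refl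

ind-no : {P : Set} (d : Dec P) → ¬ P → ind d ≡ 0
ind-no d ¬p rewrite dec-false d ¬p = refl

ind-mono : {P Q : Set} (d : Dec P) (e : Dec Q) → (P → Q) → ind d ≤ ind e
ind-mono (yes p) e f = ≤-reflexive (sym (ind-yes e (f p)))
ind-mono (no ¬p) e f = z≤n

∑ˡ : {A : Set} → List A → (A → ℕ) → ℕ
∑ˡ []       f = 0
∑ˡ (x ∷ xs) f = f x + ∑ˡ xs f

module _ {A : Set} where

  ∑ˡ-mono : ∀ (xs : List A) {f g : A → ℕ} → (∀ x → f x ≤ g x) → ∑ˡ xs f ≤ ∑ˡ xs g
  ∑ˡ-mono []       f≤g = z≤n
  ∑ˡ-mono (x ∷ xs) f≤g = +-mono-≤ (f≤g x) (∑ˡ-mono xs f≤g)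

  ∑ˡ-+ : ∀ (xs : List A) (f g : A → ℕ) → ∑ˡ xs (λ x → f x + g x) ≡ ∑ˡ xs f + ∑ˡ xs g
  ∑ˡ-+ []       f g = refl
  ∑ˡ-+ (x ∷ xs) f g rewrite ∑ˡ-+ xs f g = interchange (f x) (g x) (∑ˡ xs f) (∑ˡ xs g)
    where
    interchange : ∀ a b c d → a + b + (c + d) ≡ a + c + (b + d)
    interchange = solve-∀

  ∑ˡ-* : ∀ (xs : List A) (f : A → ℕ) m → ∑ˡ xs (λ x → m * f x) ≡ m * ∑ˡ xs f
  ∑ˡ-* []       f m = sym (*-zeroʳ m)
  ∑ˡ-* (x ∷ xs) f m rewrite ∑ˡ-* xs f m = sym (*-distribˡ-+ m (f x) (∑ˡ xs f))

  ∑ˡ-0 : ∀ (xs : List A) → ∑ˡ xs (λ _ → 0) ≡ 0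
  ∑ˡ-0 []       = refl
  ∑ˡ-0 (_ ∷ xs) = ∑ˡ-0 xs

  ∑ˡ-≤1 : ∀ {P : A → Set} (P? : Decidable P) {xs} → Unique xs → (∀ {x y} → P x → P y → x ≡ y) →
          ∑ˡ xs (λ x → ind (P? x)) ≤ 1
  ∑ˡ-≤1 P? []       _ = z≤n
  ∑ˡ-≤1 {P} P? {x ∷ xs} (x∉ ∷ u) same with P? x
  ... | no  _  = ∑ˡ-≤1 P? u same
  ... | yes px = s≤s (≤-reflexive (none xs x∉))
    where
    none : ∀ zs → All (λ z → x ≢ z) zs → ∑ˡ zs (λ z → ind (P? z)) ≡ 0
    none []       []        = refl
    none (z ∷ zs) (x≢z ∷ h) rewrite ind-no (P? z) (λ pz → x≢z (same px pz)) = none zs h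

  ∑ˡ-≥ : ∀ (f : A → ℕ) {xs x} → x ∈ˡ xs → f x ≤ ∑ˡ xs f
  ∑ˡ-≥ f (here refl) = m≤m+n _ _
  ∑ˡ-≥ f (there x∈)  = ≤-trans (∑ˡ-≥ f x∈) (m≤n+m _ _)

∑ˡ-swap : {A B : Set} (xs : List A) (ys : List B) (f : A → B → ℕ) →
          ∑ˡ xs (λ x → ∑ˡ ys (f x)) ≡ ∑ˡ ys (λ y → ∑ˡ xs (λ x → f x y))
∑ˡ-swap []       ys f = sym (∑ˡ-0 ys)
∑ˡ-swap (x ∷ xs) ys f rewrite ∑ˡ-swap xs ys f = sym (∑ˡ-+ ys (f x) _)

record Enum (A : Set) : Set where
  field
    elems    : List A
    complete : ∀ x → x ∈ˡ elems
    unique   : Unique elems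
open Enum ⦃ ... ⦄

opaque
  count : {A : Set} ⦃ _ : Enum A ⦄ {P : A → Set} → Decidable P → ℕ
  count P? = ∑ˡ elems (λ x → ind (P? x))

module _ {A : Set} ⦃ _ : Enum A ⦄ where

  opaque
    unfolding count

    count-mono : {P Q : A → Set} (P? : Decidable P) (Q? : Decidable Q) →
                 (∀ x → P x → Q x) → count P? ≤ count Q?
    count-mono P? Q? f = ∑ˡ-mono elems (λ x → ind-mono (P? x) (Q? x) (f x))

    count-cong : {P Q : A → Set} (P? : Decidable P) (Q? : Decidable Q) →
                 (∀ x → P x → Q x) → (∀ x → Q x → P x) → count P? ≡ count Q?
    count-cong P? Q? f g = ≤-antisym (count-mono P? Q? f) (count-mono Q? P? g)

    count-split : {P Q : A → Set} (P? : Decidable P) (Q? : Decidable Q) →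
                  count P? ≡ count (λ x → P? x ×-dec Q? x) + count (λ x → P? x ×-dec ¬? (Q? x))
    count-split P? Q? = trans (≤-antisym (∑ˡ-mono elems (λ x → ≤-reflexive (pointwise x)))
                                         (∑ˡ-mono elems (λ x → ≤-reflexive (sym (pointwise x)))))
                              (∑ˡ-+ elems _ _)
      where
      pointwise : ∀ x → ind (P? x) ≡ ind (P? x ×-dec Q? x) + ind (P? x ×-dec ¬? (Q? x))
      pointwise x with P? x | Q? x
      ... | yes _ | yes _ = refl
      ... | yes _ | no  _ = refl
      ... | no  _ | yes _ = refl
      ... | no  _ | no  _ = refl

    count-≤1 : {P : A → Set} (P? : Decidable P) → (∀ {x y} → P x → P y → x ≡ y) → count P? ≤ 1
    count-≤1 P? = ∑ˡ-≤1 P? unique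

    count-≥1 : {P : A → Set} (P? : Decidable P) → ∃ P → 1 ≤ count P?
    count-≥1 P? (x , px) = ≤-trans (≤-reflexive (sym (ind-yes (P? x) px)))
                                   (∑ˡ-≥ (λ y → ind (P? y)) (complete x))

    count-≡0 : {P : A → Set} (P? : Decidable P) → (∀ x → ¬ P x) → count P? ≡ 0
    count-≡0 P? none = n≤0⇒n≡0 (≤-trans (∑ˡ-mono elems (λ x → ≤-reflexive (ind-no (P? x) (none x))))
                                        (≤-reflexive (∑ˡ-0 elems)))

  count-⊂ : {P Q : A → Set} (P? : Decidable P) (Q? : Decidable Q) → (∀ x → P x → Q x) →
            ∀ {x} → Q x → ¬ P x → count P? < count Q?
  count-⊂ P? Q? f {x} qx ¬px rewrite count-split Q? P? = begin
      suc (count P?) ≡⟨ +-comm 1 _ ⟩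
      count P? + 1 ≤⟨ +-mono-≤
        (count-mono P? (λ y → Q? y ×-dec P? y) (λ y py → f y py , py))
        (count-≥1 (λ y → Q? y ×-dec ¬? (P? y)) (x , qx , ¬px)) ⟩
      count (λ y → Q? y ×-dec P? y) + count (λ y → Q? y ×-dec ¬? (P? y)) ∎
    where open ≤-Reasoning

  count-full : {P Q : A → Set} (P? : Decidable P) (Q? : Decidable Q) → (∀ x → P x → Q x) →
               count Q? ≤ count P? → ∀ x → Q x → P x
  count-full P? Q? f le x qx with P? x
  ... | yes px = px
  ... | no ¬px = contradiction (count-⊂ P? Q? f qx ¬px) (≤⇒≯ le)

module _ {A B : Set} ⦃ _ : Enum A ⦄ ⦃ _ : Enum B ⦄ where

  opaque
    unfolding count

    -- Both sides are compared with the number of `R`-related pairs between `P` and `Q`, summed by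
    -- rows and by columns.
    double-count : {P : A → Set} {Q : B → Set} {R : A → B → Set}
      (P? : Decidable P) (Q? : Decidable Q) (R? : ∀ x y → Dec (R x y)) (α β : ℕ) →
      (∀ x → P x → α ≤ count (λ y → Q? y ×-dec R? x y)) →
      (∀ y → Q y → count (λ x → P? x ×-dec R? x y) ≤ β) →
      α * count P? ≤ β * count Q?
    double-count {P} {Q} {R} P? Q? R? α β lower upper = begin
        α * count P? ≡⟨ ∑ˡ-* elems (λ x → ind (P? x)) α ⟨
        ∑ˡ elems (λ x → α * ind (P? x)) ≤⟨ ∑ˡ-mono elems row ⟩
        ∑ˡ elems (λ x → ∑ˡ elems (λ y → w x y)) ≡⟨ ∑ˡ-swap elems elems w ⟩
        ∑ˡ elems (λ y → ∑ˡ elems (λ x → w x y)) ≤⟨ ∑ˡ-mono elems col ⟩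
        ∑ˡ elems (λ y → β * ind (Q? y)) ≡⟨ ∑ˡ-* elems (λ y → ind (Q? y)) β ⟩
        β * count Q? ∎
      where
      open ≤-Reasoning
      w : A → B → ℕ
      w x y = ind (P? x ×-dec (Q? y ×-dec R? x y))
      row : ∀ x → α * ind (P? x) ≤ ∑ˡ elems (w x)
      row x with P? x
      ... | no  _  = ≤-trans (≤-reflexive (*-zeroʳ α)) z≤n
      ... | yes px = ≤-trans (≤-reflexive (*-identityʳ α)) (lower x px)
      col : ∀ y → ∑ˡ elems (λ x → w x y) ≤ β * ind (Q? y)
      col y with Q? y
      ... | yes qy = ≤-trans (upper y qy) (≤-reflexive (sym (*-identityʳ β)))
      ... | no ¬qy = ≤-trans (≤-trans (∑ˡ-mono elems (λ x → ≤-reflexive (ind-no (P? x ×-dec (no ¬qy ×-dec R? x y)) (λ z → ¬qy (proj₁ (proj₂ z))))))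
                                      (≤-reflexive (∑ˡ-0 {A} elems))) z≤n

  union-bound : {P : A → Set} {Q : B → Set} {R : A → B → Set}
    (P? : Decidable P) (Q? : Decidable Q) (R? : ∀ x y → Dec (R x y)) (β : ℕ) →
    (∀ x → P x → ∃ λ y → Q y × R x y) →
    (∀ y → Q y → count (λ x → P? x ×-dec R? x y) ≤ β) →
    count P? ≤ count Q? * β
  union-bound P? Q? R? β cover upper = begin
      count P? ≡⟨ *-identityˡ _ ⟨
      1 * count P? ≤⟨ double-count P? Q? R? 1 β
                           (λ x px → count-≥1 (λ y → Q? y ×-dec R? x y) (cover x px)) upper ⟩
      β * count Q? ≡⟨ *-comm β _ ⟩
      count Q? * β ∎
    where open ≤-Reasoning

-- Enumerating and counting the subsets of a finite set

private
  subsets : ∀ b → List (Subset b)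
  subsets zero    = [] ∷ []
  subsets (suc b) = map (outside ∷_) (subsets b) ++ map (inside ∷_) (subsets b)

  ∈-subsets : ∀ {b} (A : Subset b) → A ∈ˡ subsets b
  ∈-subsets []            = here refl
  ∈-subsets (outside ∷ A) = ∈-++⁺ˡ (∈-map⁺ (outside ∷_) (∈-subsets A))
  ∈-subsets (inside ∷ A)  = ∈-++⁺ʳ (map (outside ∷_) (subsets _)) (∈-map⁺ (inside ∷_) (∈-subsets A))

  subsets-unique : ∀ b → Unique (subsets b)
  subsets-unique zero    = [] ∷ []
  subsets-unique (suc b) =
    Uniq.++⁺ (Uniq.map⁺ ∷-injectiveʳ (subsets-unique b)) (Uniq.map⁺ ∷-injectiveʳ (subsets-unique b))
      (λ (x∈ , y∈) → case ∈-map⁻ (outside ∷_) x∈ of λ where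
        (_ , _ , refl) → case ∈-map⁻ (inside ∷_) y∈ of λ where (_ , _ , ()))

instance
  enumFin : ∀ {b} → Enum (Fin b)
  enumFin {b} = record { elems = allFin b ; complete = ∈-allFin ; unique = Uniq.allFin⁺ b }

  enumSubset : ∀ {b} → Enum (Subset b)
  enumSubset {b} = record { elems = subsets b ; complete = ∈-subsets ; unique = subsets-unique b }

opaque
  unfolding count

  count-∈ : ∀ {b} (A : Subset b) → count (_∈? A) ≡ ∣ A ∣
  count-∈ A = go A id (λ i → ind (i ∈? A)) (λ _ → refl)
    where
    go : ∀ {b} {X : Set} (A : Subset b) (f : Fin b → X) (g : X → ℕ) →
         (∀ i → g (f i) ≡ ind (i ∈? A)) → ∑ˡ (tabulate f) g ≡ ∣ A ∣
    go []            f g h = refl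
    go (inside ∷ A)  f g h rewrite h zero =
      cong suc (go A (f ∘ suc) g (λ i → trans (h (suc i)) refl))
    go (outside ∷ A) f g h rewrite h zero = go A (f ∘ suc) g (λ i → trans (h (suc i)) refl)

-- Pascal's rule holds by computation, unlike for Data.Nat.Combinatorics._C_.
binom : ℕ → ℕ → ℕ
binom m       zero    = 1
binom zero    (suc j) = 0
binom (suc m) (suc j) = binom m j + binom m (suc j)

private
  ∑ˡ-map : {A B : Set} (h : A → B) (f : B → ℕ) (xs : List A) → ∑ˡ (map h xs) f ≡ ∑ˡ xs (f ∘ h)
  ∑ˡ-map h f []       = refl
  ∑ˡ-map h f (x ∷ xs) = cong (f (h x) +_) (∑ˡ-map h f xs)

  ∑ˡ-++ : {A : Set} (f : A → ℕ) (xs ys : List A) → ∑ˡ (xs ++ ys) f ≡ ∑ˡ xs f + ∑ˡ ys f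
  ∑ˡ-++ f []       ys = refl
  ∑ˡ-++ f (x ∷ xs) ys = trans (cong (f x +_) (∑ˡ-++ f xs ys)) (sym (+-assoc (f x) _ _))

opaque
  unfolding count

  count-∷ : ∀ {b} {P : Subset (suc b) → Set} (P? : Decidable P) →
            count P? ≡ count (P? ∘ (outside ∷_)) + count (P? ∘ (inside ∷_))
  count-∷ {b} P? = trans (∑ˡ-++ _ (map (outside ∷_) (subsets b)) _)
                         (cong₂ _+_ (∑ˡ-map (outside ∷_) _ (subsets b)) (∑ˡ-map (inside ∷_) _ (subsets b)))

_⊆₌_ : ∀ {b} → Subset b × ℕ → Subset b → Set
(S , m) ⊆₌ A = A ⊆ S × ∣ A ∣ ≡ m

⊆₌? : ∀ {b} (S : Subset b) m A → Dec ((S , m) ⊆₌ A)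
⊆₌? S m A = (A ⊆? S) ×-dec (∣ A ∣ ≟ m)

count-choose : ∀ {b} (S : Subset b) m → count (⊆₌? S m) ≡ binom ∣ S ∣ m
count-choose []            zero    =
  ≤-antisym (count-≤1 (⊆₌? [] 0) (λ { {[]} {[]} _ _ → refl })) (count-≥1 (⊆₌? [] 0) ([] , id , refl))
count-choose []            (suc m) = count-≡0 (⊆₌? [] (suc m)) (λ { [] (_ , ()) })
count-choose (outside ∷ S) m =
  trans (count-∷ (⊆₌? (outside ∷ S) m))
  (trans (cong₂ _+_
    (trans (count-cong (⊆₌? (outside ∷ S) m ∘ (outside ∷_)) (⊆₌? S m) (λ A (s , e) → drop-∷-⊆ s , e) (λ A (s , e) → s⊆s s , e)) (count-choose S m))
    (count-≡0 (⊆₌? (outside ∷ S) m ∘ (inside ∷_)) λ A (s , _) → case s here of λ ()))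
  (+-identityʳ _))
count-choose (inside ∷ S) zero =
  trans (count-∷ (⊆₌? (inside ∷ S) 0))
  (cong₂ _+_
    (trans (count-cong (⊆₌? (inside ∷ S) 0 ∘ (outside ∷_)) (⊆₌? S 0) (λ A (s , e) → drop-∷-⊆ s , e) (λ A (s , e) → out⊆ s , e)) (count-choose S 0))
    (count-≡0 (⊆₌? (inside ∷ S) 0 ∘ (inside ∷_)) λ A p → case proj₂ p of λ ()))
count-choose (inside ∷ S) (suc m) =
  trans (count-∷ (⊆₌? (inside ∷ S) (suc m)))
  (trans (cong₂ _+_
    (trans (count-cong (⊆₌? (inside ∷ S) (suc m) ∘ (outside ∷_)) (⊆₌? S (suc m)) (λ A (s , e) → drop-∷-⊆ s , e) (λ A (s , e) → out⊆ s , e)) (count-choose S (suc m)))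
    (trans (count-cong (⊆₌? (inside ∷ S) (suc m) ∘ (inside ∷_)) (⊆₌? S m)
       (λ A (s , e) → drop-∷-⊆ s , suc-injective e) (λ A (s , e) → in⊆in s , cong suc e)) (count-choose S m)))
  (+-comm (binom ∣ S ∣ (suc m)) (binom ∣ S ∣ m)))

-- Sizes of subsets, and sets that miss at most one element of another

infixl 5 _⊕_
_⊕_ : ∀ {b} → Subset b → Fin b → Subset b
A ⊕ x = A ∪ ⁅ x ⁆

module _ {b : ℕ} where

  ∈-stable : ∀ {x} {A : Subset b} → ¬ (x ∉ A) → x ∈ A
  ∈-stable {x} {A} = decidable-stable (x ∈? A)

  x∈A⊕x : ∀ (A : Subset b) x → x ∈ A ⊕ x
  x∈A⊕x A x = q⊆p∪q A ⁅ x ⁆ (x∈⁅x⁆ x)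

  A⊆A⊕x : ∀ (A : Subset b) x → A ⊆ A ⊕ x
  A⊆A⊕x A x = p⊆p∪q ⁅ x ⁆

  ∈-⊕⁻ : ∀ (A : Subset b) x {y} → y ∈ A ⊕ x → y ∈ A ⊎ y ≡ x
  ∈-⊕⁻ A x y∈ with x∈p∪q⁻ A ⁅ x ⁆ y∈
  ... | inj₁ y∈A = inj₁ y∈A
  ... | inj₂ y∈x = inj₂ (x∈⁅y⁆⇒x≡y x y∈x)

  ⊕-⊆ : ∀ {A F : Subset b} {x} → A ⊆ F → x ∈ F → A ⊕ x ⊆ F
  ⊕-⊆ {A} {F} {x} A⊆F x∈F y∈ with ∈-⊕⁻ A x y∈
  ... | inj₁ y∈A  = A⊆F y∈A
  ... | inj₂ refl = x∈F

∈-remove⁻ : ∀ {b} (A : Subset b) x {y} → y ∈ A - x → y ∈ A × y ≢ x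
∈-remove⁻ A x {y} y∈ = p─q⊆p A ⁅ x ⁆ y∈ , λ { refl → x∉A-x A x y∈ }
  where
  x∉A-x : ∀ {b} (A : Subset b) x → x ∉ A - x
  x∉A-x (_ ∷ A) zero    ()
  x∉A-x (_ ∷ A) (suc x) (there x∈) = x∉A-x A x x∈

∣∪∣+∣∩∣ : ∀ {b} (A B : Subset b) → ∣ A ∪ B ∣ + ∣ A ∩ B ∣ ≡ ∣ A ∣ + ∣ B ∣
∣∪∣+∣∩∣ []            []            = refl
∣∪∣+∣∩∣ (outside ∷ A) (outside ∷ B) = ∣∪∣+∣∩∣ A B
∣∪∣+∣∩∣ (outside ∷ A) (inside ∷ B)  = trans (cong suc (∣∪∣+∣∩∣ A B)) (sym (+-suc ∣ A ∣ ∣ B ∣))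
∣∪∣+∣∩∣ (inside ∷ A)  (outside ∷ B) = cong suc (∣∪∣+∣∩∣ A B)
∣∪∣+∣∩∣ (inside ∷ A)  (inside ∷ B)  =
  cong suc (trans (+-suc ∣ A ∪ B ∣ ∣ A ∩ B ∣) (trans (cong suc (∣∪∣+∣∩∣ A B)) (sym (+-suc ∣ A ∣ ∣ B ∣))))

module _ {b : ℕ} where

  ∣Empty∣ : {A : Subset b} → Empty A → ∣ A ∣ ≡ 0
  ∣Empty∣ e = trans (cong ∣_∣ (Empty-unique e)) (∣⊥∣≡0 b)

  ∣∪∣-disjoint : ∀ (A B : Subset b) → (∀ {x} → x ∈ A → x ∉ B) → ∣ A ∪ B ∣ ≡ ∣ A ∣ + ∣ B ∣
  ∣∪∣-disjoint A B disj = trans (sym (+-identityʳ _)) (trans (cong (∣ A ∪ B ∣ +_) (sym (∣Empty∣ e))) (∣∪∣+∣∩∣ A B))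
    where
    e : Empty (A ∩ B)
    e (x , x∈) = let (x∈A , x∈B) = x∈p∩q⁻ A B x∈ in disj x∈A x∈B

  ∣⊕∣ : ∀ {A : Subset b} {x} → x ∉ A → ∣ A ⊕ x ∣ ≡ suc ∣ A ∣
  ∣⊕∣ {A} {x} x∉A =
    trans (∣∪∣-disjoint A ⁅ x ⁆ (λ y∈A y∈x → x∉A (subst (_∈ A) (x∈⁅y⁆⇒x≡y x y∈x) y∈A)))
          (trans (cong (∣ A ∣ +_) (∣⁅x⁆∣≡1 x)) (+-comm ∣ A ∣ 1))

  ⊆∧≥⇒⊇ : ∀ (A B : Subset b) → A ⊆ B → ∣ B ∣ ≤ ∣ A ∣ → B ⊆ A
  ⊆∧≥⇒⊇ A B A⊆B le {x} x∈B with x ∈? A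
  ... | yes x∈A = x∈A
  ... | no  x∉A = contradiction (p⊂q⇒∣p∣<∣q∣ (A⊆B , x , x∈B , x∉A)) (≤⇒≯ le)

  ⊆∧≥⇒≡ : ∀ (A B : Subset b) → A ⊆ B → ∣ B ∣ ≤ ∣ A ∣ → A ≡ B
  ⊆∧≥⇒≡ A B A⊆B le = ⊆-antisym A⊆B (⊆∧≥⇒⊇ A B A⊆B le)

  ∣remove∣ : ∀ {A : Subset b} {x} → x ∈ A → suc ∣ A - x ∣ ≡ ∣ A ∣
  ∣remove∣ {A} {x} x∈A = trans (sym (∣⊕∣ (λ x∈ → proj₂ (∈-remove⁻ A x x∈) refl)))
                               (cong ∣_∣ (⊆-antisym (⊕-⊆ (p─q⊆p A ⁅ x ⁆) x∈A) back))
    where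
    back : A ⊆ (A - x) ⊕ x
    back {y} y∈A with y Fin.≟ x
    ... | yes refl = x∈A⊕x (A - x) x
    ... | no  y≢x  = A⊆A⊕x (A - x) x (x∈p∧x≢y⇒x∈p-y y∈A y≢x)

  ⊈⇒∃ : ∀ {A B : Subset b} → ¬ (A ⊆ B) → ∃ λ x → x ∈ A × x ∉ B
  ⊈⇒∃ {A} {B} A⊈B with Fin.any? (λ x → (x ∈? A) ×-dec ¬? (x ∈? B))
  ... | yes w = w
  ... | no ¬w = contradiction (λ {x} x∈A → ∈-stable (λ x∉B → ¬w (x , x∈A , x∉B))) A⊈B

  ∣∣<⇒∃ : ∀ (A B : Subset b) → ∣ A ∣ < ∣ B ∣ → ∃ λ x → x ∈ B × x ∉ A
  ∣∣<⇒∃ A B lt = ⊈⇒∃ (λ B⊆A → <⇒≱ lt (p⊆q⇒∣p∣≤∣q∣ B⊆A))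

  nonempty : ∀ (A : Subset b) → 1 ≤ ∣ A ∣ → ∃ (_∈ A)
  nonempty A le with nonempty? A
  ... | yes w = w
  ... | no ¬w = contradiction (∣Empty∣ ¬w) (>⇒≢ le)

  subsetOfSize : ∀ (A : Subset b) m → m ≤ ∣ A ∣ → ∃ λ B → B ⊆ A × ∣ B ∣ ≡ m
  subsetOfSize A zero    le = ∅ , (λ x∈ → contradiction x∈ ∉⊥) , ∣⊥∣≡0 b
  subsetOfSize A (suc m) le with subsetOfSize A m (≤-trans (n≤1+n m) le)
  ... | B , B⊆A , refl with ∣∣<⇒∃ B A le
  ... | x , x∈A , x∉B = B ⊕ x , ⊕-⊆ B⊆A x∈A , ∣⊕∣ x∉B

  comprehension : {P : Fin b → Set} → Decidable P → Subset b
  comprehension P? = Vec.tabulate (λ x → does (P? x))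

  ∈-comprehension⁺ : {P : Fin b → Set} (P? : Decidable P) → ∀ {x} → P x → x ∈ comprehension P?
  ∈-comprehension⁺ P? {x} px = lookup⇒[]= x _ (trans (lookup∘tabulate _ x) (dec-true (P? x) px))

  ∈-comprehension⁻ : {P : Fin b → Set} (P? : Decidable P) → ∀ {x} → x ∈ comprehension P? → P x
  ∈-comprehension⁻ P? {x} x∈ with P? x | trans (sym (lookup∘tabulate (λ y → does (P? y)) x)) ([]=⇒lookup x∈)
  ... | yes px | _ = px

  infix 4 _⊑_
  -- For ∣ A ∣ = m + 1 this says ∣ A ∩ F ∣ ≥ m.
  _⊑_ : Subset b → Subset b → Set
  A ⊑ F = ∀ {x y} → x ∈ A → x ∉ F → y ∈ A → y ∉ F → x ≡ y

  ⊑⁺ : ∀ (A F : Subset b) {m} → ∣ A ∣ ≡ suc m → m ≤ ∣ A ∩ F ∣ → A ⊑ F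
  ⊑⁺ A F {m} ∣A∣ le {x} {y} x∈A x∉F y∈A y∉F with x Fin.≟ y
  ... | yes x≡y = x≡y
  ... | no  x≢y = contradiction le (<⇒≱ (≤-pred (begin
      suc (suc ∣ A ∩ F ∣) ≤⟨ s≤s (s≤s (p⊆q⇒∣p∣≤∣q∣ sub)) ⟩
      suc (suc ∣ A - x - y ∣) ≡⟨ cong suc (∣remove∣ (x∈p∧x≢y⇒x∈p-y y∈A (x≢y ∘ sym))) ⟩
      suc ∣ A - x ∣ ≡⟨ trans (∣remove∣ x∈A) ∣A∣ ⟩
      suc m ∎)))
    where
    open ≤-Reasoning
    sub : A ∩ F ⊆ A - x - y
    sub z∈ = let (z∈A , z∈F) = x∈p∩q⁻ A F z∈ in
      x∈p∧x≢y⇒x∈p-y (x∈p∧x≢y⇒x∈p-y z∈A (λ { refl → x∉F z∈F })) (λ { refl → y∉F z∈F })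

  ⊑⁻ : ∀ (A F : Subset b) {m} → ∣ A ∣ ≡ suc m → A ⊑ F → m ≤ ∣ A ∩ F ∣
  ⊑⁻ A F {m} ∣A∣ almost with A ⊆? F
  ... | yes A⊆F = ≤-trans (n≤1+n m) (≤-trans (≤-reflexive (sym ∣A∣)) (p⊆q⇒∣p∣≤∣q∣ (λ x∈A → x∈p∩q⁺ (x∈A , A⊆F x∈A))))
  ... | no A⊈F with ⊈⇒∃ A⊈F
  ... | x , x∈A , x∉F = ≤-trans (≤-reflexive (suc-injective (trans (sym ∣A∣) (sym (∣remove∣ x∈A))))) (p⊆q⇒∣p∣≤∣q∣ sub)
    where
    sub : A - x ⊆ A ∩ F
    sub y∈ = let (y∈A , y≢x) = ∈-remove⁻ A x y∈ in
      x∈p∩q⁺ (y∈A , ∈-stable (λ y∉F → y≢x (almost y∈A y∉F x∈A x∉F)))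

  ∣∣-2⇒∃₂ : ∀ (A B : Subset b) → 2 + ∣ A ∩ B ∣ ≤ ∣ A ∣ → ∃ λ x → ∃ λ y → x ≢ y × (x ∈ A × x ∉ B) × (y ∈ A × y ∉ B)
  ∣∣-2⇒∃₂ A B le with ∣∣<⇒∃ (A ∩ B) A (≤-trans (n≤1+n _) le)
  ... | x , x∈A , x∉AB with ∣∣<⇒∃ ((A ∩ B) ⊕ x) A (≤-trans (s≤s (≤-reflexive (∣⊕∣ x∉AB))) le)
  ... | y , y∈A , y∉ = x , y , (λ { refl → y∉ (x∈A⊕x (A ∩ B) x) }) ,
        (x∈A , λ x∈B → x∉AB (x∈p∩q⁺ (x∈A , x∈B))) ,
        (y∈A , λ y∈B → y∉ (A⊆A⊕x (A ∩ B) x (x∈p∩q⁺ (y∈A , y∈B))))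

-- Clique systems

count-≤1⁻ : {A : Set} ⦃ _ : Enum A ⦄ {P : A → Set} (P? : Decidable P) → (∀ x y → Dec (x ≡ y)) →
            count P? ≤ 1 → ∀ {x y} → P x → P y → x ≡ y
count-≤1⁻ {P = P} P? _≟′_ le {x} {y} px py with x ≟′ y
... | yes x≡y = x≡y
... | no  x≢y = contradiction
  (count-⊂ (λ z → z ≟′ x) P? (λ { _ refl → px }) py (x≢y ∘ sym))
  (≤⇒≯ (≤-trans le (count-≥1 (λ z → z ≟′ x) (x , refl))))

count-≥1⁻ : ∀ {b} {P : Subset b → Set} (P? : Decidable P) → 1 ≤ count P? → ∃ P
count-≥1⁻ P? le with anySubset? P?
... | yes w = w
... | no ¬w = contradiction (count-≡0 P? (λ x px → ¬w (x , px))) (>⇒≢ le)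

infix 4 _≟ˢ_
_≟ˢ_ : ∀ {b} (A B : Subset b) → Dec (A ≡ B)
_≟ˢ_ = Vec.≡-dec Bool._≟_

∣∣≡0⇒∉ : ∀ {b} (A : Subset b) → ∣ A ∣ ≡ 0 → ∀ {x} → x ∉ A
∣∣≡0⇒∉ A e x∈ = case trans (∣remove∣ x∈) e of λ ()

record CliqueSystem (b k : ℕ) : Set₁ where
  field
    Valid           : Fin b → Set
    valid?          : Decidable Valid
    Compatible      : Fin b → Fin b → Set
    compatible?     : ∀ i j → Dec (Compatible i j)
    compatible-sym  : ∀ {i j} → Compatible i j → Compatible j i

  IsClique : Subset b → Set
  IsClique A = (∀ j → j ∈ A → Valid j) × (∀ i j → i ∈ A → j ∈ A → i ≢ j → Compatible i j)

  -- The three clauses are flat rather than built on `IsClique`, so that for blocks this unfolds to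
  -- `InU` and members pass between the two without conversion.
  Clique : ℕ → Subset b → Set
  Clique ℓ A = (∀ j → j ∈ A → Valid j) × (∀ i j → i ∈ A → j ∈ A → i ≢ j → Compatible i j) × ∣ A ∣ ≡ ℓ

  isClique? : Decidable IsClique
  isClique? A = Fin.all? (λ j → (j ∈? A) →-dec valid? j) ×-dec
    Fin.all? (λ i → Fin.all? (λ j → (i ∈? A) →-dec ((j ∈? A) →-dec (¬? (i Fin.≟ j) →-dec compatible? i j))))

  clique? : ∀ ℓ → Decidable (Clique ℓ)
  clique? ℓ A = map′ (λ ((v , c) , s) → v , c , s) (λ (v , c , s) → (v , c) , s) (isClique? A ×-dec (∣ A ∣ ≟ ℓ))

  _⊆ᶜ_ : Subset b → Subset b → Set
  A ⊆ᶜ F = Clique k F × A ⊆ F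

  ⊆ᶜ? : ∀ A → Decidable (A ⊆ᶜ_)
  ⊆ᶜ? A F = clique? k F ×-dec (A ⊆? F)

  field
    u r     : ℕ → ℕ
    u-zero  : u 0 ≡ 1
    u-suc   : ∀ i → u (suc i) ≡ r (suc i) * u i
    r-one   : r 1 ≡ 1
    r-pos   : ∀ i → 1 ≤ r (suc i)
    extensions : ∀ i A → IsClique A → i + ∣ A ∣ ≡ k → count (⊆ᶜ? A) ≡ u i

  -- w i z counts the k-cliques through a clique A that avoid z further vertices of a clique
  -- containing A, where ∣ A ∣ = k - i; m i z counts those that meet these z vertices.
  w : ℕ → ℕ → ℕ
  w i       zero    = u i
  w zero    (suc z) = 0
  w (suc i) (suc z) = w (suc i) z ∸ w i z

  m : ℕ → ℕ → ℕ
  m i       zero    = 0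
  m zero    (suc z) = 0
  m (suc i) (suc z) = m (suc i) z + w i z

module CliqueCounts {b k : ℕ} (S : CliqueSystem b k) where
  open CliqueSystem S

  isClique : ∀ {ℓ A} → Clique ℓ A → IsClique A
  isClique (v , c , _) = v , c

  size : ∀ {ℓ A} → Clique ℓ A → ∣ A ∣ ≡ ℓ
  size (_ , _ , s) = s

  clique : ∀ {ℓ A} → IsClique A → ∣ A ∣ ≡ ℓ → Clique ℓ A
  clique (v , c) s = v , c , s

  isClique-⊆ : ∀ {A B} → A ⊆ B → IsClique B → IsClique A
  isClique-⊆ A⊆B (v , c) = (λ j j∈ → v j (A⊆B j∈)) , (λ i j i∈ j∈ → c i j (A⊆B i∈) (A⊆B j∈))

  isClique-⊕ : ∀ {A x} → IsClique A → Valid x → (∀ {y} → y ∈ A → y ≢ x → Compatible x y) → IsClique (A ⊕ x)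
  isClique-⊕ {A} {x} (v , c) vx cx =
    (λ j j∈ → case ∈-⊕⁻ A x j∈ of λ { (inj₁ j∈A) → v j j∈A ; (inj₂ refl) → vx }) ,
    (λ i j i∈ j∈ i≢j → case ∈-⊕⁻ A x i∈ , ∈-⊕⁻ A x j∈ of λ where
      (inj₁ i∈A , inj₁ j∈A)   → c i j i∈A j∈A i≢j
      (inj₁ i∈A , inj₂ refl)  → compatible-sym (cx i∈A i≢j)
      (inj₂ refl , inj₁ j∈A)  → cx j∈A (i≢j ∘ sym)
      (inj₂ refl , inj₂ refl) → contradiction refl i≢j)

  u-pos : ∀ i → 1 ≤ u i
  u-pos zero    = ≤-reflexive (sym u-zero)
  u-pos (suc i) rewrite u-suc i = *-mono-≤ (r-pos i) (u-pos i)

  u-one : u 1 ≡ 1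
  u-one rewrite u-suc 0 | r-one | u-zero = refl

  extensions-≤ : ∀ i A → i + ∣ A ∣ ≡ k → count (⊆ᶜ? A) ≤ u i
  extensions-≤ i A e with isClique? A
  ... | yes c = ≤-reflexive (extensions i A c e)
  ... | no ¬c = ≤-trans (≤-reflexive (count-≡0 (⊆ᶜ? A) (λ F (cF , A⊆F) → ¬c (isClique-⊆ A⊆F (isClique cF))))) z≤n

  extension-exists : ∀ i A → IsClique A → i + ∣ A ∣ ≡ k → ∃ λ F → Clique k F × A ⊆ F
  extension-exists i A c e = count-≥1⁻ (⊆ᶜ? A) (≤-trans (u-pos i) (≤-reflexive (sym (extensions i A c e))))

  -- Since u 1 = 1, the last vertex of a k-clique is forced by the others.
  extension-unique : ∀ {A F F′} → suc ∣ A ∣ ≡ k → A ⊆ F → A ⊆ F′ → Clique k F → Clique k F′ → F ≡ F′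
  extension-unique {A} {F} {F′} e A⊆F A⊆F′ cF cF′ = count-≤1⁻ (⊆ᶜ? A) _≟ˢ_
    (≤-trans (extensions-≤ 1 A e) (≤-reflexive u-one)) {F} {F′}
    (cF , A⊆F) (cF′ , A⊆F′)

  -- Otherwise exchanging f for e gives a second k-clique through F - f.
  conflict : ∀ {F e f} → Clique k F → Valid e → e ∉ F → f ∈ F → ∃ λ g → f ≢ g × g ∈ F × ¬ Compatible e g
  conflict {F} {e} {f} cF ve e∉F f∈F with Fin.any? (λ g → ¬? (f Fin.≟ g) ×-dec ((g ∈? F) ×-dec ¬? (compatible? e g)))
  ... | yes w = w
  ... | no none = contradiction e∈F e∉F
    where
    A = F - f
    A⊆F : A ⊆ F
    A⊆F = p─q⊆p F ⁅ f ⁆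
    c′ : IsClique (A ⊕ e)
    c′ = isClique-⊕ (isClique-⊆ A⊆F (isClique cF)) ve
      (λ {y} y∈ _ → decidable-stable (compatible? e y)
        (λ ¬c → none (y , (λ f≡y → proj₂ (∈-remove⁻ F f y∈) (sym f≡y)) , A⊆F y∈ , ¬c)))
    eq : suc ∣ A ∣ ≡ k
    eq = trans (∣remove∣ f∈F) (size cF)
    e∈F : e ∈ F
    e∈F = subst (e ∈_) (extension-unique {A} eq (A⊆A⊕x A e) A⊆F
      (clique c′ (trans (∣⊕∣ (λ e∈ → e∉F (A⊆F e∈))) eq)) cF) (x∈A⊕x A e)

  -- `conflict` at an arbitrary vertex of F yields g, and `conflict` at g yields a second vertex
  -- different from g.
  two-conflicts : ∀ {F e} → 1 ≤ k → Clique k F → Valid e → e ∉ F →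
    ∃ λ f₁ → ∃ λ f₂ → f₁ ≢ f₂ × (f₁ ∈ F × ¬ Compatible e f₁) × (f₂ ∈ F × ¬ Compatible e f₂)
  two-conflicts {F} 1≤k cF ve e∉F =
    let f , f∈F       = nonempty F (≤-trans 1≤k (≤-reflexive (sym (size cF))))
        g , _ , g∈    = conflict cF ve e∉F f∈F
        h , g≢h , h∈  = conflict cF ve e∉F (proj₁ g∈)
    in g , h , g≢h , g∈ , h∈

  private
    +-suc-≡ : ∀ i {a a′} → a′ ≡ suc a → suc i + a ≡ k → i + a′ ≡ k
    +-suc-≡ i {a} refl e = trans (+-suc i a) e

  -- Each vertex of X outside A lies in at most `u i` of the `r (suc i) * u i` extensions of A, so
  -- fewer than `r (suc i)` vertices cannot spoil all of them. This is the tool for choosing members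
  -- in general position.
  avoiding-extension : ∀ i A X → IsClique A → suc i + ∣ A ∣ ≡ k → ∣ X ∣ < r (suc i) →
    ∃ λ F → Clique k F × A ⊆ F × (∀ {x} → x ∈ F → x ∈ X → x ∈ A)
  avoiding-extension i A X c e lt with anySubset? (λ F → ⊆ᶜ? A F ×-dec Fin.all? (λ x → (x ∈? F) →-dec ((x ∈? X) →-dec (x ∈? A))))
  ... | yes (F , (cF , A⊆F) , h) = F , cF , A⊆F , λ {x} → h x
  ... | no none = contradiction bound (<⇒≱ (*-monoˡ-< (u i) ⦃ >-nonZero (u-pos i) ⦄ lt))
    where
    bound : r (suc i) * u i ≤ ∣ X ∣ * u i
    bound = begin
      r (suc i) * u i ≡⟨ trans (extensions (suc i) A c e) (u-suc i) ⟨
      count (⊆ᶜ? A) ≤⟨ union-bound (⊆ᶜ? A) new? (λ F x → x ∈? F) (u i) cover upper ⟩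
      count new? * u i ≤⟨ *-monoˡ-≤ (u i) (≤-trans (count-mono new? (_∈? X) (λ _ → proj₁)) (≤-reflexive (count-∈ X))) ⟩
      ∣ X ∣ * u i ∎
      where
      open ≤-Reasoning
      new? : Decidable (λ x → x ∈ X × x ∉ A)
      new? x = (x ∈? X) ×-dec ¬? (x ∈? A)
      cover : ∀ F → A ⊆ᶜ F → ∃ λ x → (x ∈ X × x ∉ A) × x ∈ F
      cover F F⊇ with Fin.any? (λ x → new? x ×-dec (x ∈? F))
      ... | yes w = w
      ... | no ¬w = contradiction (F , F⊇ , λ x x∈F x∈X → ∈-stable (λ x∉A → ¬w (x , (x∈X , x∉A) , x∈F))) none
      upper : ∀ x → x ∈ X × x ∉ A → count (λ F → ⊆ᶜ? A F ×-dec (x ∈? F)) ≤ u i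
      upper x (_ , x∉A) = ≤-trans
        (count-mono (λ F → ⊆ᶜ? A F ×-dec (x ∈? F)) (⊆ᶜ? (A ⊕ x)) (λ F ((cF , A⊆F) , x∈F) → cF , ⊕-⊆ A⊆F x∈F))
        (extensions-≤ i (A ⊕ x) (+-suc-≡ i (∣⊕∣ x∉A) e))

  Avoiding Meeting : Subset b → Subset b → Subset b → Set
  Avoiding A X F = A ⊆ᶜ F × Empty (F ∩ X)
  Meeting  A X F = A ⊆ᶜ F × Nonempty (F ∩ X)

  avoiding? : ∀ A X → Decidable (Avoiding A X)
  avoiding? A X F = ⊆ᶜ? A F ×-dec ¬? (nonempty? (F ∩ X))

  meeting? : ∀ A X → Decidable (Meeting A X)
  meeting? A X F = ⊆ᶜ? A F ×-dec nonempty? (F ∩ X)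

  ∩-remove : ∀ (F X : Subset b) x → x ∉ F → F ∩ X ⊆ F ∩ (X - x)
  ∩-remove F X x x∉F y∈ = let (y∈F , y∈X) = x∈p∩q⁻ F X y∈ in
    x∈p∩q⁺ (y∈F , x∈p∧x≢y⇒x∈p-y y∈X (λ { refl → x∉F y∈F }))

  ∩-mono : ∀ (F : Subset b) {X Y} → X ⊆ Y → F ∩ X ⊆ F ∩ Y
  ∩-mono F {X} X⊆Y y∈ = let (y∈F , y∈X) = x∈p∩q⁻ F X y∈ in x∈p∩q⁺ (y∈F , X⊆Y y∈X)

  private
    -- A vertex x of X moves from X to A.
    record Step (z i : ℕ) (A X : Subset b) : Set where
      field
        x         : Fin b
        x∈X       : x ∈ X
        c₁        : IsClique (A ∪ (X - x))
        disj₁     : ∀ {y} → y ∈ A → y ∉ X - x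
        c₂        : IsClique ((A ⊕ x) ∪ (X - x))
        disj₂     : ∀ {y} → y ∈ A ⊕ x → y ∉ X - x
        size-X    : ∣ X - x ∣ ≡ z
        size-A    : i + ∣ A ⊕ x ∣ ≡ k

    step : ∀ z i A X → IsClique (A ∪ X) → (∀ {y} → y ∈ A → y ∉ X) → ∣ X ∣ ≡ suc z → suc i + ∣ A ∣ ≡ k → Step z i A X
    step z i A X c disj sX e with nonempty X (≤-trans (s≤s z≤n) (≤-reflexive (sym sX)))
    ... | x , x∈X = record
      { x = x ; x∈X = x∈X
      ; c₁ = isClique-⊆ (λ y∈ → [ (λ y∈A → p⊆p∪q X y∈A) , (λ y∈X → q⊆p∪q A X (X-⊆ y∈X)) ]′ (x∈p∪q⁻ A (X - x) y∈)) c
      ; disj₁ = λ y∈A y∈X → disj y∈A (X-⊆ y∈X)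
      ; c₂ = isClique-⊆ (λ y∈ → [ (λ y∈A → [ p⊆p∪q X , (λ { refl → q⊆p∪q A X x∈X }) ]′ (∈-⊕⁻ A x y∈A)) , (λ y∈X → q⊆p∪q A X (X-⊆ y∈X)) ]′ (x∈p∪q⁻ (A ⊕ x) (X - x) y∈)) c
      ; disj₂ = λ y∈A y∈X → [ (λ y∈A′ → disj y∈A′ (X-⊆ y∈X)) , (λ y≡x → proj₂ (∈-remove⁻ X x y∈X) y≡x) ]′ (∈-⊕⁻ A x y∈A)
      ; size-X = suc-injective (trans (∣remove∣ x∈X) sX)
      ; size-A = +-suc-≡ i (∣⊕∣ (λ x∈A → disj x∈A x∈X)) e
      }
      where
      X-⊆ : X - x ⊆ X
      X-⊆ = p─q⊆p X ⁅ x ⁆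

  -- Fix x in X. The k-cliques through A that avoid X - x either contain x, hence pass through A ⊕
  -- x, or avoid all of X. So the truncated subtraction in `w` is exact here.
  count-avoiding : ∀ z i A X → z ≤ i → IsClique (A ∪ X) → (∀ {y} → y ∈ A → y ∉ X) → ∣ X ∣ ≡ z → i + ∣ A ∣ ≡ k →
    count (avoiding? A X) ≡ w i z
  count-avoiding zero i A X _ c disj sX e = trans
    (count-cong (avoiding? A X) (⊆ᶜ? A) (λ F (h , _) → h)
      (λ F h → h , λ (y , y∈) → ∣∣≡0⇒∉ X sX (proj₂ (x∈p∩q⁻ F X y∈))))
    (extensions i A (isClique-⊆ (p⊆p∪q X) c) e)
  count-avoiding (suc z) (suc i) A X (s≤s z≤i) c disj sX e = begin
      count (avoiding? A X)
        ≡⟨ m+n∸m≡n (count (avoiding? (A ⊕ x) (X - x))) _ ⟨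
      count (avoiding? (A ⊕ x) (X - x)) + count (avoiding? A X) ∸ count (avoiding? (A ⊕ x) (X - x))
        ≡⟨ cong (_∸ count (avoiding? (A ⊕ x) (X - x))) split ⟨
      count (avoiding? A (X - x)) ∸ count (avoiding? (A ⊕ x) (X - x))
        ≡⟨ cong₂ _∸_ (count-avoiding z (suc i) A (X - x) (≤-trans z≤i (n≤1+n i)) c₁ disj₁ size-X e)
                     (count-avoiding z i (A ⊕ x) (X - x) z≤i c₂ disj₂ size-X size-A) ⟩
      w (suc i) (suc z) ∎
    where
    open ≡-Reasoning
    open Step (step z i A X c disj sX e)
    split : count (avoiding? A (X - x)) ≡ count (avoiding? (A ⊕ x) (X - x)) + count (avoiding? A X)
    split = trans (count-split (avoiding? A (X - x)) (x ∈?_)) (cong₂ _+_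
      (count-cong (λ F → avoiding? A (X - x) F ×-dec (x ∈? F)) (avoiding? (A ⊕ x) (X - x))
        (λ F (((cF , A⊆F) , em) , x∈F) → (cF , ⊕-⊆ A⊆F x∈F) , em)
        (λ F ((cF , A⊆F) , em) → ((cF , λ y∈ → A⊆F (A⊆A⊕x A x y∈)) , em) , A⊆F (x∈A⊕x A x)))
      (count-cong (λ F → avoiding? A (X - x) F ×-dec ¬? (x ∈? F)) (avoiding? A X)
        (λ F ((h , em) , x∉F) → h , λ (y , y∈) → em (y , ∩-remove F X x x∉F y∈))
        (λ F (h , em) → (h , λ (y , y∈) → em (y , ∩-mono F (p─q⊆p X ⁅ x ⁆) y∈)) , λ x∈F → em (x , x∈p∩q⁺ (x∈F , x∈X)))))

  -- A clique meeting X meets X - x already, or else meets X exactly in x and is counted by `w` at A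
  -- ⊕ x.
  count-meeting : ∀ z i A X → z ≤ i → IsClique (A ∪ X) → (∀ {y} → y ∈ A → y ∉ X) → ∣ X ∣ ≡ z → i + ∣ A ∣ ≡ k →
    count (meeting? A X) ≡ m i z
  count-meeting zero i A X _ c disj sX e = count-≡0 (meeting? A X)
    (λ F (_ , y , y∈) → ∣∣≡0⇒∉ X sX (proj₂ (x∈p∩q⁻ F X y∈)))
  count-meeting (suc z) (suc i) A X (s≤s z≤i) c disj sX e = trans
      (count-split (meeting? A X) (λ F → nonempty? (F ∩ (X - x))))
      (cong₂ _+_ (trans first (count-meeting z (suc i) A (X - x) (≤-trans z≤i (n≤1+n i)) c₁ disj₁ size-X e))
                 (trans second (count-avoiding z i (A ⊕ x) (X - x) z≤i c₂ disj₂ size-X size-A)))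
    where
    open Step (step z i A X c disj sX e)
    first : count (λ F → meeting? A X F ×-dec nonempty? (F ∩ (X - x))) ≡ count (meeting? A (X - x))
    first = count-cong (λ F → meeting? A X F ×-dec nonempty? (F ∩ (X - x))) (meeting? A (X - x))
      (λ F ((h , _) , ne) → h , ne)
      (λ F (h , (y , y∈)) → (h , (y , ∩-mono F (p─q⊆p X ⁅ x ⁆) y∈)) , (y , y∈))
    second : count (λ F → meeting? A X F ×-dec ¬? (nonempty? (F ∩ (X - x)))) ≡ count (avoiding? (A ⊕ x) (X - x))
    second = count-cong (λ F → meeting? A X F ×-dec ¬? (nonempty? (F ∩ (X - x)))) (avoiding? (A ⊕ x) (X - x))
      (λ F (((cF , A⊆F) , (y , y∈)) , em) → (cF , ⊕-⊆ A⊆F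
          (∈-stable (λ x∉F → em (y , ∩-remove F X x x∉F y∈)))) , em)
      (λ F ((cF , A⊆F) , em) → ((cF , λ y∈ → A⊆F (A⊆A⊕x A x y∈)) , (x , x∈p∩q⁺ (A⊆F (x∈A⊕x A x) , x∈X))) , em)

-- Extremal families

-- Here k = 2 + (t + q), so that n = k - t - 1 is 1 + q.
module ExtremalFamilies (t q : ℕ) {b : ℕ} (S : CliqueSystem b (2 + (t + q)))
  (1≤t : 1 ≤ t) (1≤q : 1 ≤ q)
  (k<r : 2 + (t + q) < CliqueSystem.r S (1 + q)) (3≤r₂ : 3 ≤ CliqueSystem.r S 2) where
  open CliqueSystem S
  open CliqueCounts S

  k : ℕ
  k = 2 + (t + q)

  -- The bound concerns every set contained in all members. For an empty family this is every set at
  -- all, so admissible families are nonempty.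
  record AdmissiblePair (P Q : Subset b → Set) : Set where
    field
      cliqueˡ : ∀ {F} → P F → Clique k F
      cliqueʳ : ∀ {G} → Q G → Clique k G
      cross   : ∀ {F G} → P F → Q G → t ≤ ∣ F ∩ G ∣
      commonˡ : ∀ A → (∀ {F} → P F → A ⊆ F) → ∣ A ∣ < t
      commonʳ : ∀ A → (∀ {G} → Q G → A ⊆ G) → ∣ A ∣ < t

  q+[2+t] : ∀ {a} → a ≡ 2 + t → q + a ≡ k
  q+[2+t] refl = trans (+-comm q (2 + t)) refl

  [1+q]+[1+t] : ∀ {a} → a ≡ 1 + t → suc q + a ≡ k
  [1+q]+[1+t] refl = cong suc (trans (+-suc q t) (cong suc (+-comm q t)))

  [2+q]+t : ∀ {a} → a ≡ t → 2 + q + a ≡ k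
  [2+q]+t refl = cong (2 +_) (+-comm q t)

  r₂>1 : 1 < r 2
  r₂>1 = ≤-trans (s≤s (s≤s z≤n)) 3≤r₂

  r>1 : 1 < r (1 + q)
  r>1 = ≤-trans (s≤s (s≤s z≤n)) k<r

  clique-exists : ∀ ℓ → ℓ ≤ k → ∃ (Clique ℓ)
  clique-exists ℓ ℓ≤k =
    let F , cF , _    = extension-exists k ∅ ((λ j j∈ → contradiction j∈ ∉⊥) , (λ i j i∈ → contradiction i∈ ∉⊥))
                          (trans (cong (k +_) (∣⊥∣≡0 b)) (+-identityʳ k))
        A , A⊆F , sA  = subsetOfSize F ℓ (≤-trans ℓ≤k (≤-reflexive (sym (size cF))))
    in A , clique (isClique-⊆ A⊆F (isClique cF)) sA

  remove-⊆ : ∀ (A : Subset b) x → A - x ⊆ A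
  remove-⊆ A x = p─q⊆p A ⁅ x ⁆

  module Missing {A : Subset b} (cA : IsClique A) {z : Fin b} (z∈A : z ∈ A) {i : ℕ} (e : i + ∣ A ∣ ≡ k) where

    size- : suc i + ∣ A - z ∣ ≡ k
    size- = trans (sym (+-suc i ∣ A - z ∣)) (trans (cong (i +_) (∣remove∣ z∈A)) e)

    c- : IsClique (A - z)
    c- = isClique-⊆ (remove-⊆ A z) cA

    missing? : Decidable (λ F → (A - z) ⊆ᶜ F × z ∉ F)
    missing? F = ⊆ᶜ? (A - z) F ×-dec ¬? (z ∈? F)

    count-missing : count missing? ≡ w (suc i) 1
    count-missing = trans
      (count-cong missing? (avoiding? (A - z) ⁅ z ⁆)
        (λ F (h , z∉F) → h , λ (y , y∈) → let (y∈F , y∈z) = x∈p∩q⁻ F ⁅ z ⁆ y∈ in z∉F (subst (_∈ F) (x∈⁅y⁆⇒x≡y z y∈z) y∈F))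
        (λ F (h , em) → h , λ z∈F → em (z , x∈p∩q⁺ (z∈F , x∈⁅x⁆ z))))
      (count-avoiding 1 (suc i) (A - z) ⁅ z ⁆ (s≤s z≤n)
        (isClique-⊆ (⊕-⊆ (remove-⊆ A z) z∈A) cA)
        (λ y∈A y∈z → proj₂ (∈-remove⁻ A z y∈A) (x∈⁅y⁆⇒x≡y z y∈z))
        (∣⁅x⁆∣≡1 z) size-)

    missing-exists : 1 < r (suc i) → ∃ λ F → Clique k F × A - z ⊆ F × z ∉ F
    missing-exists lt =
      let F , cF , A⊆F , h = avoiding-extension i (A - z) ⁅ z ⁆ c- size- (≤-trans (s≤s (≤-reflexive (∣⁅x⁆∣≡1 z))) lt)
      in F , cF , A⊆F , λ z∈F → proj₂ (∈-remove⁻ A z (h z∈F (x∈⁅x⁆ z))) refl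

  remove-⊑ : ∀ {A F : Subset b} {z} → A - z ⊆ F → A ⊑ F
  remove-⊑ {A} {F} {z} sub x∈ x∉ y∈ y∉ = trans (is-z x∈ x∉) (sym (is-z y∈ y∉))
    where
    is-z : ∀ {x} → x ∈ A → x ∉ F → x ≡ z
    is-z {x} x∈ x∉ = decidable-stable (x Fin.≟ z) (λ x≢z → x∉ (sub (x∈p∧x≢y⇒x∈p-y x∈ x≢z)))

  ⊑-remove : ∀ {A F : Subset b} {z} → A ⊑ F → z ∈ A → z ∉ F → A - z ⊆ F
  ⊑-remove {A} {F} {z} al z∈A z∉F y∈ = let (y∈A , y≢z) = ∈-remove⁻ A z y∈ in
    ∈-stable (λ y∉F → y≢z (al y∈A y∉F z∈A z∉F))

  N₂ : Subset b → Subset b → Set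
  N₂ Z F = Clique k F × suc t ≤ ∣ F ∩ Z ∣

  N₂? : ∀ Z → Decidable (N₂ Z)
  N₂? Z F = clique? k F ×-dec (suc t ≤? ∣ F ∩ Z ∣)

  module Family₂ {Z : Subset b} (cZ : Clique (2 + t) Z) where

    N₂⁻ : ∀ {F} → N₂ Z F → Z ⊑ F
    N₂⁻ {F} (_ , le) = ⊑⁺ Z F (size cZ) (subst (λ X → suc t ≤ ∣ X ∣) (∩-comm F Z) le)

    N₂⁺ : ∀ {F} → Clique k F → Z ⊑ F → N₂ Z F
    N₂⁺ {F} cF al = cF , subst (λ X → suc t ≤ ∣ X ∣) (∩-comm Z F) (⊑⁻ Z F (size cZ) al)

    N₂-count : u q + w (1 + q) 1 * (2 + t) ≤ count (N₂? Z)
    N₂-count = begin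
      u q + w (1 + q) 1 * (2 + t) ≡⟨ cong₂ (λ x y → x + w (1 + q) 1 * y)
          (sym (extensions q Z (isClique cZ) (q+[2+t] (size cZ)))) (sym (trans (count-∈ Z) (size cZ))) ⟩
      count (⊆ᶜ? Z) + w (1 + q) 1 * count (_∈? Z) ≤⟨ +-mono-≤
          (count-mono (⊆ᶜ? Z) (λ F → N₂? Z F ×-dec (Z ⊆? F)) (λ F (cF , Z⊆F) → N₂⁺ cF (λ x∈ x∉ → contradiction (Z⊆F x∈) x∉) , Z⊆F))
          (≤-trans (double-count (_∈? Z) (λ F → N₂? Z F ×-dec ¬? (Z ⊆? F)) (λ z F → ¬? (z ∈? F)) (w (1 + q) 1) 1 lower upper)
                   (≤-reflexive (*-identityˡ _))) ⟩
      count (λ F → N₂? Z F ×-dec (Z ⊆? F)) + count (λ F → N₂? Z F ×-dec ¬? (Z ⊆? F)) ≡⟨ count-split (N₂? Z) (Z ⊆?_) ⟨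
      count (N₂? Z) ∎
      where
      open ≤-Reasoning
      lower : ∀ z → z ∈ Z → w (1 + q) 1 ≤ count (λ F → (N₂? Z F ×-dec ¬? (Z ⊆? F)) ×-dec ¬? (z ∈? F))
      lower z z∈Z = ≤-trans (≤-reflexive (sym count-missing))
        (count-mono missing? (λ F → (N₂? Z F ×-dec ¬? (Z ⊆? F)) ×-dec ¬? (z ∈? F))
          (λ F ((cF , sub) , z∉F) → (N₂⁺ cF (remove-⊑ sub) , λ Z⊆F → z∉F (Z⊆F z∈Z)) , z∉F))
        where open Missing (isClique cZ) z∈Z {q} (q+[2+t] (size cZ))
      upper : ∀ F → N₂ Z F × ¬ (Z ⊆ F) → count (λ z → (z ∈? Z) ×-dec ¬? (z ∈? F)) ≤ 1
      upper F (h , _) = count-≤1 (λ z → (z ∈? Z) ×-dec ¬? (z ∈? F))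
        (λ (x∈ , x∉) (y∈ , y∉) → N₂⁻ h x∈ x∉ y∈ y∉)

    -- Two members through Z - z can be chosen to share nothing outside Z - z, so a common set lies
    -- in Z; and every block of Z is missed by some member. The common part is therefore empty.
    N₂-common : ∀ A → (∀ {F} → N₂ Z F → A ⊆ F) → ∣ A ∣ < t
    N₂-common A common = ≤-trans (s≤s (≤-reflexive (∣Empty∣ empty))) 1≤t
      where
      z∈ = nonempty Z (≤-trans (s≤s z≤n) (≤-reflexive (sym (size cZ))))
      z = proj₁ z∈
      open Missing (isClique cZ) (proj₂ z∈) {q} (q+[2+t] (size cZ))
      F₁ = missing-exists r>1
      F₂ = avoiding-extension q (Z - z) (proj₁ F₁) c- size- (≤-trans (s≤s (≤-reflexive (size (proj₁ (proj₂ F₁))))) k<r)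
      A⊆Z : A ⊆ Z
      A⊆Z x∈A = let (F , cF , sub , h) = F₂ ; (G , cG , subG , _) = F₁ in
        remove-⊆ Z z (h (common (N₂⁺ cF (remove-⊑ sub)) x∈A) (common (N₂⁺ cG (remove-⊑ subG)) x∈A))
      empty : Empty A
      empty (x , x∈A) = let (F , cF , sub , x∉F) = M.missing-exists r>1 in x∉F (common (N₂⁺ cF (remove-⊑ sub)) x∈A)
        where module M = Missing (isClique cZ) (A⊆Z x∈A) {q} (q+[2+t] (size cZ))

    N₂-cross : ∀ {F G} → N₂ Z F → N₂ Z G → t ≤ ∣ F ∩ G ∣
    N₂-cross {F} {G} (_ , leF) (_ , leG) = ≤-trans (+-cancelˡ-≤ (2 + t) t _ (begin
      2 + t + t ≡⟨ cong suc (sym (+-suc t t)) ⟩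
      suc t + suc t ≤⟨ +-mono-≤ leF leG ⟩
      ∣ F ∩ Z ∣ + ∣ G ∩ Z ∣ ≡⟨ ∣∪∣+∣∩∣ (F ∩ Z) (G ∩ Z) ⟨
      ∣ (F ∩ Z) ∪ (G ∩ Z) ∣ + ∣ (F ∩ Z) ∩ (G ∩ Z) ∣ ≤⟨ +-monoˡ-≤ _ (≤-trans (p⊆q⇒∣p∣≤∣q∣ sub) (≤-reflexive (size cZ))) ⟩
      2 + t + ∣ (F ∩ Z) ∩ (G ∩ Z) ∣ ∎)) (p⊆q⇒∣p∣≤∣q∣ sub′)
      where
      open ≤-Reasoning
      sub : (F ∩ Z) ∪ (G ∩ Z) ⊆ Z
      sub x∈ = [ p∩q⊆q F Z , p∩q⊆q G Z ]′ (x∈p∪q⁻ (F ∩ Z) (G ∩ Z) x∈)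
      sub′ : (F ∩ Z) ∩ (G ∩ Z) ⊆ F ∩ G
      sub′ x∈ = let (x∈F , x∈G) = x∈p∩q⁻ (F ∩ Z) (G ∩ Z) x∈ in x∈p∩q⁺ (p∩q⊆p F Z x∈F , p∩q⊆p G Z x∈G)

    N₂-admissible : AdmissiblePair (N₂ Z) (N₂ Z)
    N₂-admissible = record { cliqueˡ = proj₁ ; cliqueʳ = proj₁ ; cross = N₂-cross
                           ; commonˡ = N₂-common ; commonʳ = N₂-common }

  N₁ : Subset b → Subset b → Subset b → Subset b → Set
  N₁ T L M F = Clique k F × ((T ⊆ F × suc t ≤ ∣ F ∩ L ∣) ⊎ (¬ (T ⊆ F) × ∣ F ∩ M ∣ ≡ k ∸ 2))

  N₁? : ∀ T L M → Decidable (N₁ T L M)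
  N₁? T L M F = clique? k F ×-dec (((T ⊆? F) ×-dec (suc t ≤? ∣ F ∩ L ∣)) ⊎-dec (¬? (T ⊆? F) ×-dec (∣ F ∩ M ∣ ≟ k ∸ 2)))

  -- The two parts of `N₁ T L M`: members through T that meet the q + 1 further blocks of L, and,
  -- for each of the t blocks e of T, members through M - e that miss e. Neither part depends on the
  -- choice of L and M.
  ν₁ : ℕ
  ν₁ = m (2 + q) (1 + q) + w 2 1 * t

  record Sunflower (T L : Subset b) : Set where
    field
      cT  : Clique t T
      cL  : Clique (1 + (t + q)) L
      T⊆L : T ⊆ L

    X : Subset b
    X = L ─ T

    ∈X⁻ : ∀ {x} → x ∈ X → x ∈ L × x ∉ T
    ∈X⁻ {x} x∈ = p─q⊆p L T x∈ , ─-∉ L T x∈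
      where
      ─-∉ : ∀ {b} (A B : Subset b) {x} → x ∈ A ─ B → x ∉ B
      ─-∉ (_ ∷ A) (inside ∷ B) () here
      ─-∉ (_ ∷ A) (_ ∷ B) (there x∈) (there x∈B) = ─-∉ A B x∈ x∈B

    ∣X∣ : ∣ X ∣ ≡ 1 + q
    ∣X∣ = +-cancelˡ-≡ t _ _ (begin
      t + ∣ X ∣ ≡⟨ cong (_+ ∣ X ∣) (size cT) ⟨
      ∣ T ∣ + ∣ X ∣ ≡⟨ ∣∪∣-disjoint T X (λ x∈T x∈X → proj₂ (∈X⁻ x∈X) x∈T) ⟨
      ∣ T ∪ X ∣ ≡⟨ cong ∣_∣ (⊆-antisym fwd bwd) ⟩
      ∣ L ∣ ≡⟨ trans (size cL) (sym (+-suc t q)) ⟩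
      t + suc q ∎)
      where
      open ≡-Reasoning
      fwd : T ∪ X ⊆ L
      fwd x∈ = [ T⊆L , (λ x∈X → proj₁ (∈X⁻ x∈X)) ]′ (x∈p∪q⁻ T X x∈)
      bwd : L ⊆ T ∪ X
      bwd {x} x∈L with x ∈? T
      ... | yes x∈T = p⊆p∪q X x∈T
      ... | no  x∉T = q⊆p∪q T X (x∈p∧x∉q⇒x∈p─q x∈L x∉T)

    cTX : IsClique (T ∪ X)
    cTX = isClique-⊆ (λ x∈ → [ T⊆L , (λ x∈X → proj₁ (∈X⁻ x∈X)) ]′ (x∈p∪q⁻ T X x∈)) (isClique cL)

    meets⁺ : ∀ {F} → suc t ≤ ∣ F ∩ L ∣ → Nonempty (F ∩ X)
    meets⁺ {F} le = let (x , x∈ , x∉T) = ∣∣<⇒∃ T (F ∩ L) (≤-trans (s≤s (≤-reflexive (size cT))) le)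
                        (x∈F , x∈L) = x∈p∩q⁻ F L x∈ in
                    x , x∈p∩q⁺ (x∈F , x∈p∧x∉q⇒x∈p─q x∈L x∉T)

    meets⁻ : ∀ {F} → T ⊆ F → Nonempty (F ∩ X) → suc t ≤ ∣ F ∩ L ∣
    meets⁻ {F} T⊆F (x , x∈) = ≤-trans (≤-reflexive (trans (cong suc (sym (size cT))) (sym (∣⊕∣ x∉T)))) (p⊆q⇒∣p∣≤∣q∣ sub)
      where
      x∈F = proj₁ (x∈p∩q⁻ F X x∈)
      x∈L = proj₁ (∈X⁻ (proj₂ (x∈p∩q⁻ F X x∈)))
      x∉T = proj₂ (∈X⁻ (proj₂ (x∈p∩q⁻ F X x∈)))
      sub : T ⊕ x ⊆ F ∩ L
      sub = ⊕-⊆ (λ y∈ → x∈p∩q⁺ (T⊆F y∈ , T⊆L y∈)) (x∈p∩q⁺ (x∈F , x∈L))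

    near⁺ : ∀ {F} → ∣ F ∩ L ∣ ≡ t + q → L ⊑ F
    near⁺ {F} e = ⊑⁺ L F (size cL) (≤-reflexive (trans (sym e) (cong ∣_∣ (∩-comm F L))))

    near⁻ : ∀ {F} → ¬ (T ⊆ F) → L ⊑ F → ∣ F ∩ L ∣ ≡ t + q
    near⁻ {F} T⊈F al = ≤-antisym
      (≤-pred (≤-trans (p⊂q⇒∣p∣<∣q∣ {p = F ∩ L} {q = L} (p∩q⊆q F L , x , T⊆L x∈T , λ x∈ → x∉F (p∩q⊆p F L x∈))) (≤-reflexive (size cL))))
      (≤-trans (⊑⁻ L F (size cL) al) (≤-reflexive (cong ∣_∣ (∩-comm L F))))
      where
      x = proj₁ (⊈⇒∃ T⊈F)
      x∈T = proj₁ (proj₂ (⊈⇒∃ T⊈F))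
      x∉F = proj₂ (proj₂ (⊈⇒∃ T⊈F))

  N₁-count : ∀ {T L M} → Sunflower T L → Sunflower T M → count (N₁? T L M) ≡ ν₁
  N₁-count {T} {L} {M} sL sM = trans (count-split (N₁? T L M) (T ⊆?_)) (cong₂ _+_ first second)
    where
    module L = Sunflower sL
    module M = Sunflower sM
    out? : Decidable (λ F → N₁ T L M F × ¬ (T ⊆ F))
    out? F = N₁? T L M F ×-dec ¬? (T ⊆? F)
    first : count (λ F → N₁? T L M F ×-dec (T ⊆? F)) ≡ m (2 + q) (1 + q)
    first = trans (count-cong (λ F → N₁? T L M F ×-dec (T ⊆? F)) (meeting? T L.X)
        (λ { F ((cF , inj₁ (_ , le)) , T⊆F) → (cF , T⊆F) , L.meets⁺ le
           ; F ((cF , inj₂ (T⊈F , _)) , T⊆F) → contradiction (λ {x} → T⊆F {x}) T⊈F })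
        (λ F ((cF , T⊆F) , ne) → (cF , inj₁ (T⊆F , L.meets⁻ T⊆F ne)) , T⊆F))
      (count-meeting (1 + q) (2 + q) T L.X (n≤1+n (1 + q)) L.cTX (λ x∈T x∈X → proj₂ (L.∈X⁻ x∈X) x∈T) L.∣X∣ ([2+q]+t (size L.cT)))
    exactly : ∀ e → e ∈ T → count (λ F → out? F ×-dec ¬? (e ∈? F)) ≡ w 2 1
    exactly e e∈T = trans (count-cong (λ F → out? F ×-dec ¬? (e ∈? F)) missing?
        (λ { F (((cF , inj₁ (T⊆F , _)) , T⊈F) , _) → contradiction (λ {x} → T⊆F {x}) T⊈F
           ; F (((cF , inj₂ (_ , sz)) , _) , e∉F) → (cF , ⊑-remove (M.near⁺ sz) (M.T⊆L e∈T) e∉F) , e∉F })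
        (λ F ((cF , sub) , e∉F) → let T⊈F : ¬ (T ⊆ F)
                                      T⊈F T⊆F = e∉F (T⊆F e∈T) in
          ((cF , inj₂ (T⊈F , M.near⁻ T⊈F (remove-⊑ sub))) , T⊈F) , e∉F))
      count-missing
      where open Missing (isClique M.cL) (M.T⊆L e∈T) {1} (cong suc (size M.cL))
    one-missing : ∀ F → N₁ T L M F × ¬ (T ⊆ F) → count (λ e → (e ∈? T) ×-dec ¬? (e ∈? F)) ≤ 1
    one-missing F ((_ , inj₁ (T⊆F , _)) , T⊈F) = contradiction (λ {x} → T⊆F {x}) T⊈F
    one-missing F ((_ , inj₂ (_ , sz)) , _) = count-≤1 (λ e → (e ∈? T) ×-dec ¬? (e ∈? F))
      (λ (x∈ , x∉) (y∈ , y∉) → M.near⁺ sz (M.T⊆L x∈) x∉ (M.T⊆L y∈) y∉)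
    second : count out? ≡ w 2 1 * t
    second = ≤-antisym
      (begin
        count out? ≡⟨ *-identityˡ _ ⟨
        1 * count out? ≤⟨ double-count out? (_∈? T) (λ F e → ¬? (e ∈? F)) 1 (w 2 1)
                                       (λ F (_ , T⊈F) → count-≥1 (λ e → (e ∈? T) ×-dec ¬? (e ∈? F)) (⊈⇒∃ T⊈F))
                                       (λ e e∈T → ≤-reflexive (exactly e e∈T)) ⟩
        w 2 1 * count (_∈? T) ≡⟨ cong (w 2 1 *_) (trans (count-∈ T) (size L.cT)) ⟩
        w 2 1 * t ∎)
      (begin
        w 2 1 * t ≡⟨ cong (w 2 1 *_) (trans (count-∈ T) (size L.cT)) ⟨
        w 2 1 * count (_∈? T) ≤⟨ double-count (_∈? T) out? (λ e F → ¬? (e ∈? F)) (w 2 1) 1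
                                       (λ e e∈T → ≤-reflexive (sym (exactly e e∈T))) one-missing ⟩
        1 * count out? ≡⟨ *-identityˡ _ ⟩
        count out? ∎)
      where open ≤-Reasoning

  sunflower-exists : ∃ λ T → ∃ λ L → Sunflower T L
  sunflower-exists =
    let L , cL        = clique-exists (1 + (t + q)) (n≤1+n _)
        T , T⊆L , sT  = subsetOfSize L t (≤-trans (m≤m+n t q) (≤-trans (n≤1+n _) (≤-reflexive (sym (size cL)))))
    in T , L , record { cT = clique (isClique-⊆ T⊆L (isClique cL)) sT ; cL = cL ; T⊆L = T⊆L }

  module Family₁ {T L : Subset b} (sL : Sunflower T L) where
    open Sunflower sL

    petal-exists : ∀ {x} → x ∈ X → ∀ Y → ∣ Y ∣ ≤ k → ∃ λ F → N₁ T L L F × x ∈ F × (∀ {y} → y ∈ F → y ∈ Y → y ∈ T ⊕ x)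
    petal-exists {x} x∈X Y sY =
      let F , cF , sub , h = avoiding-extension q (T ⊕ x) Y
            (isClique-⊆ (⊕-⊆ T⊆L (proj₁ (∈X⁻ x∈X))) (isClique cL))
            ([1+q]+[1+t] (trans (∣⊕∣ (proj₂ (∈X⁻ x∈X))) (cong suc (size cT)))) (≤-trans (s≤s sY) k<r)
          T⊆F = λ {y} y∈T → sub (A⊆A⊕x T x y∈T)
          x∈F = sub (x∈A⊕x T x)
      in F , (cF , inj₁ ((λ {y} → T⊆F {y}) , meets⁻ (λ {y} → T⊆F {y}) (x , x∈p∩q⁺ (x∈F , x∈X)))) , x∈F , h

    -- Members through two different petals x and y, chosen to avoid each other elsewhere, leave
    -- only T in common; q ≥ 1 supplies the second petal. A member that misses one block e of T then
    -- removes e.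
    N₁-common : ∀ A → (∀ {F} → N₁ T L L F → A ⊆ F) → ∣ A ∣ < t
    N₁-common A common = ≤-trans (s≤s (p⊆q⇒∣p∣≤∣q∣ A⊆T-e)) (≤-reflexive (trans (∣remove∣ (proj₂ e∈)) (size cT)))
      where
      two = ∣∣-2⇒∃₂ X ∅ (≤-trans (s≤s (s≤s (≤-trans (p⊆q⇒∣p∣≤∣q∣ (p∩q⊆q X ∅)) (≤-reflexive (∣⊥∣≡0 b))))) (≤-trans (s≤s 1≤q) (≤-reflexive (sym ∣X∣))))
      A⊆T : A ⊆ T
      A⊆T a∈ = let (x , y , x≢y , (x∈ , _) , (y∈ , _)) = two
                   (F , nF , x∈F , hF) = petal-exists x∈ L (≤-trans (≤-reflexive (size cL)) (n≤1+n _))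
                   (G , nG , y∈G , hG) = petal-exists y∈ F (≤-reflexive (size (proj₁ nF)))
                   a∈F = common nF a∈
               in case ∈-⊕⁻ T y (hG (common nG a∈) a∈F) of λ where
                 (inj₁ a∈T)  → a∈T
                 (inj₂ refl) → case ∈-⊕⁻ T x (hF a∈F (proj₁ (∈X⁻ y∈))) of λ where
                   (inj₁ y∈T) → y∈T
                   (inj₂ y≡x) → contradiction (sym y≡x) x≢y
      e∈ = nonempty T (≤-trans 1≤t (≤-reflexive (sym (size cT))))
      open Missing (isClique cL) (T⊆L (proj₂ e∈)) {1} (cong suc (size cL))
      A⊆T-e : A ⊆ T - proj₁ e∈
      A⊆T-e a∈ = let (F , cF , sub , e∉F) = missing-exists r₂>1
                     T⊈F : ¬ (T ⊆ F)
                     T⊈F T⊆F = e∉F (T⊆F (proj₂ e∈))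
                 in x∈p∧x≢y⇒x∈p-y (A⊆T a∈) (λ { refl → e∉F (common (cF , inj₂ (T⊈F , near⁻ T⊈F (remove-⊑ sub))) a∈) })

    N₁-cross : t ≤ 1 + q → ∀ {F G} → N₁ T L L F → N₁ T L L G → t ≤ ∣ F ∩ G ∣
    N₁-cross t≤ {F} {G} (cF , inj₁ (T⊆F , _)) (cG , inj₁ (T⊆G , _)) =
      ≤-trans (≤-reflexive (sym (size cT))) (p⊆q⇒∣p∣≤∣q∣ (λ x∈ → x∈p∩q⁺ (T⊆F x∈ , T⊆G x∈)))
    N₁-cross t≤ {F} {G} (cF , inj₁ (T⊆F , le)) (cG , inj₂ (T⊈G , sz)) = mixed F G T⊆F le T⊈G sz
      where
      mixed : ∀ F G → T ⊆ F → suc t ≤ ∣ F ∩ L ∣ → ¬ (T ⊆ G) → ∣ G ∩ L ∣ ≡ t + q → t ≤ ∣ F ∩ G ∣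
      mixed F G T⊆F le T⊈G sz = ≤-trans (⊑⁻ (T ⊕ x) G sizeTx (λ a∈ a∉ b∈ b∉ → near⁺ sz (Tx⊆L a∈) a∉ (Tx⊆L b∈) b∉)) (p⊆q⇒∣p∣≤∣q∣ sub)
        where
        x = proj₁ (meets⁺ {F} le)
        x∈F = proj₁ (x∈p∩q⁻ F X (proj₂ (meets⁺ {F} le)))
        x∈X = proj₂ (x∈p∩q⁻ F X (proj₂ (meets⁺ {F} le)))
        sizeTx : ∣ T ⊕ x ∣ ≡ suc t
        sizeTx = trans (∣⊕∣ (proj₂ (∈X⁻ x∈X))) (cong suc (size cT))
        Tx⊆L : T ⊕ x ⊆ L
        Tx⊆L = ⊕-⊆ T⊆L (proj₁ (∈X⁻ x∈X))
        sub : (T ⊕ x) ∩ G ⊆ F ∩ G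
        sub y∈ = let (y∈A , y∈G) = x∈p∩q⁻ (T ⊕ x) G y∈ in x∈p∩q⁺ (⊕-⊆ T⊆F x∈F y∈A , y∈G)
    N₁-cross t≤ {F} {G} nF@(cF , inj₂ _) nG@(cG , inj₁ _) =
      ≤-trans (N₁-cross t≤ nG nF) (≤-reflexive (cong ∣_∣ (∩-comm G F)))
    -- Each of F and G misses just one block of L, and that block lies in T. So both contain all q +
    -- 1 petals, and t ≤ q + 1 is exactly what is required.
    N₁-cross t≤ {F} {G} (cF , inj₂ (T⊈F , szF)) (cG , inj₂ (T⊈G , szG)) =
      ≤-trans t≤ (≤-trans (≤-reflexive (sym ∣X∣)) (p⊆q⇒∣p∣≤∣q∣ (λ x∈ → x∈p∩q⁺ (X⊆ F T⊈F szF x∈ , X⊆ G T⊈G szG x∈))))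
      where
      X⊆ : ∀ F → ¬ (T ⊆ F) → ∣ F ∩ L ∣ ≡ t + q → X ⊆ F
      X⊆ F T⊈F sz x∈ = let (e , e∈T , e∉F) = ⊈⇒∃ T⊈F in
        ∈-stable (λ x∉F → proj₂ (∈X⁻ x∈) (subst (_∈ T) (near⁺ sz (T⊆L e∈T) e∉F (proj₁ (∈X⁻ x∈)) x∉F) e∈T))

    N₁-admissible : t ≤ 1 + q → AdmissiblePair (N₁ T L L) (N₁ T L L)
    N₁-admissible t≤ = record { cliqueˡ = proj₁ ; cliqueʳ = proj₁ ; cross = N₁-cross t≤
                              ; commonˡ = N₁-common ; commonʳ = N₁-common }

  -- Two k-cliques through A that meet the clique Y outside A coincide.
  generic-extension : ∀ {A Y e} → IsClique A → 2 + ∣ A ∣ ≡ k → IsClique Y → e ∉ A →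
    ∃ λ F → Clique k F × A ⊆ F × e ∉ F × (∀ {x} → x ∈ F → x ∈ Y → x ∈ A)
  generic-extension {A} {Y} {e} cA sA cY e∉A
    with anySubset? (λ F → ⊆ᶜ? A F ×-dec (¬? (e ∈? F) ×-dec ((F ∩ Y) ⊆? A)))
  ... | yes (F , (cF , A⊆F) , e∉F , sub) = F , cF , A⊆F , e∉F , λ x∈F x∈Y → sub (x∈p∩q⁺ (x∈F , x∈Y))
  ... | no none = contradiction bound (<⇒≱ 3≤r₂)
    where
    open ≤-Reasoning
    bad? : Decidable (λ F → A ⊆ᶜ F × ¬ (F ∩ Y ⊆ A))
    bad? F = ⊆ᶜ? A F ×-dec ¬? ((F ∩ Y) ⊆? A)
    same : ∀ {F F′} → A ⊆ᶜ F × ¬ (F ∩ Y ⊆ A) → A ⊆ᶜ F′ × ¬ (F′ ∩ Y ⊆ A) → F ≡ F′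
    same {F} {F′} ((cF , A⊆F) , ⊈) ((cF′ , A⊆F′) , ⊈′) = decide (proj₁ p Fin.≟ proj₁ p′)
      where
      p = ⊈⇒∃ ⊈
      p′ = ⊈⇒∃ ⊈′
      x = proj₁ p
      y = proj₁ p′
      x∉A = proj₂ (proj₂ p)
      y∉A = proj₂ (proj₂ p′)
      x∈F = proj₁ (x∈p∩q⁻ F Y (proj₁ (proj₂ p)))
      y∈F′ = proj₁ (x∈p∩q⁻ F′ Y (proj₁ (proj₂ p′)))
      x∈Y = proj₂ (x∈p∩q⁻ F Y (proj₁ (proj₂ p)))
      y∈Y = proj₂ (x∈p∩q⁻ F′ Y (proj₁ (proj₂ p′)))
      decide : Dec (x ≡ y) → F ≡ F′
      decide (yes x≡y) = extension-unique {A ⊕ x} (trans (cong suc (∣⊕∣ x∉A)) sA)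
        (⊕-⊆ A⊆F x∈F) (⊕-⊆ A⊆F′ (subst (_∈ F′) (sym x≡y) y∈F′)) cF cF′
      decide (no x≢y) = trans
        (extension-unique {A ⊕ x} (trans (cong suc (∣⊕∣ x∉A)) sA) (⊕-⊆ A⊆F x∈F) (A⊆A⊕x (A ⊕ x) y) cF cB)
        (extension-unique {A ⊕ y} (trans (cong suc (∣⊕∣ y∉A)) sA)
          (⊕-⊆ (λ z∈ → A⊆A⊕x (A ⊕ x) y (A⊆A⊕x A x z∈)) (x∈A⊕x (A ⊕ x) y)) (⊕-⊆ A⊆F′ y∈F′) cB cF′)
        where
        cB : Clique k (A ⊕ x ⊕ y)
        cB = clique
          (isClique-⊕ (isClique-⊆ (⊕-⊆ A⊆F x∈F) (isClique cF)) (proj₁ (isClique cF′) y y∈F′)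
            (λ z∈ z≢y → case ∈-⊕⁻ A x z∈ of λ where
              (inj₁ z∈A)  → proj₂ (isClique cF′) y _ y∈F′ (A⊆F′ z∈A) (z≢y ∘ sym)
              (inj₂ refl) → proj₂ cY y _ y∈Y x∈Y (z≢y ∘ sym)))
          (trans (∣⊕∣ (λ y∈ → [ y∉A , (λ y≡x → x≢y (sym y≡x)) ]′ (∈-⊕⁻ A x y∈))) (trans (cong suc (∣⊕∣ x∉A)) sA))
    -- Of the r 2 extensions of A at most one contains e and at most one meets Y outside A. A third
    -- one, which r 2 ≥ 3 provides, is the desired clique.
    bound : r 2 ≤ 2
    bound = begin
      r 2 ≡⟨ trans (cong (r 2 *_) u-one) (*-identityʳ (r 2)) ⟨
      r 2 * u 1 ≡⟨ trans (extensions 2 A cA sA) (u-suc 1) ⟨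
      count (⊆ᶜ? A) ≡⟨ count-split (⊆ᶜ? A) (e ∈?_) ⟩
      count (λ F → ⊆ᶜ? A F ×-dec (e ∈? F)) + count (λ F → ⊆ᶜ? A F ×-dec ¬? (e ∈? F))
        ≤⟨ +-mono-≤
             (≤-trans (count-mono (λ F → ⊆ᶜ? A F ×-dec (e ∈? F)) (⊆ᶜ? (A ⊕ e)) (λ F ((cF , A⊆F) , e∈F) → cF , ⊕-⊆ A⊆F e∈F))
               (≤-trans (extensions-≤ 1 (A ⊕ e) (trans (cong suc (∣⊕∣ e∉A)) sA)) (≤-reflexive u-one)))
             (≤-trans (count-mono (λ F → ⊆ᶜ? A F ×-dec ¬? (e ∈? F)) bad?
                 (λ F (h , e∉F) → h , λ sub → none (F , h , e∉F , λ {x} → sub {x})))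
               (count-≤1 bad? same)) ⟩
      2 ∎

  -- For e, e′ in T take F through M - e missing e and G through L - e′ missing e′, both generic, so
  -- that they share only blocks of L ∩ M other than e and e′. The choice e = e′ gives the bound t +
  -- 1; distinct e, e′, available for t ≥ 2, give t + 2. This is the origin of min{t, 2}.
  N₁-cross⇒overlap : ∀ {T L M} → Sunflower T L → Sunflower T M →
    (∀ {F G} → N₁ T L M F → N₁ T M L G → t ≤ ∣ F ∩ G ∣) → t + (t ⊓ 2) ≤ ∣ L ∩ M ∣
  N₁-cross⇒overlap {T} {L} {M} sL sM cross with ∣∣<⇒∃ ∅ T (≤-trans (s≤s (≤-reflexive (∣⊥∣≡0 b))) (≤-trans 1≤t (≤-reflexive (sym (size (Sunflower.cT sL))))))
  ... | e , e∈T , _ = bound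
    where
    module L = Sunflower sL
    module M = Sunflower sM
    pair : ∀ {e e′} → e ∈ T → e′ ∈ T → ∃ λ F → ∃ λ G → N₁ T L M F × N₁ T M L G × (F ∩ G ⊆ (L ∩ M) - e - e′)
    pair {e} {e′} e∈T e′∈T =
      let F , cF , subF , e∉F , hF = generic-extension {M - e} {L} {e} (isClique-⊆ (remove-⊆ M e) (isClique M.cL))
            (cong suc (trans (∣remove∣ (M.T⊆L e∈T)) (size M.cL))) (isClique L.cL) (λ e∈ → proj₂ (∈-remove⁻ M e e∈) refl)
          G , cG , subG , e′∉G , hG = generic-extension {L - e′} {F} {e′} (isClique-⊆ (remove-⊆ L e′) (isClique L.cL))
            (cong suc (trans (∣remove∣ (L.T⊆L e′∈T)) (size L.cL))) (isClique cF) (λ e∈ → proj₂ (∈-remove⁻ L e′ e∈) refl)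
          T⊈F : ¬ (T ⊆ F)
          T⊈F T⊆F = e∉F (T⊆F e∈T)
          T⊈G : ¬ (T ⊆ G)
          T⊈G T⊆G = e′∉G (T⊆G e′∈T)
      in F , G , (cF , inj₂ (T⊈F , M.near⁻ T⊈F (remove-⊑ subF))) , (cG , inj₂ (T⊈G , L.near⁻ T⊈G (remove-⊑ subG))) ,
         λ {x} x∈ → let (x∈F , x∈G) = x∈p∩q⁻ F G x∈
                        (x∈L , x≢e′) = ∈-remove⁻ L e′ (hG x∈G x∈F)
                        (x∈M , x≢e) = ∈-remove⁻ M e (hF x∈F x∈L)
                    in x∈p∧x≢y⇒x∈p-y (x∈p∧x≢y⇒x∈p-y (x∈p∩q⁺ (x∈L , x∈M)) x≢e) x≢e′
    ∈LM : ∀ {x} → x ∈ T → x ∈ L ∩ M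
    ∈LM x∈T = x∈p∩q⁺ (L.T⊆L x∈T , M.T⊆L x∈T)
    one : suc t ≤ ∣ L ∩ M ∣
    one = let (F , G , nF , nG , sub) = pair e∈T e∈T in begin
      suc t ≤⟨ s≤s (cross nF nG) ⟩
      suc ∣ F ∩ G ∣ ≤⟨ s≤s (p⊆q⇒∣p∣≤∣q∣ (λ x∈ → remove-⊆ ((L ∩ M) - e) e (sub x∈))) ⟩
      suc ∣ (L ∩ M) - e ∣ ≡⟨ ∣remove∣ (∈LM e∈T) ⟩
      ∣ L ∩ M ∣ ∎
      where open ≤-Reasoning
    two : 2 ≤ t → 2 + t ≤ ∣ L ∩ M ∣
    two 2≤t with ∣∣<⇒∃ ⁅ e ⁆ T (≤-trans (s≤s (≤-reflexive (∣⁅x⁆∣≡1 e))) (≤-trans 2≤t (≤-reflexive (sym (size L.cT)))))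
    ... | e′ , e′∈T , e′∉ = let (F , G , nF , nG , sub) = pair e∈T e′∈T in begin
      2 + t ≤⟨ s≤s (s≤s (cross nF nG)) ⟩
      2 + ∣ F ∩ G ∣ ≤⟨ s≤s (s≤s (p⊆q⇒∣p∣≤∣q∣ (λ {x} → sub {x}))) ⟩
      2 + ∣ (L ∩ M) - e - e′ ∣ ≡⟨ cong suc (∣remove∣ (x∈p∧x≢y⇒x∈p-y (∈LM e′∈T) (x∉⁅y⁆⇒x≢y e′∉))) ⟩
      suc ∣ (L ∩ M) - e ∣ ≡⟨ ∣remove∣ (∈LM e∈T) ⟩
      ∣ L ∩ M ∣ ∎
      where open ≤-Reasoning
    bound : t + (t ⊓ 2) ≤ ∣ L ∩ M ∣
    bound with 2 ≤? t
    ... | yes 2≤t = ≤-trans (≤-trans (+-monoʳ-≤ t (m⊓n≤n t 2)) (≤-reflexive (+-comm t 2))) (two 2≤t)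
    ... | no ¬2≤t = ≤-trans (≤-trans (+-monoʳ-≤ t (≤-trans (m⊓n≤m t 2) (≤-pred (≰⇒> ¬2≤t)))) (≤-reflexive (+-comm t 1))) one

-- Covers and generators

module Covers (t q : ℕ) {b : ℕ} (S : CliqueSystem b (2 + (t + q)))
  (1≤t : 1 ≤ t) (1≤q : 1 ≤ q)
  (k<r : 2 + (t + q) < CliqueSystem.r S (1 + q)) (3≤r₂ : 3 ≤ CliqueSystem.r S 2) where
  open CliqueSystem S
  open CliqueCounts S
  open ExtremalFamilies t q S 1≤t 1≤q k<r 3≤r₂

  admissible-sym : ∀ {P Q} → AdmissiblePair P Q → AdmissiblePair Q P
  admissible-sym adm = record
    { cliqueˡ = cliqueʳ ; cliqueʳ = cliqueˡ ; commonˡ = commonʳ ; commonʳ = commonˡ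
    ; cross = λ {F} {G} pF qG → ≤-trans (cross qG pF) (≤-reflexive (cong ∣_∣ (∩-comm G F))) }
    where open AdmissiblePair adm

  Cover : (Subset b → Set) → Subset b → Set
  Cover Q A = ∀ {G} → Q G → t ≤ ∣ A ∩ G ∣

  cover-or-witness : ∀ {Q} → Decidable Q → ∀ A → Cover Q A ⊎ ∃ λ G → Q G × ∣ A ∩ G ∣ < t
  cover-or-witness Q? A with anySubset? (λ G → Q? G ×-dec (suc ∣ A ∩ G ∣ ≤? t))
  ... | yes w = inj₂ w
  ... | no ¬w = inj₁ (λ {G} qG → ≮⇒≥ (λ lt → ¬w (G , qG , lt)))

  cover? : ∀ {Q} → Decidable Q → Decidable (Cover Q)
  cover? Q? A with cover-or-witness Q? A
  ... | inj₁ c = yes c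
  ... | inj₂ (G , qG , lt) = no (λ c → <⇒≱ lt (c qG))

  cover-⊆ : ∀ {Q A B} → A ⊆ B → Cover Q A → Cover Q B
  cover-⊆ {A = A} {B} A⊆B c {G} qG = ≤-trans (c qG) (p⊆q⇒∣p∣≤∣q∣ (λ x∈ →
    let (x∈A , x∈G) = x∈p∩q⁻ A G x∈ in x∈p∩q⁺ (A⊆B x∈A , x∈G)))

  Generator : (Subset b → Set) → Subset b → Set
  Generator Q J = Clique (1 + t) J × Cover Q J

  opaque
    generator? : ∀ {Q} → Decidable Q → Decidable (Generator Q)
    generator? Q? J = clique? (1 + t) J ×-dec cover? Q? J

  generator-⊑ : ∀ {Q J G} → Generator Q J → Q G → J ⊑ G
  generator-⊑ {J = J} {G} (cJ , cov) qG = ⊑⁺ J G (size cJ) (cov qG)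

  module Side {P Q : Subset b → Set} (P? : Decidable P) (Q? : Decidable Q) (adm : AdmissiblePair P Q) where
    open AdmissiblePair adm

    nonemptyʳ : ∃ Q
    nonemptyʳ with anySubset? Q?
    ... | yes w = w
    ... | no ¬w = let A , cA = clique-exists k ≤-refl in
      contradiction (≤-trans (m≤n⇒m≤1+n (m≤n⇒m≤1+n (m≤m+n t q))) (≤-reflexive (sym (size cA))))
                    (<⇒≱ (commonʳ A (λ {G} qG → contradiction (G , qG) ¬w)))

    -- A t-cover with at most t blocks would be contained in every member of Q, against the bound on
    -- common blocks.
    cover-size : ∀ A → Cover Q A → 1 + t ≤ ∣ A ∣
    cover-size A cov = ≰⇒> (λ le → <⇒≱ (commonʳ A (λ {G} qG → A⊆ le qG)) t≤)
      where
      t≤ : t ≤ ∣ A ∣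
      t≤ = let G , qG = nonemptyʳ in ≤-trans (cov qG) (∣p∩q∣≤∣p∣ A G)
      A⊆ : ∣ A ∣ ≤ t → ∀ {G} → Q G → A ⊆ G
      A⊆ le {G} qG x∈ = p∩q⊆q A G (⊆∧≥⇒⊇ (A ∩ G) A (p∩q⊆p A G) (≤-trans le (cov qG)) x∈)

    -- A set A that is not a t-cover of Q misses, for some G ∈ Q, a block of F ∩ G.
    branch : ∀ {R} (R? : Decidable R) → (∀ {F} → R F → P F) → ∀ i d A → i + (d + ∣ A ∣) ≡ k →
      (∀ {F B} → R F → B ⊆ F → ∣ B ∣ < d + ∣ A ∣ → ¬ Cover Q B) →
      count (λ F → R? F ×-dec (A ⊆? F)) ≤ k ^ d * u i
    branch R? R⊆P i zero A e noCover = ≤-trans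
      (count-mono (λ F → R? F ×-dec (A ⊆? F)) (⊆ᶜ? A) (λ F (rF , A⊆F) → cliqueˡ (R⊆P rF) , A⊆F))
      (≤-trans (extensions-≤ i A e) (≤-reflexive (sym (*-identityˡ (u i)))))
    branch {R} R? R⊆P i (suc d) A e noCover with cover-or-witness Q? A
    ... | inj₁ cov = ≤-trans (≤-reflexive (count-≡0 (λ F → R? F ×-dec (A ⊆? F))
            (λ F (rF , A⊆F) → noCover rF A⊆F (s≤s (m≤n+m ∣ A ∣ d)) cov))) z≤n
    ... | inj₂ (G , qG , lt) = begin
        count (λ F → R? F ×-dec (A ⊆? F)) ≤⟨ union-bound (λ F → R? F ×-dec (A ⊆? F)) new? (λ F x → x ∈? F) (k ^ d * u i) hit rec ⟩
        count new? * (k ^ d * u i) ≤⟨ *-monoˡ-≤ (k ^ d * u i) (≤-trans (count-mono new? (_∈? G) (λ _ → proj₁))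
                                                  (≤-reflexive (trans (count-∈ G) (size (cliqueʳ qG))))) ⟩
        k * (k ^ d * u i) ≡⟨ *-assoc k (k ^ d) (u i) ⟨
        k ^ suc d * u i ∎
      where
      open ≤-Reasoning
      new? : Decidable (λ x → x ∈ G × x ∉ A)
      new? x = (x ∈? G) ×-dec ¬? (x ∈? A)
      hit : ∀ F → R F × A ⊆ F → ∃ λ x → (x ∈ G × x ∉ A) × x ∈ F
      hit F (rF , A⊆F) =
        let x , x∈ , x∉ = ∣∣<⇒∃ (A ∩ G) (F ∩ G) (≤-trans lt (cross (R⊆P rF) qG))
            x∈F , x∈G = x∈p∩q⁻ F G x∈
        in x , (x∈G , λ x∈A → x∉ (x∈p∩q⁺ (x∈A , x∈G))) , x∈F
      rec : ∀ x → x ∈ G × x ∉ A → count (λ F → (R? F ×-dec (A ⊆? F)) ×-dec (x ∈? F)) ≤ k ^ d * u i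
      rec x (_ , x∉A) = ≤-trans
        (count-mono (λ F → (R? F ×-dec (A ⊆? F)) ×-dec (x ∈? F)) (λ F → R? F ×-dec ((A ⊕ x) ⊆? F))
          (λ F ((rF , A⊆F) , x∈F) → rF , ⊕-⊆ A⊆F x∈F))
        (branch R? R⊆P i d (A ⊕ x) (trans (cong (i +_) shift) e)
          (λ rF B⊆F lt′ → noCover rF B⊆F (≤-trans lt′ (≤-reflexive shift))))
        where
        shift : d + ∣ A ⊕ x ∣ ≡ suc d + ∣ A ∣
        shift = trans (cong (d +_) (∣⊕∣ x∉A)) (+-suc d ∣ A ∣)

    -- Every F in R contains some t-subset of the cover C of P, which gives the binomial factor;
    -- from that t-set `branch` adds d blocks using members of Q.
    branch-from-cover : ∀ {R} (R? : Decidable R) → (∀ {F} → R F → P F) → ∀ C → Cover P C →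
      ∀ i d → i + (d + t) ≡ k → (∀ {F B} → R F → B ⊆ F → ∣ B ∣ < d + t → ¬ Cover Q B) →
      count R? ≤ binom ∣ C ∣ t * (k ^ d * u i)
    branch-from-cover {R} R? R⊆P C cov i d e noCover = ≤-trans
      (union-bound R? (⊆₌? C t) (λ F T → T ⊆? F) (k ^ d * u i) hit rec)
      (≤-reflexive (cong (_* (k ^ d * u i)) (count-choose C t)))
      where
      hit : ∀ F → R F → ∃ λ T → (T ⊆ C × ∣ T ∣ ≡ t) × T ⊆ F
      hit F rF = let T , T⊆ , sT = subsetOfSize (C ∩ F) t (cov (R⊆P rF)) in
        T , ((λ x∈ → p∩q⊆p C F (T⊆ x∈)) , sT) , (λ x∈ → p∩q⊆q C F (T⊆ x∈))
      rec : ∀ T → T ⊆ C × ∣ T ∣ ≡ t → count (λ F → R? F ×-dec (T ⊆? F)) ≤ k ^ d * u i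
      rec T (_ , sT) = branch R? R⊆P i d T (trans (cong (λ a → i + (d + a)) sT) e)
        (λ rF B⊆F lt → noCover rF B⊆F (≤-trans lt (≤-reflexive (cong (d +_) sT))))

    -- Members through a generator number at most `u (1 + q)` for each. A member through none
    -- contains no t-cover of Q with at most t + 1 blocks, so from a t-subset of C it can be
    -- branched twice, and this remainder is of order `u q`.
    generated-bound : ∀ C → Cover P C → ∣ C ∣ ≡ 1 + t →
      count P? ≤ count (generator? Q?) * u (1 + q) + binom (1 + t) t * (k ^ 2 * u q)
    generated-bound C cov sC = begin
      count P? ≡⟨ count-split P? gen? ⟩
      count (λ F → P? F ×-dec gen? F) + count (λ F → P? F ×-dec ¬? (gen? F)) ≤⟨ +-mono-≤ main rest ⟩
      count (generator? Q?) * u (1 + q) + binom (1 + t) t * (k ^ 2 * u q) ∎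
      where
      open ≤-Reasoning
      gen? : Decidable (λ F → ∃ λ J → Generator Q J × J ⊆ F)
      gen? F = anySubset? (λ J → generator? Q? J ×-dec (J ⊆? F))
      main : count (λ F → P? F ×-dec gen? F) ≤ count (generator? Q?) * u (1 + q)
      main = union-bound (λ F → P? F ×-dec gen? F) (generator? Q?) (λ F J → J ⊆? F) (u (1 + q)) (λ F → proj₂)
        (λ J (cJ , _) → ≤-trans
          (count-mono (λ F → (P? F ×-dec gen? F) ×-dec (J ⊆? F)) (⊆ᶜ? J) (λ F ((pF , _) , J⊆F) → cliqueˡ pF , J⊆F))
          (extensions-≤ (1 + q) J ([1+q]+[1+t] (size cJ))))
      rest : count (λ F → P? F ×-dec ¬? (gen? F)) ≤ binom (1 + t) t * (k ^ 2 * u q)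
      rest = subst (λ s → count (λ F → P? F ×-dec ¬? (gen? F)) ≤ binom s t * (k ^ 2 * u q)) sC
        (branch-from-cover (λ F → P? F ×-dec ¬? (gen? F)) proj₁ C cov q 2 (q+[2+t] refl)
          (λ {F} {B} (pF , ¬gen) B⊆F lt covB → ¬gen (B ,
            (clique (isClique-⊆ B⊆F (isClique (cliqueˡ pF))) (≤-antisym (≤-pred lt) (cover-size B covB)) , covB) , B⊆F)))

    -- The generators through a t-set T, read off a member G₀ of Q that does not contain T.
    module Petals {T : Subset b} (sT : ∣ T ∣ ≡ t) {J₀ : Subset b} (gJ₀ : Generator Q J₀) (T⊆J₀ : T ⊆ J₀) where

      T-not-cover : ∃ λ G → Q G × ∣ T ∩ G ∣ < t
      T-not-cover with cover-or-witness Q? T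
      ... | inj₁ cov = contradiction (cover-size T cov) (<⇒≱ (s≤s (≤-reflexive sT)))
      ... | inj₂ w   = w

      G₀ : Subset b
      G₀ = proj₁ T-not-cover
      qG₀ : Q G₀
      qG₀ = proj₁ (proj₂ T-not-cover)

      T⊈G₀ : ¬ (T ⊆ G₀)
      T⊈G₀ T⊆ = <⇒≱ (proj₂ (proj₂ T-not-cover)) (≤-trans (≤-reflexive (sym sT)) (p⊆q⇒∣p∣≤∣q∣ (λ x∈ → x∈p∩q⁺ (x∈ , T⊆ x∈))))

      e : Fin b
      e = proj₁ (⊈⇒∃ T⊈G₀)
      e∈T : e ∈ T
      e∈T = proj₁ (proj₂ (⊈⇒∃ T⊈G₀))
      e∉G₀ : e ∉ G₀
      e∉G₀ = proj₂ (proj₂ (⊈⇒∃ T⊈G₀))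

      cT : IsClique T
      cT = isClique-⊆ T⊆J₀ (isClique (proj₁ gJ₀))

      T-e⊆G₀ : T - e ⊆ G₀
      T-e⊆G₀ x∈ = let (x∈T , x≢e) = ∈-remove⁻ T e x∈ in
        ∈-stable (λ x∉ → x≢e (generator-⊑ gJ₀ qG₀ (T⊆J₀ x∈T) x∉ (T⊆J₀ e∈T) e∉G₀))

      petal? : Decidable (λ x → x ∈ G₀ × x ∉ T × Compatible e x)
      petal? x = (x ∈? G₀) ×-dec (¬? (x ∈? T) ×-dec compatible? e x)

      Y : Subset b
      Y = comprehension petal?

      Y⁻ : ∀ {x} → x ∈ Y → x ∈ G₀ × x ∉ T × Compatible e x
      Y⁻ = ∈-comprehension⁻ petal?

      -- T - e and Y are disjoint parts of G₀ and compatible with e, while e conflicts with two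
      -- blocks of G₀. Hence (t - 1) + |Y| ≤ k - 2.
      ∣Y∣≤ : ∣ Y ∣ ≤ 1 + q
      ∣Y∣≤ = let f , g , f≢g , (f∈ , ¬ef) , (g∈ , ¬eg) = two-conflicts (s≤s z≤n) (cliqueʳ qG₀) (proj₁ cT e e∈T) e∉G₀ in
        +-cancelˡ-≤ t ∣ Y ∣ (1 + q) (≤-pred (≤-pred (begin
          2 + (t + ∣ Y ∣) ≡⟨ cong (λ a → 2 + (a + ∣ Y ∣)) (trans (sym sT) (sym (∣remove∣ e∈T))) ⟩
          3 + (∣ T - e ∣ + ∣ Y ∣) ≡⟨ cong (3 +_) (∣∪∣-disjoint (T - e) Y (λ x∈T x∈Y → proj₁ (proj₂ (Y⁻ x∈Y)) (remove-⊆ T e x∈T))) ⟨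
          3 + ∣ (T - e) ∪ Y ∣ ≤⟨ s≤s (s≤s (s≤s (p⊆q⇒∣p∣≤∣q∣ (λ x∈ → inside-G₀ f∈ ¬ef g∈ ¬eg (x∈p∪q⁻ (T - e) Y x∈))))) ⟩
          3 + ∣ G₀ - f - g ∣ ≡⟨ cong (2 +_) (∣remove∣ (x∈p∧x≢y⇒x∈p-y g∈ (f≢g ∘ sym))) ⟩
          2 + ∣ G₀ - f ∣ ≡⟨ cong suc (∣remove∣ f∈) ⟩
          1 + ∣ G₀ ∣ ≡⟨ cong suc (size (cliqueʳ qG₀)) ⟩
          3 + (t + q) ≡⟨ cong (2 +_) (+-suc t q) ⟨
          2 + (t + (1 + q)) ∎)))
        where
        open ≤-Reasoning
        compat : ∀ {x} → x ∈ T - e ⊎ x ∈ Y → Compatible e x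
        compat (inj₁ x∈) = let (x∈T , x≢e) = ∈-remove⁻ T e x∈ in proj₂ cT e _ e∈T x∈T (x≢e ∘ sym)
        compat (inj₂ x∈) = proj₂ (proj₂ (Y⁻ x∈))
        inside-G₀ : ∀ {f g x} → f ∈ G₀ → ¬ Compatible e f → g ∈ G₀ → ¬ Compatible e g → x ∈ T - e ⊎ x ∈ Y → x ∈ G₀ - f - g
        inside-G₀ f∈ ¬ef g∈ ¬eg x∈ = x∈p∧x≢y⇒x∈p-y (x∈p∧x≢y⇒x∈p-y
          ([ T-e⊆G₀ , (λ x∈Y → proj₁ (Y⁻ x∈Y)) ]′ x∈)
          (λ { refl → ¬ef (compat x∈) })) (λ { refl → ¬eg (compat x∈) })

      through? : Decidable (λ J → Generator Q J × T ⊆ J)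
      through? J = generator? Q? J ×-dec (T ⊆? J)

      ≡T⊕ : ∀ {J x} → Clique (1 + t) J → T ⊆ J → x ∈ J → x ∉ T → T ⊕ x ≡ J
      ≡T⊕ {J} {x} cJ T⊆J x∈J x∉T = ⊆∧≥⇒≡ (T ⊕ x) J (⊕-⊆ T⊆J x∈J)
        (≤-reflexive (trans (size cJ) (sym (trans (∣⊕∣ x∉T) (cong suc sT)))))

      good? : Decidable (λ x → x ∈ Y × Generator Q (T ⊕ x))
      good? x = (x ∈? Y) ×-dec generator? Q? (T ⊕ x)

      -- A generator through T has the form T ⊕ x. It misses e in G₀ and can miss nothing else, so x
      -- lies in G₀; and x is compatible with e because both lie in one clique.
      count-through : count through? ≤ count good?
      count-through = ≤-trans (union-bound through? good? (λ J x → x ∈? J) 1 hit single) (≤-reflexive (*-identityʳ _))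
        where
        hit : ∀ J → Generator Q J × T ⊆ J → ∃ λ x → (x ∈ Y × Generator Q (T ⊕ x)) × x ∈ J
        hit J (gJ , T⊆J) =
          let x , x∈J , x∉T = ∣∣<⇒∃ T J (≤-trans (s≤s (≤-reflexive sT)) (≤-reflexive (sym (size (proj₁ gJ)))))
              e≢x = λ e≡x → x∉T (subst (_∈ T) e≡x e∈T)
              x∈G₀ = ∈-stable (λ x∉ → e≢x (generator-⊑ gJ qG₀ (T⊆J e∈T) e∉G₀ x∈J x∉))
          in x , (∈-comprehension⁺ petal? (x∈G₀ , x∉T , proj₂ (isClique (proj₁ gJ)) e x (T⊆J e∈T) x∈J e≢x) ,
                  subst (Generator Q) (sym (≡T⊕ (proj₁ gJ) T⊆J x∈J x∉T)) gJ) , x∈J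
        single : ∀ x → x ∈ Y × Generator Q (T ⊕ x) → count (λ J → through? J ×-dec (x ∈? J)) ≤ 1
        single x (x∈Y , _) = count-≤1 (λ J → through? J ×-dec (x ∈? J))
          (λ ((gJ , T⊆J) , x∈J) ((gK , T⊆K) , x∈K) → let x∉T = proj₁ (proj₂ (Y⁻ x∈Y)) in
            trans (sym (≡T⊕ (proj₁ gJ) T⊆J x∈J x∉T)) (≡T⊕ (proj₁ gK) T⊆K x∈K x∉T))

      good≤Y : count good? ≤ ∣ Y ∣
      good≤Y = ≤-trans (count-mono good? (_∈? Y) (λ _ → proj₁)) (≤-reflexive (count-∈ Y))

      module Maximum (max : 1 + q ≤ count through?) where

        ∣Y∣≡ : ∣ Y ∣ ≡ 1 + q
        ∣Y∣≡ = ≤-antisym ∣Y∣≤ (≤-trans max (≤-trans count-through good≤Y))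

        all-good : ∀ {x} → x ∈ Y → Generator Q (T ⊕ x)
        all-good {x} x∈Y = proj₂ (count-full good? (_∈? Y) (λ _ → proj₁)
          (≤-trans (≤-reflexive (trans (count-∈ Y) ∣Y∣≡)) (≤-trans max count-through)) x x∈Y)

        L : Subset b
        L = T ∪ Y

        sunflower : Sunflower T L
        sunflower = record
          { cT = clique cT sT
          ; T⊆L = p⊆p∪q Y
          ; cL = clique
              ( (λ j j∈ → [ proj₁ cT j , (λ j∈Y → proj₁ cG j (proj₁ (Y⁻ j∈Y))) ]′ (x∈p∪q⁻ T Y j∈))
              , (λ i j i∈ j∈ i≢j → case x∈p∪q⁻ T Y i∈ , x∈p∪q⁻ T Y j∈ of λ where
                  (inj₁ i∈T , inj₁ j∈T) → proj₂ cT i j i∈T j∈T i≢j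
                  (inj₁ i∈T , inj₂ j∈Y) → mixed i∈T j∈Y
                  (inj₂ i∈Y , inj₁ j∈T) → compatible-sym (mixed j∈T i∈Y)
                  (inj₂ i∈Y , inj₂ j∈Y) → proj₂ cG i j (proj₁ (Y⁻ i∈Y)) (proj₁ (Y⁻ j∈Y)) i≢j))
              (trans (∣∪∣-disjoint T Y (λ x∈T x∈Y → proj₁ (proj₂ (Y⁻ x∈Y)) x∈T)) (trans (cong₂ _+_ sT ∣Y∣≡) (+-suc t q)))
          }
          where
          cG : IsClique G₀
          cG = isClique (cliqueʳ qG₀)
          mixed : ∀ {x y} → x ∈ T → y ∈ Y → Compatible x y
          mixed {x} {y} x∈T y∈Y with x Fin.≟ e
          ... | yes refl = proj₂ (proj₂ (Y⁻ y∈Y))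
          ... | no x≢e = proj₂ cG x y (T-e⊆G₀ (x∈p∧x≢y⇒x∈p-y x∈T x≢e)) (proj₁ (Y⁻ y∈Y))
                           (λ { refl → proj₁ (proj₂ (Y⁻ y∈Y)) x∈T })

        -- F shares t blocks with G₀ and T fewer, so F has a block x of G₀ outside T. As e and x are
        -- both in F they are compatible, and x is a petal.
        P-meets : ∀ {F} → P F → T ⊆ F → suc t ≤ ∣ F ∩ L ∣
        P-meets {F} pF T⊆F =
          let x , x∈ , x∉ = ∣∣<⇒∃ (T ∩ G₀) (F ∩ G₀) (≤-trans (proj₂ (proj₂ T-not-cover)) (cross pF qG₀))
              x∈F , x∈G₀ = x∈p∩q⁻ F G₀ x∈
              x∉T = λ x∈T → x∉ (x∈p∩q⁺ (x∈T , x∈G₀))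
              x∈Y = ∈-comprehension⁺ petal? (x∈G₀ , x∉T ,
                      proj₂ (isClique (cliqueˡ pF)) e x (T⊆F e∈T) x∈F (λ e≡x → x∉T (subst (_∈ T) e≡x e∈T)))
          in Sunflower.meets⁻ sunflower T⊆F (x , x∈p∩q⁺ (x∈F , x∈p∧x∉q⇒x∈p─q (q⊆p∪q T Y x∈Y) x∉T))

        -- G misses some z in T. Every T ⊕ x with x in Y is a generator and can lose only one block
        -- to G, so G contains all of Y and misses nothing of T besides z.
        Q-near : ∀ {G} → Q G → ¬ (T ⊆ G) → ∣ G ∩ L ∣ ≡ t + q
        Q-near {G} qG T⊈G = Sunflower.near⁻ sunflower T⊈G almost
          where
          y∈Y = nonempty Y (≤-trans (s≤s z≤n) (≤-reflexive (sym ∣Y∣≡)))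
          T⊑G : ∀ {x y} → x ∈ T → x ∉ G → y ∈ T → y ∉ G → x ≡ y
          T⊑G x∈ x∉ y∈ y∉ = generator-⊑ (all-good (proj₂ y∈Y)) qG (A⊆A⊕x T _ x∈) x∉ (A⊆A⊕x T _ y∈) y∉
          Y⊆G : Y ⊆ G
          Y⊆G {x} x∈Y = let (z , z∈T , z∉G) = ⊈⇒∃ T⊈G in
            ∈-stable (λ x∉G → proj₁ (proj₂ (Y⁻ x∈Y)) (subst (_∈ T) (generator-⊑ (all-good x∈Y) qG (A⊆A⊕x T x z∈T) z∉G (x∈A⊕x T x) x∉G) z∈T))
          in-T : ∀ {x} → x ∈ L → x ∉ G → x ∈ T
          in-T x∈ x∉ = [ id , (λ x∈Y → contradiction (Y⊆G x∈Y) x∉) ]′ (x∈p∪q⁻ T Y x∈)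
          almost : L ⊑ G
          almost x∈ x∉ y∈ y∉ = T⊑G (in-T x∈ x∉) x∉ (in-T y∈ y∉) y∉

    through-bound : ∀ T → ∣ T ∣ ≡ t → count (λ J → generator? Q? J ×-dec (T ⊆? J)) ≤ 1 + q
    through-bound T sT with anySubset? (λ J → generator? Q? J ×-dec (T ⊆? J))
    ... | no none = ≤-trans (≤-reflexive (count-≡0 (λ J → generator? Q? J ×-dec (T ⊆? J)) (λ J h → none (J , h)))) z≤n
    ... | yes (J , gJ , T⊆J) = ≤-trans count-through (≤-trans good≤Y ∣Y∣≤)
      where open Petals sT gJ T⊆J

  record Maximal {P Q : Subset b → Set} (P? : Decidable P) (Q? : Decidable Q) : Set₁ where
    field
      adm     : AdmissiblePair P Q
      maximal : ∀ {P′ Q′} (P′? : Decidable P′) (Q′? : Decidable Q′) → AdmissiblePair P′ Q′ →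
                count P′? * count Q′? ≤ count P? * count Q?
    open AdmissiblePair adm public

  maximal-sym : ∀ {P Q} {P? : Decidable P} {Q? : Decidable Q} → Maximal P? Q? → Maximal Q? P?
  maximal-sym {P? = P?} {Q?} max = record
    { adm = admissible-sym (Maximal.adm max)
    ; maximal = λ P′? Q′? adm′ → ≤-trans (≤-reflexive (*-comm (count P′?) (count Q′?)))
        (≤-trans (Maximal.maximal max Q′? P′? (admissible-sym adm′)) (≤-reflexive (*-comm (count P?) (count Q?)))) }

  -- Adding F to P keeps the pair admissible, since a larger family has no more common blocks. As Q
  -- is nonempty, a new F would increase the product.
  closed : ∀ {P Q} {P? : Decidable P} {Q? : Decidable Q} → Maximal P? Q? → ∀ {F} → Clique k F → Cover Q F → P F
  closed {P? = P?} {Q?} max {F} cF cov = decidable-stable (P? F) λ ¬pF →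
    let P⁺? = λ X → P? X ⊎-dec (X ≟ˢ F)
        adm⁺ = record
          { cliqueˡ = λ { (inj₁ pX) → cliqueˡ pX ; (inj₂ refl) → cF }
          ; cliqueʳ = cliqueʳ
          ; cross = λ { (inj₁ pX) qG → cross pX qG ; (inj₂ refl) qG → cov qG }
          ; commonˡ = λ A h → commonˡ A (λ pX → h (inj₁ pX))
          ; commonʳ = commonʳ }
    in <⇒≱ (*-monoˡ-< (count Q?) ⦃ >-nonZero (count-≥1 Q? (Side.nonemptyʳ P? Q? adm)) ⦄
              (count-⊂ P? P⁺? (λ X → inj₁) {F} (inj₂ refl) ¬pF))
           (maximal P⁺? Q? adm⁺)
    where open Maximal max

  -- All partitions through J lie in P and all those through K lie in Q by `closed`. Choosing F
  -- through J that avoids K outside J, and G through K that avoids F outside K, leaves F ∩ G inside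
  -- J ∩ K.
  generators-cross : ∀ {P Q} {P? : Decidable P} {Q? : Decidable Q} → Maximal P? Q? →
    ∀ {J K} → Generator Q J → Generator P K → J ⊑ K
  generators-cross max {J} {K} (cJ , covJ) (cK , covK) =
    let F , cF , J⊆F , hF = avoiding-extension q J K (isClique cJ) ([1+q]+[1+t] (size cJ))
          (≤-trans (s≤s (≤-trans (≤-reflexive (size cK)) (s≤s (m≤n⇒m≤1+n (m≤m+n t q))))) k<r)
        G , cG , K⊆G , hG = avoiding-extension q K F (isClique cK) ([1+q]+[1+t] (size cK))
          (≤-trans (s≤s (≤-reflexive (size cF))) k<r)
    in ⊑⁺ J K (size cJ) (≤-trans
         (Maximal.cross max (closed max cF (cover-⊆ J⊆F covJ)) (closed (maximal-sym max) cG (cover-⊆ K⊆G covK)))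
         (p⊆q⇒∣p∣≤∣q∣ (λ x∈ → let (x∈F , x∈G) = x∈p∩q⁻ F G x∈
                                  x∈K = hG x∈G x∈F in x∈p∩q⁺ (hF x∈F x∈K , x∈K))))

-- Classification of the generators

count-list : {A : Set} ⦃ _ : Enum A ⦄ {P : A → Set} (P? : Decidable P) → (∀ x y → Dec (x ≡ y)) →
  ∀ xs → (∀ {x} → P x → x ∈ˡ xs) → count P? ≤ length xs
count-list P? _≟′_ []       h = ≤-reflexive (count-≡0 P? (λ x px → case h px of λ ()))
count-list {P = P} P? _≟′_ (y ∷ ys) h = begin
    count P? ≡⟨ count-split P? (_≟′ y) ⟩
    count (λ x → P? x ×-dec (x ≟′ y)) + count (λ x → P? x ×-dec ¬? (x ≟′ y)) ≤⟨ +-mono-≤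
      (count-≤1 (λ x → P? x ×-dec (x ≟′ y)) (λ (_ , x≡y) (_ , z≡y) → trans x≡y (sym z≡y)))
      (count-list (λ x → P? x ×-dec ¬? (x ≟′ y)) _≟′_ ys tail) ⟩
    suc (length ys) ∎
  where
  open ≤-Reasoning
  tail : ∀ {x} → P x × x ≢ y → x ∈ˡ ys
  tail (px , x≢y) with h px
  ... | here x≡y = contradiction x≡y x≢y
  ... | there x∈ = x∈

module _ {A : Set} {a b c d x : A} where

  ∈-drop₃ : x ∈ˡ a ∷ b ∷ c ∷ d ∷ [] → x ≢ c → x ∈ˡ a ∷ b ∷ d ∷ []
  ∈-drop₃ (here e)                         _   = here e
  ∈-drop₃ (there (here e))                 _   = there (here e)
  ∈-drop₃ (there (there (here e)))         x≢c = contradiction e x≢c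
  ∈-drop₃ (there (there (there (here e)))) _   = there (there (here e))

  ∈-drop₄ : x ∈ˡ a ∷ b ∷ c ∷ d ∷ [] → x ≢ d → x ∈ˡ a ∷ b ∷ c ∷ []
  ∈-drop₄ (here e)                         _   = here e
  ∈-drop₄ (there (here e))                 _   = there (here e)
  ∈-drop₄ (there (there (here e)))         _   = there (there (here e))
  ∈-drop₄ (there (there (there (here e)))) x≢d = contradiction e x≢d

  ∈-drop₃₄ : x ∈ˡ a ∷ b ∷ c ∷ d ∷ [] → x ≢ c → x ≢ d → x ∈ˡ a ∷ b ∷ []
  ∈-drop₃₄ (here e)                         _   _   = here e
  ∈-drop₃₄ (there (here e))                 _   _   = there (here e)
  ∈-drop₃₄ (there (there (here e)))         x≢c _   = contradiction e x≢c
  ∈-drop₃₄ (there (there (there (here e)))) _   x≢d = contradiction e x≢d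

count-≥2⁻ : ∀ {b} {P : Subset b → Set} (P? : Decidable P) → 2 ≤ count P? → ∃ λ A → ∃ λ B → P A × P B × A ≢ B
count-≥2⁻ {P = P} P? le with anySubset? (λ A → anySubset? (λ B → P? A ×-dec (P? B ×-dec ¬? (A ≟ˢ B))))
... | yes w = w
... | no ¬w = contradiction (count-≤1 P? (λ {A} {B} pA pB → decidable-stable (A ≟ˢ B) (λ A≢B → ¬w (A , B , pA , pB , A≢B)))) (<⇒≱ le)

binom-n-n : ∀ m → binom m m ≡ 1
binom-n->n : ∀ m d → binom m (suc (d + m)) ≡ 0
binom-n->n zero    d = refl
binom-n->n (suc m) d = cong₂ _+_ (trans (cong (binom m) (+-suc d m)) (binom-n->n m d))
                                 (trans (cong (λ j → binom m (suc j)) (+-suc d m)) (binom-n->n m (suc d)))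
binom-n-n zero    = refl
binom-n-n (suc m) = cong₂ _+_ (binom-n-n m) (binom-n->n m 0)

binom-[1+n]-n : ∀ m → binom (suc m) m ≡ suc m
binom-[1+n]-n zero    = refl
binom-[1+n]-n (suc m) = trans (cong₂ _+_ (binom-[1+n]-n m) (binom-n-n (suc m))) (+-comm (suc m) 1)

module _ {b : ℕ} where

  ⊑-sym : ∀ {s} (A B : Subset b) → ∣ A ∣ ≡ suc s → ∣ B ∣ ≡ suc s → A ⊑ B → B ⊑ A
  ⊑-sym A B sA sB al = ⊑⁺ B A sB (≤-trans (⊑⁻ A B sA al) (≤-reflexive (cong ∣_∣ (∩-comm A B))))

  ⊆-remove₂ : ∀ {A W : Subset b} {x y} → A ⊆ W → x ∉ A → y ∉ A → A ⊆ W - x - y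
  ⊆-remove₂ A⊆W x∉ y∉ z∈ = x∈p∧x≢y⇒x∈p-y (x∈p∧x≢y⇒x∈p-y (A⊆W z∈) (λ { refl → x∉ z∈ })) (λ { refl → y∉ z∈ })

  ∈-remove₂⁻ : ∀ (W : Subset b) x y {z} → z ∈ W - x - y → z ∈ W × z ≢ x × z ≢ y
  ∈-remove₂⁻ W x y z∈ = let (z∈′ , z≢y) = ∈-remove⁻ (W - x) y z∈
                            (z∈W , z≢x) = ∈-remove⁻ W x z∈′ in z∈W , z≢x , z≢y

  ∉-remove₂⁻ : ∀ (W : Subset b) x y {z} → z ∈ W → z ∉ W - x - y → z ≡ x ⊎ z ≡ y
  ∉-remove₂⁻ W x y {z} z∈W z∉ with z Fin.≟ x | z Fin.≟ y
  ... | yes z≡x | _       = inj₁ z≡x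
  ... | no _    | yes z≡y = inj₂ z≡y
  ... | no z≢x  | no z≢y  = contradiction (x∈p∧x≢y⇒x∈p-y (x∈p∧x≢y⇒x∈p-y z∈W z≢x) z≢y) z∉

  ∣remove₂∣ : ∀ {W : Subset b} {x y} → x ∈ W → y ∈ W → x ≢ y → 2 + ∣ W - x - y ∣ ≡ ∣ W ∣
  ∣remove₂∣ x∈ y∈ x≢y = trans (cong suc (∣remove∣ (x∈p∧x≢y⇒x∈p-y y∈ (x≢y ∘ sym)))) (∣remove∣ x∈)

  pair≡ : ∀ {A : Subset b} {x y} → ∣ A ∣ ≡ 2 → x ∈ A → y ∈ A → x ≢ y → ⁅ x ⁆ ∪ ⁅ y ⁆ ≡ A
  pair≡ {A} {x} {y} sA x∈ y∈ x≢y = ⊆∧≥⇒≡ (⁅ x ⁆ ∪ ⁅ y ⁆) A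
    (⊕-⊆ (λ z∈ → subst (_∈ A) (sym (x∈⁅y⁆⇒x≡y x z∈)) x∈) y∈)
    (≤-reflexive (trans sA (sym (trans (∣⊕∣ (λ y∈x → x≢y (sym (x∈⁅y⁆⇒x≡y x y∈x)))) (cong suc (∣⁅x⁆∣≡1 x))))))

  module Adjacent {s : ℕ} (K₁ K₂ : Subset b) (s₁ : ∣ K₁ ∣ ≡ suc s) (s₂ : ∣ K₂ ∣ ≡ suc s)
                  (K₁≢K₂ : K₁ ≢ K₂) (le : s ≤ ∣ K₁ ∩ K₂ ∣) where
    T Z : Subset b
    T = K₁ ∩ K₂
    Z = K₁ ∪ K₂

    ∣T∣ : ∣ T ∣ ≡ s
    ∣T∣ = ≤-antisym (≤-pred (≰⇒> (λ ge → K₁≢K₂ (trans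
        (sym (⊆∧≥⇒≡ T K₁ (p∩q⊆p K₁ K₂) (≤-trans (≤-reflexive s₁) ge)))
        (⊆∧≥⇒≡ T K₂ (p∩q⊆q K₁ K₂) (≤-trans (≤-reflexive s₂) ge)))))) le

    ∣Z∣ : ∣ Z ∣ ≡ 2 + s
    ∣Z∣ = +-cancelʳ-≡ s ∣ Z ∣ (2 + s) (begin
      ∣ Z ∣ + s ≡⟨ cong (∣ Z ∣ +_) ∣T∣ ⟨
      ∣ Z ∣ + ∣ T ∣ ≡⟨ ∣∪∣+∣∩∣ K₁ K₂ ⟩
      ∣ K₁ ∣ + ∣ K₂ ∣ ≡⟨ cong₂ _+_ s₁ s₂ ⟩
      suc s + suc s ≡⟨ cong suc (+-suc s s) ⟩
      2 + s + s ∎)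
      where open ≡-Reasoning

    T⊆K₁ : T ⊆ K₁
    T⊆K₁ = p∩q⊆p K₁ K₂
    T⊆Z : T ⊆ Z
    T⊆Z x∈ = p⊆p∪q K₂ (T⊆K₁ x∈)

    -- If W misses τ in T = K₁ ∩ K₂, then τ is the only block that W misses from K₁ and from K₂, so
    -- W contains Z - τ, which has the same size.
    dichotomy : ∀ {W} → ∣ W ∣ ≡ suc s → K₁ ⊑ W → K₂ ⊑ W → T ⊆ W ⊎ ∃ λ τ → τ ∈ T × Z - τ ≡ W
    dichotomy {W} sW a₁ a₂ with T ⊆? W
    ... | yes T⊆W = inj₁ T⊆W
    ... | no T⊈W with ⊈⇒∃ T⊈W
    ... | τ , τ∈T , τ∉W = inj₂ (τ , τ∈T , ⊆∧≥⇒≡ (Z - τ) W sub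
            (≤-reflexive (trans sW (sym (suc-injective (trans (∣remove∣ (T⊆Z τ∈T)) ∣Z∣))))))
      where
      sub : Z - τ ⊆ W
      sub x∈ = let (x∈Z , x≢τ) = ∈-remove⁻ Z τ x∈ in ∈-stable (λ x∉W → x≢τ
        ([ (λ x∈₁ → a₁ x∈₁ x∉W (p∩q⊆p K₁ K₂ τ∈T) τ∉W) , (λ x∈₂ → a₂ x∈₂ x∉W (p∩q⊆q K₁ K₂ τ∈T) τ∉W) ]′ (x∈p∪q⁻ K₁ K₂ x∈Z)))

  module Distant {s : ℕ} (J₁ J₂ : Subset b) (s₁ : ∣ J₁ ∣ ≡ suc s) (s₂ : ∣ J₂ ∣ ≡ suc s) (lt : ∣ J₁ ∩ J₂ ∣ < s) where
    W : Subset b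
    W = J₁ ∪ J₂

    ∣W∣≥ : 3 + s ≤ ∣ W ∣
    ∣W∣≥ = +-cancelʳ-≤ (∣ J₁ ∩ J₂ ∣) (3 + s) ∣ W ∣ (begin
      3 + s + ∣ J₁ ∩ J₂ ∣ ≡⟨ cong (2 +_) (+-suc s _) ⟨
      2 + (s + suc ∣ J₁ ∩ J₂ ∣) ≤⟨ s≤s (s≤s (+-monoʳ-≤ s lt)) ⟩
      2 + (s + s) ≡⟨ cong suc (+-suc s s) ⟨
      suc s + suc s ≡⟨ cong₂ _+_ s₁ s₂ ⟨
      ∣ J₁ ∣ + ∣ J₂ ∣ ≡⟨ ∣∪∣+∣∩∣ J₁ J₂ ⟨
      ∣ W ∣ + ∣ J₁ ∩ J₂ ∣ ∎)
      where open ≤-Reasoning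

    not⊑ : ∀ {A} → A ≡ J₁ ⊎ A ≡ J₂ → ¬ (J₁ ⊑ A × J₂ ⊑ A)
    not⊑ (inj₁ refl) (_ , a₂) = <⇒≱ lt (≤-trans (⊑⁻ J₂ J₁ s₂ a₂) (≤-reflexive (cong ∣_∣ (∩-comm J₂ J₁))))
    not⊑ (inj₂ refl) (a₁ , _) = <⇒≱ lt (⊑⁻ J₁ J₂ s₁ a₁)

    -- K misses exactly one x of J₁ and one y of J₂, and x ≠ y because W - x is already larger than
    -- K. So K contains W - x - y, and |W| ≥ s + 3 leaves no room for anything else.
    between : ∀ {K} → ∣ K ∣ ≡ suc s → J₁ ⊑ K → J₂ ⊑ K →
      ∃ λ x → ∃ λ y → (x ∈ J₁ × x ∉ J₂) × (y ∈ J₂ × y ∉ J₁) × K ≡ W - x - y × ∣ W ∣ ≡ 3 + s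
    between {K} sK a₁ a₂ = go (⊈⇒∃ (λ sub → not⊑ (inj₁ (sym (⊆∧≥⇒≡ J₁ K sub (≤-reflexive (trans sK (sym s₁)))))) (a₁ , a₂)))
                              (⊈⇒∃ (λ sub → not⊑ (inj₂ (sym (⊆∧≥⇒≡ J₂ K sub (≤-reflexive (trans sK (sym s₂)))))) (a₁ , a₂)))
      where
      go : (∃ λ x → x ∈ J₁ × x ∉ K) → (∃ λ y → y ∈ J₂ × y ∉ K) → _
      go (x , x∈ , x∉K) (y , y∈ , y∉K) = x , y , (x∈ , x∉J₂) , (y∈ , y∉J₁) , sym W-≡ , sizeW
        where
        in-K : ∀ {z} → z ∈ W → z ≢ x → z ≢ y → z ∈ K
        in-K z∈ z≢x z≢y = ∈-stable (λ z∉K → [ (λ z∈₁ → z≢x (a₁ z∈₁ z∉K x∈ x∉K)) , (λ z∈₂ → z≢y (a₂ z∈₂ z∉K y∈ y∉K)) ]′ (x∈p∪q⁻ J₁ J₂ z∈))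
        x≢y : x ≢ y
        x≢y refl = <⇒≱ ∣W∣≥ (≤-trans (≤-reflexive (sym (∣remove∣ (p⊆p∪q J₂ x∈))))
                     (s≤s (≤-trans (p⊆q⇒∣p∣≤∣q∣ (λ z∈ → let (z∈W , z≢x) = ∈-remove⁻ W x z∈ in in-K z∈W z≢x z≢x)) (≤-reflexive sK))))
        x∉J₂ : x ∉ J₂
        x∉J₂ x∈₂ = x≢y (a₂ x∈₂ x∉K y∈ y∉K)
        y∉J₁ : y ∉ J₁
        y∉J₁ y∈₁ = x≢y (a₁ x∈ x∉K y∈₁ y∉K)
        W-⊆ : W - x - y ⊆ K
        W-⊆ z∈ = let (z∈W , z≢x , z≢y) = ∈-remove₂⁻ W x y z∈ in in-K z∈W z≢x z≢y
        sizeW-xy : 2 + ∣ W - x - y ∣ ≡ ∣ W ∣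
        sizeW-xy = ∣remove₂∣ (p⊆p∪q J₂ x∈) (q⊆p∪q J₁ J₂ y∈) x≢y
        le : suc s ≤ ∣ W - x - y ∣
        le = ≤-pred (≤-pred (≤-trans ∣W∣≥ (≤-reflexive (sym sizeW-xy))))
        W-≡ : W - x - y ≡ K
        W-≡ = ⊆∧≥⇒≡ (W - x - y) K W-⊆ (≤-trans (≤-reflexive sK) le)
        sizeW : ∣ W ∣ ≡ 3 + s
        sizeW = trans (sym sizeW-xy) (cong (2 +_) (trans (cong ∣_∣ W-≡) sK))

-- The bound m is kept apart from N = max(t + 2, q + 1): from N ≤ x ≤ m it follows which of the two
-- terms attains the maximum.
tight : ∀ {N m x y} → 1 ≤ N → N * N ≤ x * y → x ≤ m → y ≤ m → m ≤ N → N ≤ x × N ≤ y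
tight {N} {m} {x} {y} 1≤N big x≤m y≤m m≤N =
  ≮⇒≥ (λ x<N → <⇒≱ (≤-<-trans (*-monoʳ-≤ x (≤-trans y≤m m≤N)) (*-monoˡ-< N ⦃ >-nonZero 1≤N ⦄ x<N)) big) ,
  ≮⇒≥ (λ y<N → <⇒≱ (≤-<-trans (*-monoˡ-≤ y (≤-trans x≤m m≤N)) (*-monoʳ-< N ⦃ >-nonZero 1≤N ⦄ y<N)) big)

-- Here n + t and 2 are the bounds for the two generator counts when only one family has two
-- generators far apart.
2[n+t]<N² : ∀ {n t} N → 2 + t ≤ N → n ≤ N → 3 ≤ N → (n + t) * 2 < N * N
2[n+t]<N² {n} {t} (suc (suc (suc M))) (s≤s (s≤s t≤)) n≤ (s≤s (s≤s (s≤s _))) = begin-strict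
    (n + t) * 2 ≤⟨ *-monoˡ-≤ 2 (+-mono-≤ n≤ t≤) ⟩
    (3 + M + (1 + M)) * 2 <⟨ s≤s (m≤m+n _ _) ⟩
    suc ((3 + M + (1 + M)) * 2 + (2 * M + M * M)) ≡⟨ expand M ⟩
    (3 + M) * (3 + M) ∎
  where
  open ≤-Reasoning
  expand : ∀ M → suc ((3 + M + (1 + M)) * 2 + (2 * M + M * M)) ≡ (3 + M) * (3 + M)
  expand = solve-∀

module Classification (t q : ℕ) {b : ℕ} (S : CliqueSystem b (2 + (t + q)))
  (1≤t : 1 ≤ t) (1≤q : 1 ≤ q)
  (k<r : 2 + (t + q) < CliqueSystem.r S (1 + q)) (3≤r₂ : 3 ≤ CliqueSystem.r S 2) where
  open CliqueSystem S
  open CliqueCounts S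
  open ExtremalFamilies t q S 1≤t 1≤q k<r 3≤r₂
  open Covers t q S 1≤t 1≤q k<r 3≤r₂

  N : ℕ
  N = (2 + t) ⊔ (1 + q)

  2+t≤N : 2 + t ≤ N
  2+t≤N = m≤m⊔n (2 + t) (1 + q)
  1+q≤N : 1 + q ≤ N
  1+q≤N = m≤n⊔m (2 + t) (1 + q)
  3≤N : 3 ≤ N
  3≤N = ≤-trans (s≤s (s≤s 1≤t)) 2+t≤N
  1≤N : 1 ≤ N
  1≤N = ≤-trans (s≤s z≤n) 3≤N
  9≤N*N : 9 ≤ N * N
  9≤N*N = *-mono-≤ 3≤N 3≤N

  -- Convention: J denotes generators of P, that is t-covers of Q, and K denotes generators of Q.
  module OneSided {P Q : Subset b → Set} {P? : Decidable P} {Q? : Decidable Q} (max : Maximal P? Q?) where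
    open Side P? Q? (Maximal.adm max)

    J? : Decidable (Generator Q)
    J? = generator? Q?
    K? : Decidable (Generator P)
    K? = generator? P?

    sizeᴳ : ∀ {R A} → Generator R A → ∣ A ∣ ≡ 1 + t
    sizeᴳ (cA , _) = size cA

    cross-JK : ∀ {J K} → Generator Q J → Generator P K → J ⊑ K
    cross-JK = generators-cross max
    cross-KJ : ∀ {J K} → Generator Q J → Generator P K → K ⊑ J
    cross-KJ = λ gJ gK → generators-cross (maximal-sym max) gK gJ

    -- Each J shares t blocks with the given K, hence contains one of its t + 1 subsets of size t,
    -- and every such subset is in at most q + 1 generators.
    single-bound : ∀ {K} → Generator P K → count J? ≤ (1 + t) * (1 + q)
    single-bound {K} gK = ≤-trans
      (union-bound J? (⊆₌? K t) (λ J T → T ⊆? J) (1 + q) hit (λ T (_ , sT) → through-bound T sT))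
      (≤-reflexive (cong (_* (1 + q)) (trans (count-choose K t) (trans (cong (λ s → binom s t) (sizeᴳ gK)) (binom-[1+n]-n t)))))
      where
      hit : ∀ J → Generator Q J → ∃ λ T → (T ⊆ K × ∣ T ∣ ≡ t) × T ⊆ J
      hit J gJ = let T , T⊆ , sT = subsetOfSize (J ∩ K) t (⊑⁻ J K (sizeᴳ gJ) (cross-JK gJ gK)) in
        T , ((λ x∈ → p∩q⊆q J K (T⊆ x∈)) , sT) , (λ x∈ → p∩q⊆p J K (T⊆ x∈))

    -- With a single K the product of the counts would be at most (t + 1)(q + 1) < N².
    two-generatorsʳ : ∃ (Generator P) → N * N ≤ count J? * count K? → ∃ λ K₁ → ∃ λ K₂ → Generator P K₁ × Generator P K₂ × K₁ ≢ K₂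
    two-generatorsʳ (K , gK) big = count-≥2⁻ K? (≰⇒> λ le → <⇒≱ (begin-strict
      count J? * count K? ≤⟨ *-mono-≤ (single-bound gK) le ⟩
      (1 + t) * (1 + q) * 1 ≡⟨ *-identityʳ _ ⟩
      (1 + t) * (1 + q) ≤⟨ *-monoʳ-≤ (1 + t) 1+q≤N ⟩
      (1 + t) * N <⟨ *-monoˡ-< N ⦃ >-nonZero 1≤N ⦄ 2+t≤N ⟩
      N * N ∎) big)
      where open ≤-Reasoning

    -- Generators of opposite families always share t blocks, but two generators of the same family
    -- need not. The classification splits according to the families in which this fails.
    DistantJ : Set
    DistantJ = ∃ λ J₁ → ∃ λ J₂ → Generator Q J₁ × Generator Q J₂ × ∣ J₁ ∩ J₂ ∣ < t

    distantJ? : Dec DistantJ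
    distantJ? = anySubset? (λ J₁ → anySubset? (λ J₂ → J? J₁ ×-dec (J? J₂ ×-dec (suc ∣ J₁ ∩ J₂ ∣ ≤? t))))

    close-J : ¬ DistantJ → ∀ {J₁ J₂} → Generator Q J₁ → Generator Q J₂ → J₁ ⊑ J₂
    close-J none {J₁} {J₂} g₁ g₂ = ⊑⁺ J₁ J₂ (sizeᴳ g₁) (≮⇒≥ (λ lt → none (J₁ , J₂ , g₁ , g₂ , lt)))

  module Half {P Q : Subset b → Set} {P? : Decidable P} {Q? : Decidable Q} (max : Maximal P? Q?) where
    open OneSided max
    open Side P? Q? (Maximal.adm max)
    module Op = OneSided (maximal-sym max)

    -- J has a distant pair but K has none: then K has two elements and J at most t + q + 1.
    module OneDistant {J₁ J₂ K₁ K₂ : Subset b} (g₁ : Generator Q J₁) (g₂ : Generator Q J₂) (lt : ∣ J₁ ∩ J₂ ∣ < t)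
      (closeK : ¬ Op.DistantJ) (gK₁ : Generator P K₁) (gK₂ : Generator P K₂) (K₁≢K₂ : K₁ ≢ K₂) where
      open ≤-Reasoning
      open Adjacent K₁ K₂ (sizeᴳ gK₁) (sizeᴳ gK₂) K₁≢K₂ (⊑⁻ K₁ K₂ (sizeᴳ gK₁) (Op.close-J closeK gK₁ gK₂))
      dich : ∀ {J} → Generator Q J → T ⊆ J ⊎ ∃ λ τ → τ ∈ T × Z - τ ≡ J
      dich gJ = dichotomy (sizeᴳ gJ) (cross-KJ gJ gK₁) (cross-KJ gJ gK₂)
      J≤ : count J? ≤ 1 + q + t
      J≤ = begin
        count J? ≡⟨ count-split J? (T ⊆?_) ⟩
        count (λ J → J? J ×-dec (T ⊆? J)) + count (λ J → J? J ×-dec ¬? (T ⊆? J)) ≤⟨ +-mono-≤ (through-bound T ∣T∣) out ⟩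
        1 + q + t ∎
        where
        out : count (λ J → J? J ×-dec ¬? (T ⊆? J)) ≤ t
        out = begin
          count (λ J → J? J ×-dec ¬? (T ⊆? J)) ≤⟨ union-bound (λ J → J? J ×-dec ¬? (T ⊆? J)) (_∈? T) (λ J τ → Z - τ ≟ˢ J) 1
                                                       (λ J (gJ , T⊈J) → [ (λ T⊆J → contradiction (λ {x} → T⊆J {x}) T⊈J) , id ]′ (dich gJ))
                                                       (λ τ _ → count-≤1 (λ J → (J? J ×-dec ¬? (T ⊆? J)) ×-dec (Z - τ ≟ˢ J))
                                                         (λ (_ , e) (_ , e′) → trans (sym e) e′)) ⟩
          count (_∈? T) * 1 ≡⟨ trans (*-identityʳ _) (trans (count-∈ T) ∣T∣) ⟩
          t ∎
      -- J″ = Z - τ is far from J′, so J′ has a block w outside Z. A K not containing T is Z - τ′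
      -- and would miss both τ′ and w from J′; hence K = T ⊕ z. If z were outside Z, then J″ would
      -- miss both τ and z from K. So z lies in K₁ or K₂, and K is that set.
      pinned : ∀ {J′ J″} → Generator Q J′ → Generator Q J″ → T ⊆ J′ → ¬ (J′ ⊑ J″) → (∃ λ τ → τ ∈ T × Z - τ ≡ J″) →
               ∀ {K} → Generator P K → K ∈ˡ K₁ ∷ K₂ ∷ []
      pinned {J′} gJ′ gJ″ T⊆J′ far (τ , τ∈T , refl) {K} gK =
          case x∈p∪q⁻ K₁ K₂ z∈Z of λ where
            (inj₁ z∈₁) → here (trans (sym (T⊕z≡ gK T⊆K z∈K)) (T⊕z≡ gK₁ T⊆K₁ z∈₁))
            (inj₂ z∈₂) → there (here (trans (sym (T⊕z≡ gK T⊆K z∈K)) (T⊕z≡ gK₂ (p∩q⊆q K₁ K₂) z∈₂)))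
        where
        outside-Z : ∃ λ w → w ∈ J′ × w ∉ Z
        outside-Z = ⊈⇒∃ (λ J′⊆Z → far (λ x∈ x∉ y∈ y∉ → trans (is-τ (J′⊆Z x∈) x∉) (sym (is-τ (J′⊆Z y∈) y∉))))
          where
          is-τ : ∀ {x} → x ∈ Z → x ∉ Z - τ → x ≡ τ
          is-τ {x} x∈ x∉ = decidable-stable (x Fin.≟ τ) (λ x≢τ → x∉ (x∈p∧x≢y⇒x∈p-y x∈ x≢τ))
        T⊆K : T ⊆ K
        T⊆K with dichotomy (sizeᴳ gK) (Op.close-J closeK gK₁ gK) (Op.close-J closeK gK₂ gK)
        ... | inj₁ T⊆K = T⊆K
        ... | inj₂ (τ′ , τ′∈T , refl) = let (w , w∈ , w∉Z) = outside-Z in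
          contradiction (subst (_∈ Z) (cross-JK gJ′ gK (T⊆J′ τ′∈T) (λ τ′∈ → proj₂ (∈-remove⁻ Z τ′ τ′∈) refl)
            w∈ (λ w∈K → w∉Z (proj₁ (∈-remove⁻ Z τ′ w∈K)))) (T⊆Z τ′∈T)) w∉Z
        z-data = ∣∣<⇒∃ T K (≤-trans (s≤s (≤-reflexive ∣T∣)) (≤-reflexive (sym (sizeᴳ gK))))
        z = proj₁ z-data
        z∈K : z ∈ K
        z∈K = proj₁ (proj₂ z-data)
        z∉T : z ∉ T
        z∉T = proj₂ (proj₂ z-data)
        z∈Z : z ∈ Z
        z∈Z = ∈-stable (λ z∉Z → z∉T (subst (_∈ T)
          (cross-KJ gJ″ gK (T⊆K τ∈T) (λ τ∈ → proj₂ (∈-remove⁻ Z τ τ∈) refl) z∈K (λ z∈ → z∉Z (proj₁ (∈-remove⁻ Z τ z∈)))) τ∈T))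
        T⊕z≡ : ∀ {K′} → Generator P K′ → T ⊆ K′ → z ∈ K′ → T ⊕ z ≡ K′
        T⊕z≡ {K′} gK′ T⊆ z∈ = ⊆∧≥⇒≡ (T ⊕ z) K′ (⊕-⊆ T⊆ z∈) (≤-reflexive (trans (sizeᴳ gK′) (sym (trans (∣⊕∣ z∉T) (cong suc ∣T∣)))))
      far₁ : ¬ (J₁ ⊑ J₂)
      far₁ al = <⇒≱ lt (⊑⁻ J₁ J₂ (sizeᴳ g₁) al)
      far₂ : ¬ (J₂ ⊑ J₁)
      far₂ al = far₁ (⊑-sym J₂ J₁ (sizeᴳ g₂) (sizeᴳ g₁) al)
      K≤ : count K? ≤ 2
      K≤ = split (dich g₁) (dich g₂)
        where
        split : (T ⊆ J₁ ⊎ ∃ λ τ → τ ∈ T × Z - τ ≡ J₁) → (T ⊆ J₂ ⊎ ∃ λ τ → τ ∈ T × Z - τ ≡ J₂) → count K? ≤ 2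
        split (inj₁ T⊆₁) (inj₁ T⊆₂) = contradiction (≤-trans (≤-reflexive (sym ∣T∣)) (p⊆q⇒∣p∣≤∣q∣ (λ x∈ → x∈p∩q⁺ (T⊆₁ x∈ , T⊆₂ x∈)))) (<⇒≱ lt)
        split (inj₁ T⊆₁) (inj₂ z₂) = count-list K? _≟ˢ_ (K₁ ∷ K₂ ∷ []) (pinned g₁ g₂ T⊆₁ far₁ z₂)
        split (inj₂ z₁) (inj₁ T⊆₂) = count-list K? _≟ˢ_ (K₁ ∷ K₂ ∷ []) (pinned g₂ g₁ T⊆₂ far₂ z₁)
        split (inj₂ (τ₁ , _ , J₁≡)) (inj₂ (τ₂ , _ , J₂≡)) = contradiction
          (λ {x} {y} x∈ x∉ y∈ y∉ → trans (is-τ x∈ x∉) (sym (is-τ y∈ y∉))) far₁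
          where
          is-τ : ∀ {x} → x ∈ J₁ → x ∉ J₂ → x ≡ τ₂
          is-τ {x} x∈ x∉ = decidable-stable (x Fin.≟ τ₂) (λ x≢τ → x∉ (subst (x ∈_) J₂≡
            (x∈p∧x≢y⇒x∈p-y (remove-⊆ Z τ₁ (subst (x ∈_) (sym J₁≡) x∈)) x≢τ)))

    one-distant : ∃ (Generator P) → DistantJ → ¬ Op.DistantJ → ¬ (N * N ≤ count J? * count K?)
    one-distant someK (J₁ , J₂ , g₁ , g₂ , lt) closeK big =
      let K₁ , K₂ , gK₁ , gK₂ , K₁≢K₂ = two-generatorsʳ someK big
          open OneDistant g₁ g₂ lt closeK gK₁ gK₂ K₁≢K₂
      in <⇒≱ (≤-<-trans (*-mono-≤ J≤ K≤) (2[n+t]<N² N 2+t≤N 1+q≤N 3≤N)) big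

  infix 8 _∙_
  _∙_ : Fin b → Fin b → Subset b
  x ∙ y = ⁅ x ⁆ ∪ ⁅ y ⁆

  record SunflowerType (P Q : Subset b → Set) {P? : Decidable P} {Q? : Decidable Q} : Set where
    field
      T    : Subset b
      ∣T∣  : ∣ T ∣ ≡ t
      T⊆J  : ∀ {J} → Generator Q J → T ⊆ J
      T⊆K  : ∀ {K} → Generator P K → T ⊆ K
      manyJ : 1 + q ≤ count (generator? Q?)
      manyK : 1 + q ≤ count (generator? P?)

  record SimplexType (P Q : Subset b → Set) : Set where
    field
      Z     : Subset b
      ∣Z∣   : ∣ Z ∣ ≡ 2 + t
      allJ  : ∀ {A} → A ⊆ Z → ∣ A ∣ ≡ 1 + t → Generator Q A
      allK  : ∀ {A} → A ⊆ Z → ∣ A ∣ ≡ 1 + t → Generator P A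

  record SquareType (P Q : Subset b → Set) : Set where
    field
      e₁ e₂ e₃ e₄ : Fin b
      J₁₂ : Generator Q (e₁ ∙ e₂)
      J₃₄ : Generator Q (e₃ ∙ e₄)
      J₁₄ : Generator Q (e₁ ∙ e₄)
      K₁₃ : Generator P (e₁ ∙ e₃)
      K₂₄ : Generator P (e₂ ∙ e₄)
      K₁₄ : Generator P (e₁ ∙ e₄)

  record ManyGenerators {P Q : Subset b → Set} (P? : Decidable P) (Q? : Decidable Q) : Set where
    field
      big : N * N ≤ count (generator? Q?) * count (generator? P?)

  module Both {P Q : Subset b → Set} {P? : Decidable P} {Q? : Decidable Q} (max : Maximal P? Q?)
      (someJ : ∃ (Generator Q)) (someK : ∃ (Generator P))
      (manyGenerators : ManyGenerators P? Q?) where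
    open ManyGenerators manyGenerators
    open OneSided max
    module Op = OneSided (maximal-sym max)
    open Side P? Q? (Maximal.adm max)
    module SideOp = Side Q? P? (Maximal.adm (maximal-sym max))

    -- Both generator sets together now form a family of (t+1)-sets that pairwise share at least t
    -- blocks. Such a family has a common t-set or lies in a (t+2)-set, and K₁, K₂ determine the
    -- candidates T and Z.
    module NoneDistant (closeJ : ¬ DistantJ) (closeK : ¬ Op.DistantJ)
      {K₁ K₂ : Subset b} (gK₁ : Generator P K₁) (gK₂ : Generator P K₂) (K₁≢K₂ : K₁ ≢ K₂) where
      open Adjacent K₁ K₂ (sizeᴳ gK₁) (sizeᴳ gK₂) K₁≢K₂ (⊑⁻ K₁ K₂ (sizeᴳ gK₁) (Op.close-J closeK gK₁ gK₂))
      G : Subset b → Set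
      G A = Generator Q A ⊎ Generator P A
      G? : Decidable G
      G? A = J? A ⊎-dec K? A
      sizeG : ∀ {A} → G A → ∣ A ∣ ≡ 1 + t
      sizeG (inj₁ g) = sizeᴳ g
      sizeG (inj₂ g) = sizeᴳ g
      close : ∀ {A B} → G A → G B → A ⊑ B
      close (inj₁ a) (inj₁ b) = close-J closeJ a b
      close (inj₁ a) (inj₂ b) = cross-JK a b
      close (inj₂ a) (inj₁ b) = cross-KJ b a
      close (inj₂ a) (inj₂ b) = Op.close-J closeK a b
      dich : ∀ {A} → G A → T ⊆ A ⊎ ∃ λ τ → τ ∈ T × Z - τ ≡ A
      dich g = dichotomy (sizeG g) (close (inj₂ gK₁) g) (close (inj₂ gK₂) g)
      Result : Set
      Result = (2 + t ≤ 1 + q × SunflowerType P Q {P?} {Q?}) ⊎ (1 + q ≤ 2 + t × SimplexType P Q)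

      common-kernel : (∀ {A} → G A → T ⊆ A) → Result
      common-kernel T⊆ = inj₁ (≤-trans 2+t≤N N≤1+q , record
          { T = T ; ∣T∣ = ∣T∣ ; T⊆J = λ g → T⊆ (inj₁ g) ; T⊆K = λ g → T⊆ (inj₂ g)
          ; manyJ = ≤-trans 1+q≤N (proj₁ tight-bounds)
          ; manyK = ≤-trans 1+q≤N (proj₂ tight-bounds) })
        where
        J≤ : count J? ≤ 1 + q
        J≤ = ≤-trans (count-mono J? (λ J → J? J ×-dec (T ⊆? J)) (λ J g → g , T⊆ (inj₁ g))) (through-bound T ∣T∣)
        K≤ : count K? ≤ 1 + q
        K≤ = ≤-trans (count-mono K? (λ K → K? K ×-dec (T ⊆? K)) (λ K g → g , T⊆ (inj₂ g))) (SideOp.through-bound T ∣T∣)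
        tight-bounds : N ≤ count J? × N ≤ count K?
        tight-bounds = tight 1≤N big J≤ K≤ 1+q≤N
        N≤1+q : N ≤ 1 + q
        N≤1+q = ≤-trans (proj₁ tight-bounds) J≤

      -- One generator Z - τ pulls all others into Z: a set through T with a block outside Z would
      -- lose that block and τ to Z - τ. Since Z has only t + 2 facets, the lower bound N ≥ t + 2 on
      -- each count makes every facet a generator on both sides.
      in-simplex : ∀ {τ} → τ ∈ T → G (Z - τ) → Result
      in-simplex {τ} τ∈T g₀ = inj₂ (≤-trans 1+q≤N N≤2+t , record
          { Z = Z ; ∣Z∣ = ∣Z∣
          ; allJ = λ {A} A⊆Z sA → count-full J? (⊆₌? Z (1 + t)) (λ _ g → ⊆Z (inj₁ g) , sizeᴳ g)
              (≤-trans (≤-reflexive choose) (≤-trans 2+t≤N (proj₁ tight-bounds))) A (A⊆Z , sA)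
          ; allK = λ {A} A⊆Z sA → count-full K? (⊆₌? Z (1 + t)) (λ _ g → ⊆Z (inj₂ g) , sizeᴳ g)
              (≤-trans (≤-reflexive choose) (≤-trans 2+t≤N (proj₂ tight-bounds))) A (A⊆Z , sA) })
        where
        choose : count (⊆₌? Z (1 + t)) ≡ 2 + t
        choose = trans (count-choose Z (1 + t)) (trans (cong (λ s → binom s (1 + t)) ∣Z∣) (binom-[1+n]-n (1 + t)))
        ⊆Z : ∀ {A} → G A → A ⊆ Z
        ⊆Z {A} g {x} x∈ =
          [ (λ T⊆A → ∈-stable (λ x∉Z → x∉Z (subst (_∈ Z)
              (close g g₀ (T⊆A τ∈T) (λ τ∈ → proj₂ (∈-remove⁻ Z τ τ∈) refl) x∈ (λ x∈A₀ → x∉Z (remove-⊆ Z τ x∈A₀))) (T⊆Z τ∈T))))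
          , (λ (τ′ , _ , Z-τ′≡A) → remove-⊆ Z τ′ (subst (x ∈_) (sym Z-τ′≡A) x∈)) ]′ (dich g)
        J≤ : count J? ≤ 2 + t
        J≤ = ≤-trans (count-mono J? (⊆₌? Z (1 + t)) (λ _ g → ⊆Z (inj₁ g) , sizeᴳ g)) (≤-reflexive choose)
        K≤ : count K? ≤ 2 + t
        K≤ = ≤-trans (count-mono K? (⊆₌? Z (1 + t)) (λ _ g → ⊆Z (inj₂ g) , sizeᴳ g)) (≤-reflexive choose)
        tight-bounds : N ≤ count J? × N ≤ count K?
        tight-bounds = tight 1≤N big J≤ K≤ 2+t≤N
        N≤2+t : N ≤ 2 + t
        N≤2+t = ≤-trans (proj₁ tight-bounds) J≤

      result : Result
      result = decide (anySubset? (λ A → G? A ×-dec ¬? (T ⊆? A)))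
        where
        decide : Dec (∃ λ A → G A × ¬ (T ⊆ A)) → Result
        decide (no none) = common-kernel (λ {A} g {x} x∈ → ∈-stable (λ x∉ → none (A , g , λ T⊆A → x∉ (T⊆A x∈))))
        decide (yes (A , g , T⊈A)) = [ (λ T⊆A → contradiction (λ {x} → T⊆A {x}) T⊈A)
                                     , (λ (τ , τ∈T , Z-τ≡A) → in-simplex τ∈T (subst G (sym Z-τ≡A) g)) ]′ (dich g)

    -- Here J ⊆ {W - y₁ - y₂, W - x₁ - x₂, α, β} and K ⊆ {W - x₂ - y₂, W - x₁ - y₁, α, β}
    -- with α = W - x₁ - y₂, β = W - x₂ - y₁, and α, β do not occur on opposite sides.
    module Square {J₁ J₂ K₁ K₂ : Subset b} {x₁ x₂ y₁ y₂ : Fin b}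
      (g₁ : Generator Q J₁) (g₂ : Generator Q J₂) (ltJ : ∣ J₁ ∩ J₂ ∣ < t)
      (h₁ : Generator P K₁) (h₂ : Generator P K₂) (ltK : ∣ K₁ ∩ K₂ ∣ < t)
      (x₂∈J₁ : x₂ ∈ J₁) (x₂∉J₂ : x₂ ∉ J₂) (y₂∈J₂ : y₂ ∈ J₂) (y₂∉J₁ : y₂ ∉ J₁)
      (x₁∈J₁ : x₁ ∈ J₁) (x₁∉J₂ : x₁ ∉ J₂) (y₁∈J₂ : y₁ ∈ J₂) (y₁∉J₁ : y₁ ∉ J₁)
      (K₁≡ : K₁ ≡ (J₁ ∪ J₂) - x₂ - y₂) (K₂≡ : K₂ ≡ (J₁ ∪ J₂) - x₁ - y₁) (∣W∣ : ∣ J₁ ∪ J₂ ∣ ≡ 3 + t) where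
      module DJ = Distant J₁ J₂ (sizeᴳ g₁) (sizeᴳ g₂) ltJ
      module DK = Distant K₁ K₂ (sizeᴳ h₁) (sizeᴳ h₂) ltK
      W : Subset b
      W = J₁ ∪ J₂
      J₁⊆W : J₁ ⊆ W
      J₁⊆W = p⊆p∪q J₂
      J₂⊆W : J₂ ⊆ W
      J₂⊆W = q⊆p∪q J₁ J₂
      x₁∈W = J₁⊆W x₁∈J₁
      x₂∈W = J₁⊆W x₂∈J₁
      y₁∈W = J₂⊆W y₁∈J₂
      y₂∈W = J₂⊆W y₂∈J₂
      xy : ∀ {x y} → x ∈ J₁ → y ∉ J₁ → x ≢ y
      xy x∈ y∉ refl = y∉ x∈
      K₁∌ : ∀ {z} → z ∈ K₁ → z ∈ W × z ≢ x₂ × z ≢ y₂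
      K₁∌ z∈ = ∈-remove₂⁻ W x₂ y₂ (subst (_ ∈_) K₁≡ z∈)
      K₂∌ : ∀ {z} → z ∈ K₂ → z ∈ W × z ≢ x₁ × z ≢ y₁
      K₂∌ z∈ = ∈-remove₂⁻ W x₁ y₁ (subst (_ ∈_) K₂≡ z∈)
      far : ¬ (K₁ ⊑ K₂)
      far al = <⇒≱ ltK (⊑⁻ K₁ K₂ (sizeᴳ h₁) al)
      K₁∖K₂ : ∀ {z} → z ∈ K₁ → z ∉ K₂ → z ≡ x₁ ⊎ z ≡ y₁
      K₁∖K₂ z∈ z∉ = ∉-remove₂⁻ W x₁ y₁ (proj₁ (K₁∌ z∈)) (subst (_ ∉_) K₂≡ z∉)
      x₁≢x₂ : x₁ ≢ x₂
      x₁≢x₂ refl = far λ x∈ x∉ y∈ y∉ → trans (is-y₁ x∈ x∉) (sym (is-y₁ y∈ y∉))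
        where
        is-y₁ : ∀ {z} → z ∈ K₁ → z ∉ K₂ → z ≡ y₁
        is-y₁ z∈ z∉ = [ (λ z≡x₂ → contradiction z≡x₂ (proj₁ (proj₂ (K₁∌ z∈)))) , id ]′ (K₁∖K₂ z∈ z∉)
      y₁≢y₂ : y₁ ≢ y₂
      y₁≢y₂ refl = far λ x∈ x∉ y∈ y∉ → trans (is-x₁ x∈ x∉) (sym (is-x₁ y∈ y∉))
        where
        is-x₁ : ∀ {z} → z ∈ K₁ → z ∉ K₂ → z ≡ x₁
        is-x₁ z∈ z∉ = [ id , (λ z≡y₂ → contradiction z≡y₂ (proj₂ (proj₂ (K₁∌ z∈)))) ]′ (K₁∖K₂ z∈ z∉)
      size₂ : ∀ {x y} → x ∈ W → y ∈ W → x ≢ y → ∣ W - x - y ∣ ≡ 1 + t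
      size₂ x∈ y∈ x≢y = suc-injective (suc-injective (trans (∣remove₂∣ x∈ y∈ x≢y) ∣W∣))
      J₁≡ : J₁ ≡ W - y₁ - y₂
      J₁≡ = ⊆∧≥⇒≡ J₁ (W - y₁ - y₂) (⊆-remove₂ J₁⊆W y₁∉J₁ y₂∉J₁) (≤-reflexive (trans (size₂ y₁∈W y₂∈W y₁≢y₂) (sym (sizeᴳ g₁))))
      J₂≡ : J₂ ≡ W - x₁ - x₂
      J₂≡ = ⊆∧≥⇒≡ J₂ (W - x₁ - x₂) (⊆-remove₂ J₂⊆W x₁∉J₂ x₂∉J₂) (≤-reflexive (trans (size₂ x₁∈W x₂∈W x₁≢x₂) (sym (sizeᴳ g₂))))
      W′≡W : DK.W ≡ W
      W′≡W = ⊆∧≥⇒≡ DK.W W (λ z∈ → [ (λ z∈₁ → proj₁ (K₁∌ z∈₁)) , (λ z∈₂ → proj₁ (K₂∌ z∈₂)) ]′ (x∈p∪q⁻ K₁ K₂ z∈))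
        (≤-trans (≤-reflexive ∣W∣) DK.∣W∣≥)
      α β : Subset b
      α = W - x₁ - y₂
      β = W - x₂ - y₁
      placeJ : ∀ {J z z′} → z ≡ x₁ ⊎ z ≡ y₁ → z′ ≡ x₂ ⊎ z′ ≡ y₂ → J ≡ W - z - z′ → J ∈ˡ J₁ ∷ J₂ ∷ α ∷ β ∷ []
      placeJ (inj₁ refl) (inj₁ refl) J≡ = there (here (trans J≡ (sym J₂≡)))
      placeJ (inj₁ refl) (inj₂ refl) J≡ = there (there (here J≡))
      placeJ (inj₂ refl) (inj₁ refl) J≡ = there (there (there (here (trans J≡ (p─x─y≡p─y─x W y₁ x₂)))))
      placeJ (inj₂ refl) (inj₂ refl) J≡ = here (trans J≡ (sym J₁≡))
      placeK : ∀ {K x y} → x ≡ x₁ ⊎ x ≡ x₂ → y ≡ y₁ ⊎ y ≡ y₂ → K ≡ W - x - y → K ∈ˡ K₁ ∷ K₂ ∷ α ∷ β ∷ []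
      placeK (inj₁ refl) (inj₁ refl) K≡ = there (here (trans K≡ (sym K₂≡)))
      placeK (inj₁ refl) (inj₂ refl) K≡ = there (there (here K≡))
      placeK (inj₂ refl) (inj₁ refl) K≡ = there (there (there (here K≡)))
      placeK (inj₂ refl) (inj₂ refl) K≡ = here (trans K≡ (sym K₁≡))
      J-list : ∀ {J} → Generator Q J → J ∈ˡ J₁ ∷ J₂ ∷ α ∷ β ∷ []
      J-list g = let z , z′ , (z∈ , z∉) , (z′∈ , z′∉) , J≡ , _ = DK.between (sizeᴳ g) (cross-KJ g h₁) (cross-KJ g h₂) in
        placeJ (K₁∖K₂ z∈ z∉) (∉-remove₂⁻ W x₂ y₂ (proj₁ (K₂∌ z′∈)) (subst (z′ ∉_) K₁≡ z′∉))
               (trans J≡ (cong (λ V → V - z - z′) W′≡W))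
      K-list : ∀ {K} → Generator P K → K ∈ˡ K₁ ∷ K₂ ∷ α ∷ β ∷ []
      K-list h = let x , y , (x∈ , x∉) , (y∈ , y∉) , K≡ , _ = DJ.between (sizeᴳ h) (cross-JK g₁ h) (cross-JK g₂ h) in
        placeK (∉-remove₂⁻ W x₁ x₂ (J₁⊆W x∈) (subst (x ∉_) J₂≡ x∉))
               (∉-remove₂⁻ W y₁ y₂ (J₂⊆W y∈) (subst (y ∉_) J₁≡ y∉)) K≡
      αβ : α ⊑ β → ⊥
      αβ al = xy x₂∈J₁ y₁∉J₁ (al
        (x∈p∧x≢y⇒x∈p-y (x∈p∧x≢y⇒x∈p-y x₂∈W (x₁≢x₂ ∘ sym)) (xy x₂∈J₁ y₂∉J₁)) (λ x₂∈ → proj₁ (proj₂ (∈-remove₂⁻ W x₂ y₁ x₂∈)) refl)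
        (x∈p∧x≢y⇒x∈p-y (x∈p∧x≢y⇒x∈p-y y₁∈W (xy x₁∈J₁ y₁∉J₁ ∘ sym)) y₁≢y₂) (λ y₁∈ → proj₂ (proj₂ (∈-remove₂⁻ W x₂ y₁ y₁∈)) refl))
      not-member : ∀ {R : Subset b → Set} {A B} → R A → ¬ R B → A ≢ B
      not-member {R} rA ¬rB A≡B = ¬rB (subst R A≡B rA)
      too-small : ∀ {x y} → count J? ≤ x → count K? ≤ y → x * y ≤ 8 → ⊥
      too-small a≤ b≤ le = <⇒≱ 9≤N*N (≤-trans big (≤-trans (*-mono-≤ a≤ b≤) le))
      ¬αβ : Generator Q α → ¬ Generator P β
      ¬αβ jα kβ = αβ (cross-JK jα kβ)
      ¬βα : Generator Q β → ¬ Generator P α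
      ¬βα jβ kα = αβ (cross-KJ jβ kα)
      N≤3 : count J? ≤ 3 → count K? ≤ 3 → N ≤ 3
      N≤3 a≤ b≤ = ≤-trans (proj₁ (tight 1≤N big a≤ b≤ 3≤N)) a≤
      pairs : N ≤ 3 → ∀ {R A x y} → Generator R A → x ∈ A → y ∈ A → x ≢ y → Generator R (x ∙ y)
      pairs le {R} g x∈ y∈ x≢y = subst (Generator R) (sym (pair≡ (trans (sizeᴳ g) (cong suc t≡1)) x∈ y∈ x≢y)) g
        where
        t≡1 : t ≡ 1
        t≡1 = ≤-antisym (≤-pred (≤-pred (≤-trans 2+t≤N le))) 1≤t
      ∈₂ : ∀ {z x y} → z ∈ W → z ≢ x → z ≢ y → z ∈ W - x - y
      ∈₂ z∈ z≢x z≢y = x∈p∧x≢y⇒x∈p-y (x∈p∧x≢y⇒x∈p-y z∈ z≢x) z≢y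
      x₁y₁ = xy x₁∈J₁ y₁∉J₁
      x₁y₂ = xy x₁∈J₁ y₂∉J₁
      x₂y₁ = xy x₂∈J₁ y₁∉J₁
      x₂y₂ = xy x₂∈J₁ y₂∉J₁
      x₁∈K₁ = subst (x₁ ∈_) (sym K₁≡) (∈₂ x₁∈W x₁≢x₂ x₁y₂)
      y₁∈K₁ = subst (y₁ ∈_) (sym K₁≡) (∈₂ y₁∈W (x₂y₁ ∘ sym) y₁≢y₂)
      x₂∈K₂ = subst (x₂ ∈_) (sym K₂≡) (∈₂ x₂∈W (x₁≢x₂ ∘ sym) x₂y₁)
      y₂∈K₂ = subst (y₂ ∈_) (sym K₂≡) (∈₂ y₂∈W (x₁y₂ ∘ sym) (y₁≢y₂ ∘ sym))
      -- N ≥ 3, so the counts must have product at least 9. If α and β both occur on one side they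
      -- are excluded on the other, giving at most 4 · 2; if neither occurs among the J, at most 2 ·
      -- 4; if one occurs among the J but not among the K, at most 3 · 2. There remains the same one
      -- of α, β on both sides, with at most 3 · 3; then N = 3, so t = 1 and all generators are
      -- pairs.
      decide : Dec (Generator Q α) → Dec (Generator Q β) → Dec (Generator P α) → Dec (Generator P β) → N ≤ 3 × SquareType P Q
      decide (yes jα) (yes jβ) _ _ = ⊥-elim (too-small (count-list J? _≟ˢ_ _ J-list)
              (count-list K? _≟ˢ_ (K₁ ∷ K₂ ∷ []) (λ h → ∈-drop₃₄ (K-list h) (not-member {Generator P} h (¬βα jβ)) (not-member {Generator P} h (¬αβ jα)))) ≤-refl)
      decide (no ¬jα) (no ¬jβ) _ _ = ⊥-elim (too-small
              (count-list J? _≟ˢ_ (J₁ ∷ J₂ ∷ []) (λ g → ∈-drop₃₄ (J-list g) (not-member {Generator Q} g ¬jα) (not-member {Generator Q} g ¬jβ))) (count-list K? _≟ˢ_ _ K-list) ≤-refl)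
      decide (yes jα) (no ¬jβ) (no ¬kα) _ = ⊥-elim (too-small
              (count-list J? _≟ˢ_ _ (λ g → ∈-drop₄ (J-list g) (not-member {Generator Q} g ¬jβ)))
              (count-list K? _≟ˢ_ (K₁ ∷ K₂ ∷ []) (λ h → ∈-drop₃₄ (K-list h) (not-member {Generator P} h ¬kα) (not-member {Generator P} h (¬αβ jα)))) (m≤m+n 6 2))
      decide (no ¬jα) (yes jβ) _ (no ¬kβ) = ⊥-elim (too-small
              (count-list J? _≟ˢ_ _ (λ g → ∈-drop₃ (J-list g) (not-member {Generator Q} g ¬jα)))
              (count-list K? _≟ˢ_ (K₁ ∷ K₂ ∷ []) (λ h → ∈-drop₃₄ (K-list h) (not-member {Generator P} h (¬βα jβ)) (not-member {Generator P} h ¬kβ))) (m≤m+n 6 2))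
      decide (yes jα) (no ¬jβ) (yes kα) _ = le , record
              { e₁ = x₂ ; e₂ = x₁ ; e₃ = y₂ ; e₄ = y₁
              ; J₁₂ = pairs le g₁ x₂∈J₁ x₁∈J₁ (x₁≢x₂ ∘ sym)
              ; J₃₄ = pairs le g₂ y₂∈J₂ y₁∈J₂ (y₁≢y₂ ∘ sym)
              ; J₁₄ = pairs le jα x₂∈α y₁∈α x₂y₁
              ; K₁₃ = pairs le h₂ x₂∈K₂ y₂∈K₂ x₂y₂
              ; K₂₄ = pairs le h₁ x₁∈K₁ y₁∈K₁ x₁y₁
              ; K₁₄ = pairs le kα x₂∈α y₁∈α x₂y₁ }
        where
        le = N≤3 (count-list J? _≟ˢ_ _ (λ g → ∈-drop₄ (J-list g) (not-member {Generator Q} g ¬jβ)))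
                 (count-list K? _≟ˢ_ _ (λ h → ∈-drop₄ (K-list h) (not-member {Generator P} h (¬αβ jα))))
        x₂∈α = ∈₂ x₂∈W (x₁≢x₂ ∘ sym) x₂y₂
        y₁∈α = ∈₂ y₁∈W (x₁y₁ ∘ sym) y₁≢y₂
      decide (no ¬jα) (yes jβ) _ (yes kβ) = le , record
              { e₁ = x₁ ; e₂ = x₂ ; e₃ = y₁ ; e₄ = y₂
              ; J₁₂ = pairs le g₁ x₁∈J₁ x₂∈J₁ x₁≢x₂
              ; J₃₄ = pairs le g₂ y₁∈J₂ y₂∈J₂ y₁≢y₂
              ; J₁₄ = pairs le jβ x₁∈β y₂∈β x₁y₂
              ; K₁₃ = pairs le h₁ x₁∈K₁ y₁∈K₁ x₁y₁
              ; K₂₄ = pairs le h₂ x₂∈K₂ y₂∈K₂ x₂y₂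
              ; K₁₄ = pairs le kβ x₁∈β y₂∈β x₁y₂ }
        where
        le = N≤3 (count-list J? _≟ˢ_ _ (λ g → ∈-drop₃ (J-list g) (not-member {Generator Q} g ¬jα)))
                 (count-list K? _≟ˢ_ _ (λ h → ∈-drop₃ (K-list h) (not-member {Generator P} h (¬βα jβ))))
        x₁∈β = ∈₂ x₁∈W x₁≢x₂ x₁y₁
        y₂∈β = ∈₂ y₂∈W (x₂y₂ ∘ sym) (y₁≢y₂ ∘ sym)

      result : N ≤ 3 × SquareType P Q
      result = decide (J? α) (J? β) (K? α) (K? β)

    both-distant : DistantJ → Op.DistantJ → N ≤ 3 × SquareType P Q
    both-distant (J₁ , J₂ , g₁ , g₂ , ltJ) (K₁ , K₂ , h₁ , h₂ , ltK) =
      let x₂ , y₂ , (x₂∈J₁ , x₂∉J₂) , (y₂∈J₂ , y₂∉J₁) , K₁≡ , ∣W∣ = between (sizeᴳ h₁) (cross-JK g₁ h₁) (cross-JK g₂ h₁)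
          x₁ , y₁ , (x₁∈J₁ , x₁∉J₂) , (y₁∈J₂ , y₁∉J₁) , K₂≡ , _   = between (sizeᴳ h₂) (cross-JK g₁ h₂) (cross-JK g₂ h₂)
      in Square.result g₁ g₂ ltJ h₁ h₂ ltK x₂∈J₁ x₂∉J₂ y₂∈J₂ y₂∉J₁ x₁∈J₁ x₁∉J₂ y₁∈J₂ y₁∉J₁ K₁≡ K₂≡ ∣W∣
      where open Distant J₁ J₂ (sizeᴳ g₁) (sizeᴳ g₂) ltJ

    classification : (2 + t ≤ 1 + q × SunflowerType P Q {P?} {Q?}) ⊎ (1 + q ≤ 2 + t × SimplexType P Q) ⊎ (N ≤ 3 × SquareType P Q)
    classification = decide distantJ? Op.distantJ?
      where
      decide : Dec DistantJ → Dec Op.DistantJ → _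
      decide (no cJ)  (no cK)  = let K₁ , K₂ , gK₁ , gK₂ , K₁≢K₂ = two-generatorsʳ someK big in
        [ inj₁ , (λ s → inj₂ (inj₁ s)) ]′ (NoneDistant.result cJ cK gK₁ gK₂ K₁≢K₂)
      decide (yes dJ) (no cK)  = contradiction big (Half.one-distant max someK dJ cK)
      decide (no cJ)  (yes dK) = contradiction (≤-trans big (≤-reflexive (*-comm (count J?) (count K?))))
                                   (Half.one-distant (maximal-sym max) someJ dK cJ)
      decide (yes dJ) (yes dK) = inj₂ (inj₂ (both-distant dJ dK))

-- Estimates

binom-absorb : ∀ m j → suc j * binom (suc m) (suc j) ≡ suc m * binom m j
binom-absorb zero    zero    = refl
binom-absorb zero    (suc j) = *-zeroʳ j
binom-absorb (suc m) zero    = trans (cong (1 *_) (cong (1 +_) (trans (sym (*-identityˡ _)) (binom-absorb m zero)))) (arith m)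
  where
  arith : ∀ m → 1 * (1 + suc m * 1) ≡ suc (suc m) * 1
  arith = solve-∀
binom-absorb (suc m) (suc j) = begin
    suc (suc j) * (X + Y) ≡⟨ expand j X Y ⟩
    suc j * X + X + suc (suc j) * Y ≡⟨ cong₂ (λ x y → x + X + y) (binom-absorb m j) (binom-absorb m (suc j)) ⟩
    suc m * binom m j + X + suc m * binom m (suc j) ≡⟨ collect m (binom m j) (binom m (suc j)) ⟩
    suc (suc m) * (binom m j + binom m (suc j)) ∎
  where
  open ≡-Reasoning
  X = binom (suc m) (suc j)
  Y = binom (suc m) (suc (suc j))
  expand : ∀ j X Y → suc (suc j) * (X + Y) ≡ suc j * X + X + suc (suc j) * Y
  expand = solve-∀
  collect : ∀ m x y → suc m * x + (x + y) + suc m * y ≡ suc (suc m) * (x + y)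
  collect = solve-∀

binom-next : ∀ d t → suc t * binom (d + t) (suc t) ≡ d * binom (d + t) t
binom-next d t = +-cancelˡ-≡ (suc t * binom (d + t) t) _ _ (begin
    suc t * binom (d + t) t + suc t * binom (d + t) (suc t) ≡⟨ *-distribˡ-+ (suc t) (binom (d + t) t) _ ⟨
    suc t * binom (suc (d + t)) (suc t) ≡⟨ binom-absorb (d + t) t ⟩
    suc (d + t) * binom (d + t) t ≡⟨ arith d t (binom (d + t) t) ⟩
    suc t * binom (d + t) t + d * binom (d + t) t ∎)
  where
  open ≡-Reasoning
  arith : ∀ d t x → suc (d + t) * x ≡ suc t * x + d * x
  arith = solve-∀

binom-up : ∀ d t → suc d * binom (suc (d + t)) t ≡ suc (d + t) * binom (d + t) t
binom-up d t = trans (sym (binom-next (suc d) t)) (binom-absorb (d + t) t)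

binom-mono : ∀ {m n} j → m ≤ n → binom m j ≤ binom n j
binom-mono {m} {n} j m≤n = subst (λ x → binom m j ≤ binom x j) (m∸n+n≡m m≤n) (go (n ∸ m))
  where
  go : ∀ d → binom m j ≤ binom (d + m) j
  go zero    = ≤-refl
  go (suc d) = ≤-trans (go d) (up (d + m) j)
    where
    up : ∀ m j → binom m j ≤ binom (suc m) j
    up m zero    = ≤-refl
    up m (suc j) = m≤n+m _ _

half : ∀ d → ∃ λ i → i + i ≤ d × d ≤ suc (i + i)
half zero          = 0 , z≤n , z≤n
half (suc zero)    = 0 , z≤n , s≤s z≤n
half (suc (suc d)) with half d
... | i , lo , hi = suc i , ≤-trans (≤-reflexive (cong suc (+-suc i i))) (s≤s (s≤s lo)) ,
                    ≤-trans (s≤s (s≤s hi)) (≤-reflexive (cong (2 +_) (sym (+-suc i i))))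

least : ∀ {P : ℕ → Set} → Decidable P → ∀ k → P k → ∃ λ s → P s × s ≤ k × (∀ {s′} → s′ < s → ¬ P s′)
least P? zero    p = 0 , p , z≤n , λ ()
least P? (suc k) p with P? 0
... | yes p₀ = 0 , p₀ , z≤n , λ ()
... | no ¬p₀ with least (λ s → P? (suc s)) k p
... | s , ps , s≤k , min = suc s , ps , s≤s s≤k , λ { {zero} _ → ¬p₀ ; {suc _} (s≤s lt) → min lt }

-- With D = N R - E, the inequality (a R + E) (b R + E) < D² is proved after adding 2 E D + E², which
-- removes the subtraction.
product-bound : ∀ {N E R v a b x y o} → 1 ≤ v → 1 ≤ a → 1 ≤ b → a * b < N * N → E * (N * (N + 2)) < R →
  x ≤ (a * R + E) * v → y ≤ (b * R + E) * v → N * (R * v) ≤ o + E * v → x * y < o * o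
product-bound {N} {E} {R} {v} {suc a} {suc b} {x} {y} {o} 1≤v (s≤s _) (s≤s _) ab<N² R> x≤ y≤ o≥ = begin-strict
    x * y ≤⟨ *-mono-≤ x≤ y≤ ⟩
    (A * R + E) * v * ((B * R + E) * v) ≡⟨ regroup (A * R + E) (B * R + E) v ⟩
    (A * R + E) * (B * R + E) * (v * v) <⟨ *-monoˡ-< (v * v) ⦃ >-nonZero (*-mono-≤ 1≤v 1≤v) ⦄ core ⟩
    D * D * (v * v) ≡⟨ regroup D D v ⟨
    D * v * (D * v) ≤⟨ *-mono-≤ Dv≤o Dv≤o ⟩
    o * o ∎
  where
  open ≤-Reasoning
  A = suc a
  B = suc b
  D = N * R ∸ E
  regroup : ∀ x y v → x * v * (y * v) ≡ x * y * (v * v)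
  regroup = solve-∀
  1≤N : 1 ≤ N
  1≤N = n≢0⇒n>0 λ { refl → case ab<N² of λ () }
  E≤NR : E ≤ N * R
  E≤NR = begin
    E ≡⟨ *-identityʳ E ⟨
    E * 1 ≤⟨ *-monoʳ-≤ E (*-mono-≤ 1≤N (≤-trans (s≤s z≤n) (m≤n+m 2 N))) ⟩
    E * (N * (N + 2)) ≤⟨ <⇒≤ R> ⟩
    R ≡⟨ *-identityˡ R ⟨
    1 * R ≤⟨ *-monoˡ-≤ R 1≤N ⟩
    N * R ∎
  D+E : D + E ≡ N * R
  D+E = m∸n+n≡m E≤NR
  Dv≤o : D * v ≤ o
  Dv≤o = +-cancelʳ-≤ (E * v) (D * v) o (begin
    D * v + E * v ≡⟨ *-distribʳ-+ v D E ⟨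
    (D + E) * v ≡⟨ trans (cong (_* v) D+E) (*-assoc N R v) ⟩
    N * (R * v) ≤⟨ o≥ ⟩
    o + E * v ∎)
  -- From (A - 1)(B - 1) ≥ 0 and A B < N². Together with the 2 E N R of the added terms, this
  -- produces the factor N (N + 2) of the hypothesis.
  A+B≤ : A + B ≤ N * N
  A+B≤ = ≤-trans (≤-trans (m≤m+n (A + B) (a * b)) (≤-reflexive (expand a b))) ab<N²
    where
    expand : ∀ a b → suc a + suc b + a * b ≡ suc (suc a * suc b)
    expand = solve-∀
  core : (A * R + E) * (B * R + E) < D * D
  core = +-cancelʳ-< (2 * (E * D) + E * E) _ _ (begin-strict
    (A * R + E) * (B * R + E) + (2 * (E * D) + E * E) ≡⟨ e₁ A B R E D ⟩
    A * B * (R * R) + (E * (A + B) * R + 2 * (E * (D + E))) ≤⟨ +-monoʳ-≤ (A * B * (R * R)) (+-mono-≤ (*-monoˡ-≤ R (*-monoʳ-≤ E A+B≤)) (≤-reflexive (cong (λ z → 2 * (E * z)) D+E))) ⟩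
    A * B * (R * R) + (E * (N * N) * R + 2 * (E * (N * R))) ≡⟨ cong (A * B * (R * R) +_) (e₂ E N R) ⟩
    A * B * (R * R) + E * (N * (N + 2)) * R <⟨ +-monoʳ-< (A * B * (R * R)) (*-monoˡ-< R ⦃ >-nonZero (≤-trans (s≤s z≤n) R>) ⦄ R>) ⟩
    A * B * (R * R) + R * R ≡⟨ +-comm (A * B * (R * R)) _ ⟩
    suc (A * B) * (R * R) ≤⟨ *-monoˡ-≤ (R * R) ab<N² ⟩
    N * N * (R * R) ≡⟨ e₃ N R ⟩
    N * R * (N * R) ≡⟨ cong (λ z → z * z) D+E ⟨
    (D + E) * (D + E) ≡⟨ e₄ D E ⟩
    D * D + (2 * (E * D) + E * E) ∎)
    where
    e₁ : ∀ A B R E D → (A * R + E) * (B * R + E) + (2 * (E * D) + E * E) ≡ A * B * (R * R) + (E * (A + B) * R + 2 * (E * (D + E)))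
    e₁ = solve-∀
    e₂ : ∀ E N R → E * (N * N) * R + 2 * (E * (N * R)) ≡ E * (N * (N + 2)) * R
    e₂ = solve-∀
    e₃ : ∀ N R → N * N * (R * R) ≡ N * R * (N * R)
    e₃ = solve-∀
    e₄ : ∀ D E → (D + E) * (D + E) ≡ D * D + (2 * (E * D) + E * E)
    e₄ = solve-∀

-- For pairs in which y has the order of v only, while x has order R v. Here N stands for the
-- maximum less one: as E < R, giving up one summand R v of the benchmark o absorbs the error E v.
product-bound′ : ∀ {N E R v A B x y o} → 1 ≤ v → A * B < R * (N * N) → E < R →
  x ≤ A * (R * v) → y ≤ B * v → suc N * (R * v) ≤ o + E * v → x * y < o * o
product-bound′ {N} {E} {R} {v} {A} {B} {x} {y} {o} 1≤v AB< E<R x≤ y≤ o≥ = begin-strict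
    x * y ≤⟨ *-mono-≤ x≤ y≤ ⟩
    A * (R * v) * (B * v) ≡⟨ e₁ A B R v ⟩
    A * B * (R * (v * v)) <⟨ *-monoˡ-< (R * (v * v)) ⦃ >-nonZero (*-mono-≤ (≤-trans (s≤s z≤n) E<R) (*-mono-≤ 1≤v 1≤v)) ⦄ AB< ⟩
    R * (N * N) * (R * (v * v)) ≡⟨ e₂ N R v ⟩
    N * (R * v) * (N * (R * v)) ≤⟨ *-mono-≤ le le ⟩
    o * o ∎
  where
  open ≤-Reasoning
  e₁ : ∀ A B R v → A * (R * v) * (B * v) ≡ A * B * (R * (v * v))
  e₁ = solve-∀
  e₂ : ∀ N R v → R * (N * N) * (R * (v * v)) ≡ N * (R * v) * (N * (R * v))
  e₂ = solve-∀
  le : N * (R * v) ≤ o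
  le = +-cancelʳ-≤ (R * v) _ _ (begin
    N * (R * v) + R * v ≡⟨ +-comm (N * (R * v)) (R * v) ⟩
    suc N * (R * v) ≤⟨ o≥ ⟩
    o + E * v ≤⟨ +-monoʳ-≤ o (*-monoˡ-≤ v (<⇒≤ E<R)) ⟩
    o + R * v ∎)

-- `main-term` feeds `product-bound` and makes the generator counts decisive; `lower-order` feeds
-- `product-bound′` and excludes covers above t + 1 blocks and missing generators. `growth` pays for
-- larger covers during branching, `r₂≥3` yields generic members near a (k-1)-clique, and
-- `second-order` breaks the tie at k = 2t + 3.
record Large (t q : ℕ) {b : ℕ} (S : CliqueSystem b (2 + (t + q))) : Set where
  open CliqueSystem S
  k : ℕ
  k = 2 + (t + q)
  N : ℕ
  N = (2 + t) ⊔ (1 + q)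
  field
    main-term   : (1 + t) * k ^ 2 * (N * (N + 2)) < r (1 + q)
    lower-order : (1 + t) * k * (binom (3 + t) t * k ^ 2) < r (1 + q) * ((N ∸ 1) * (N ∸ 1))
    growth      : ∀ m → 2 ≤ m → 2 + q ≤ m + m → k * ((4 + t) * (5 + t)) ≤ 20 * r m
    r₂≥3        : 3 ≤ r 2
    second-order : 2 ≤ t → q ≡ 1 + t → u t + u 2 < u (1 + t)

  k<r : k < r (1 + q)
  k<r = ≤-<-trans (begin
      k ≤⟨ m≤m*n k (k * 1) ⟩
      k ^ 2 ≤⟨ m≤n*m (k ^ 2) (1 + t) ⟩
      (1 + t) * k ^ 2 ≡⟨ *-identityʳ _ ⟨
      (1 + t) * k ^ 2 * 1 ≤⟨ *-monoʳ-≤ ((1 + t) * k ^ 2) (s≤s z≤n) ⟩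
      (1 + t) * k ^ 2 * (N * (N + 2)) ∎) main-term
    where open ≤-Reasoning

-- Comparison of a maximum pair with the extremal families

module Main (t q : ℕ) {b : ℕ} (S : CliqueSystem b (2 + (t + q))) (1≤t : 1 ≤ t) (1≤q : 1 ≤ q) (large : Large t q S) where
  open CliqueSystem S
  open CliqueCounts S
  open Large large using (main-term; lower-order; growth; r₂≥3; second-order; k<r)
  open ExtremalFamilies t q S 1≤t 1≤q k<r r₂≥3
  open Covers t q S 1≤t 1≤q k<r r₂≥3
  open Classification t q S 1≤t 1≤q k<r r₂≥3

  private
    R v H E : ℕ
    R = r (1 + q)
    v = u q
    H = binom (3 + t) t
    E = (1 + t) * k ^ 2

    N-1 : ℕ
    N-1 = (1 + t) ⊔ q

    N-1≤k : N-1 ≤ k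
    N-1≤k = ⊔-lub (s≤s (m≤n⇒m≤1+n (m≤m+n t q))) (m≤n⇒m≤1+n (m≤n⇒m≤1+n (m≤n+m q t)))

    E<R : E < R
    E<R = ≤-<-trans (≤-trans (≤-reflexive (sym (*-identityʳ E))) (*-monoʳ-≤ E (s≤s z≤n))) main-term

    u-1+q : u (1 + q) ≡ R * v
    u-1+q = u-suc q

    w-lower : ∀ z → u (1 + q) ≤ w (1 + q) z + z * v
    w-lower zero    = ≤-reflexive (sym (+-identityʳ _))
    w-lower (suc z) = begin
        u (1 + q) ≤⟨ w-lower z ⟩
        w (1 + q) z + z * v ≤⟨ +-monoˡ-≤ (z * v) (m≤n+m∸n (w (1 + q) z) (w q z)) ⟩
        w q z + (w (1 + q) z ∸ w q z) + z * v ≤⟨ +-monoˡ-≤ (z * v) (+-monoˡ-≤ _ (w≤u q z)) ⟩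
        v + w (1 + q) (suc z) + z * v ≡⟨ arith v (w (1 + q) (suc z)) (z * v) ⟩
        w (1 + q) (suc z) + (v + z * v) ∎
      where
      open ≤-Reasoning
      arith : ∀ a b c → a + b + c ≡ b + (a + c)
      arith = solve-∀
      w≤u : ∀ i z → w i z ≤ u i
      w≤u i       zero    = ≤-refl
      w≤u zero    (suc z) = z≤n
      w≤u (suc i) (suc z) = ≤-trans (m∸n≤m (w (suc i) z) (w i z)) (w≤u (suc i) z)

    -- Inclusion-exclusion cut off after pairs, with `z * z` as a generous bound for the number of
    -- pairs.
    m-lower : ∀ z → z * u (1 + q) ≤ m (2 + q) z + z * z * v
    m-lower zero    = z≤n
    m-lower (suc z) = begin
        u (1 + q) + z * u (1 + q) ≤⟨ +-mono-≤ (w-lower z) (m-lower z) ⟩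
        w (1 + q) z + z * v + (m (2 + q) z + z * z * v) ≤⟨ m≤m+n _ ((1 + z) * v) ⟩
        w (1 + q) z + z * v + (m (2 + q) z + z * z * v) + (1 + z) * v ≡⟨ arith (w (1 + q) z) (m (2 + q) z) z v ⟩
        m (2 + q) z + w (1 + q) z + suc z * suc z * v ∎
      where
      open ≤-Reasoning
      arith : ∀ w m z v → w + z * v + (m + z * z * v) + (1 + z) * v ≡ m + w + suc z * suc z * v
      arith = solve-∀

    -- o is the size of a family paired with itself, 𝒩₂ or 𝒩₁ according to which term attains N. Its
    -- lower bound N R v - E v is written without subtraction.
    Benchmark : ℕ → Set
    Benchmark x = ∃ λ o → N * (R * v) ≤ o + E * v × o * o ≤ x

    N≡2+t : 1 + q ≤ 2 + t → N ≡ 2 + t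
    N≡2+t le = m≥n⇒m⊔n≡m le
    N≡1+q : 2 + t ≤ 1 + q → N ≡ 1 + q
    N≡1+q le = m≤n⇒m⊔n≡n le

    2+t≤E : 2 + t ≤ E
    2+t≤E = ≤-trans (s≤s (s≤s (m≤m+n t q))) (≤-trans (m≤m*n k (k * 1)) (m≤n*m (k ^ 2) (1 + t)))

    [1+q]²≤E : (1 + q) * (1 + q) ≤ E
    [1+q]²≤E = ≤-trans (*-mono-≤ le (≤-trans le (≤-reflexive (sym (*-identityʳ k))))) (m≤n*m (k ^ 2) (1 + t))
      where
      le : 1 + q ≤ k
      le = s≤s (m≤n⇒m≤1+n (m≤n+m q t))

    N₂-size : (2 + t) * (R * v) ≤ v + w (1 + q) 1 * (2 + t) + E * v
    N₂-size = begin
        (2 + t) * (R * v) ≡⟨ cong ((2 + t) *_) u-1+q ⟨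
        (2 + t) * u (1 + q) ≤⟨ *-monoʳ-≤ (2 + t) (w-lower 1) ⟩
        (2 + t) * (w (1 + q) 1 + 1 * v) ≡⟨ arith t (w (1 + q) 1) v ⟩
        w (1 + q) 1 * (2 + t) + (2 + t) * v ≤⟨ +-mono-≤ (m≤n+m _ v) (*-monoˡ-≤ v 2+t≤E) ⟩
        v + w (1 + q) 1 * (2 + t) + E * v ∎
      where
      open ≤-Reasoning
      arith : ∀ t w v → (2 + t) * (w + 1 * v) ≡ w * (2 + t) + (2 + t) * v
      arith = solve-∀

    ν₁-size : (1 + q) * (R * v) ≤ ν₁ + E * v
    ν₁-size = begin
        (1 + q) * (R * v) ≡⟨ cong ((1 + q) *_) u-1+q ⟨
        (1 + q) * u (1 + q) ≤⟨ m-lower (1 + q) ⟩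
        m (2 + q) (1 + q) + (1 + q) * (1 + q) * v ≤⟨ +-mono-≤ (m≤m+n (m (2 + q) (1 + q)) (w 2 1 * t)) (*-monoˡ-≤ v [1+q]²≤E) ⟩
        ν₁ + E * v ∎
      where open ≤-Reasoning

  module _ {P Q : Subset b → Set} {P? : Decidable P} {Q? : Decidable Q} (max : Maximal P? Q?) where
    open Maximal max using (maximal)

    N₂-competitor : ∃ λ o → v + w (1 + q) 1 * (2 + t) ≤ o × o * o ≤ count P? * count Q?
    N₂-competitor = let Z , cZ = clique-exists (2 + t) (s≤s (s≤s (m≤m+n t q))) in
      count (N₂? Z) , Family₂.N₂-count cZ , maximal (N₂? Z) (N₂? Z) (Family₂.N₂-admissible cZ)

    -- The diagonal choice L = M is admissible once t ≤ q + 1 and has the size ν₁ of the general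
    -- case.
    N₁-competitor : t ≤ 1 + q → ν₁ * ν₁ ≤ count P? * count Q?
    N₁-competitor le = let T , L , sL = sunflower-exists in
      subst (λ x → x * x ≤ count P? * count Q?) (N₁-count sL sL)
        (maximal (N₁? T L L) (N₁? T L L) (Family₁.N₁-admissible sL le))

    benchmark : Benchmark (count P? * count Q?)
    benchmark = [ first , second ]′ (≤-total (1 + q) (2 + t))
      where
      first : 1 + q ≤ 2 + t → Benchmark (count P? * count Q?)
      first le = let o , o≥ , oo≤ = N₂-competitor in
        o , ≤-trans (≤-trans (≤-reflexive (cong (_* (R * v)) (N≡2+t le))) N₂-size) (+-monoˡ-≤ (E * v) o≥) , oo≤
      second : 2 + t ≤ 1 + q → Benchmark (count P? * count Q?)
      second le = ν₁ , ≤-trans (≤-reflexive (cong (_* (R * v)) (N≡1+q le))) ν₁-size ,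
        N₁-competitor (≤-trans (m≤n+m t 2) le)

  private
    -- β₁ is the branching bound for covers of t + 1 blocks: t + 1 choices of a t-set and one
    -- branching step. β₂ is the bound for t + 3 blocks with two steps; it serves all larger covers.
    β₁ β₂ : ℕ
    β₁ = (1 + t) * k * (R * v)
    β₂ = H * k ^ 2 * v

    not-lower-order : ∀ {x y} → Benchmark (x * y) → x ≤ β₁ → y ≤ β₂ → ⊥
    not-lower-order (o , o≥ , oo≤) x≤ y≤ =
      <⇒≱ (product-bound′ {N-1} {E} {R} {v} {(1 + t) * k} {H * k ^ 2} {o = o} (u-pos q) lower-order E<R x≤ y≤ o≥) oo≤

    β₂≤β₁ : β₂ ≤ β₁
    β₂≤β₁ = begin
        H * k ^ 2 * v ≡⟨ e₁ H k v ⟩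
        k * (H * k * v) ≤⟨ *-monoʳ-≤ k (*-monoˡ-≤ v Hk≤R) ⟩
        k * (R * v) ≤⟨ m≤n*m (k * (R * v)) (1 + t) ⟩
        (1 + t) * (k * (R * v)) ≡⟨ *-assoc (1 + t) k (R * v) ⟨
        (1 + t) * k * (R * v) ∎
      where
      open ≤-Reasoning
      e₁ : ∀ H k v → H * (k * (k * 1)) * v ≡ k * (H * k * v)
      e₁ = solve-∀
      e₂ : ∀ t H k → (1 + t) * k * (H * (k * (k * 1))) ≡ (1 + t) * (H * k) * (k * k)
      e₂ = solve-∀
      Hk≤R : H * k ≤ R
      Hk≤R = ≤-trans (m≤n*m (H * k) (1 + t)) (<⇒≤ (*-cancelʳ-< (k * k) _ _ (begin-strict
        (1 + t) * (H * k) * (k * k) ≡⟨ e₂ t H k ⟨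
        (1 + t) * k * (H * k ^ 2) <⟨ lower-order ⟩
        R * (N-1 * N-1) ≤⟨ *-monoʳ-≤ R (*-mono-≤ N-1≤k N-1≤k) ⟩
        R * (k * k) ∎)))

    -- Two further blocks of the cover cost less than one level of branching gains.
    branching-bound : ∀ i p → q ≡ i + p → i ≤ p → binom (3 + (i + i) + t) t * (k ^ (2 + i) * u p) ≤ H * (k ^ 2 * v)
    branching-bound zero    p refl _ = ≤-refl
    branching-bound (suc i) p q≡ (s≤s {n = p′} i≤p) = begin
        binom (3 + (suc i + suc i) + t) t * (k ^ (3 + i) * u p) ≡⟨ cong (λ x → binom (4 + x + t) t * (k ^ (3 + i) * u p)) (+-suc i i) ⟩
        B₅ * (k * K * u p) ≡⟨ e₁ B₅ k K (u p) ⟩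
        B₅ * k * (K * u p) ≤⟨ *-monoˡ-≤ (K * u p) step ⟩
        B₃ * r (suc p) * (K * u p) ≡⟨ e₂ B₃ (r (suc p)) K (u p) ⟩
        B₃ * (K * (r (suc p) * u p)) ≡⟨ cong (λ x → B₃ * (K * x)) (u-suc p) ⟨
        B₃ * (K * u (suc p)) ≤⟨ branching-bound i (suc p) (trans q≡ (sym (+-suc i p))) (m≤n⇒m≤1+n (m≤n⇒m≤1+n i≤p)) ⟩
        H * (k ^ 2 * v) ∎
      where
      open ≤-Reasoning
      d = i + i
      K = k ^ (2 + i)
      B₃ = binom (3 + d + t) t
      B₄ = binom (4 + d + t) t
      B₅ = binom (5 + d + t) t
      e₁ : ∀ a b c d → a * (b * c * d) ≡ a * b * (c * d)
      e₁ = solve-∀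
      e₂ : ∀ a b c d → a * b * (c * d) ≡ a * (c * (b * d))
      e₂ = solve-∀
      ups : (5 + d) * (4 + d) * B₅ ≡ (5 + d + t) * (4 + d + t) * B₃
      ups = begin-equality
        (5 + d) * (4 + d) * B₅ ≡⟨ f₁ (5 + d) (4 + d) B₅ ⟩
        (4 + d) * ((5 + d) * B₅) ≡⟨ cong ((4 + d) *_) (binom-up (4 + d) t) ⟩
        (4 + d) * ((5 + d + t) * B₄) ≡⟨ f₂ (4 + d) (5 + d + t) B₄ ⟩
        (5 + d + t) * ((4 + d) * B₄) ≡⟨ cong ((5 + d + t) *_) (binom-up (3 + d) t) ⟩
        (5 + d + t) * ((4 + d + t) * B₃) ≡⟨ *-assoc (5 + d + t) (4 + d + t) B₃ ⟨
        (5 + d + t) * (4 + d + t) * B₃ ∎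
        where
        f₁ : ∀ a b c → a * b * c ≡ b * (a * c)
        f₁ = solve-∀
        f₂ : ∀ a b c → a * (b * c) ≡ b * (a * c)
        f₂ = solve-∀
      -- By `ups` the quotient B₅ / B₃ is (5+d+t)(4+d+t) / ((5+d)(4+d)), which is largest at d = 0.
      -- There its denominator is the 20 of `growth`.
      step : B₅ * k ≤ B₃ * r (suc p)
      step = *-cancelˡ-≤ (20 * ((5 + d) * (4 + d))) (begin
        20 * ((5 + d) * (4 + d)) * (B₅ * k) ≡⟨ g₁ ((5 + d) * (4 + d)) B₅ k ⟩
        20 * k * ((5 + d) * (4 + d) * B₅) ≡⟨ cong (20 * k *_) ups ⟩
        20 * k * ((5 + d + t) * (4 + d + t) * B₃) ≡⟨ g₂ k (5 + d + t) (4 + d + t) B₃ ⟩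
        5 * (5 + d + t) * (4 * (4 + d + t)) * (k * B₃) ≤⟨ *-monoˡ-≤ (k * B₃) (*-mono-≤ (h 5 d t) (h 4 d t)) ⟩
        (5 + t) * (5 + d) * ((4 + t) * (4 + d)) * (k * B₃) ≡⟨ g₃ k t d B₃ ⟩
        k * ((4 + t) * (5 + t)) * ((5 + d) * (4 + d) * B₃) ≤⟨ *-monoˡ-≤ ((5 + d) * (4 + d) * B₃) (growth (suc p) (s≤s (≤-trans (s≤s z≤n) (s≤s i≤p))) size≤) ⟩
        20 * r (suc p) * ((5 + d) * (4 + d) * B₃) ≡⟨ g₄ (r (suc p)) ((5 + d) * (4 + d)) B₃ ⟩
        20 * ((5 + d) * (4 + d)) * (B₃ * r (suc p)) ∎)
        where
        g₁ : ∀ a b c → 20 * a * (b * c) ≡ 20 * c * (a * b)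
        g₁ = solve-∀
        g₂ : ∀ k a b c → 20 * k * (a * b * c) ≡ 5 * a * (4 * b) * (k * c)
        g₂ = solve-∀
        g₃ : ∀ k t d B → (5 + t) * (5 + d) * ((4 + t) * (4 + d)) * (k * B) ≡ k * ((4 + t) * (5 + t)) * ((5 + d) * (4 + d) * B)
        g₃ = solve-∀
        g₄ : ∀ a b c → 20 * a * (b * c) ≡ 20 * b * (c * a)
        g₄ = solve-∀
        h : ∀ a d t → a * (a + d + t) ≤ (a + t) * (a + d)
        h a d t = ≤-trans (m≤m+n _ (t * d)) (≤-reflexive (expand a d t))
          where
          expand : ∀ a d t → a * (a + d + t) + t * d ≡ (a + t) * (a + d)
          expand = solve-∀
        size≤ : 2 + q ≤ suc p + suc p
        size≤ = ≤-trans (≤-reflexive (cong (2 +_) q≡)) (≤-trans (s≤s (s≤s (+-monoˡ-≤ p (s≤s i≤p)))) (≤-reflexive (cong suc (sym (+-suc p p)))))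

    -- The depth d may be chosen below s - t, so that a large cover need not be used for branching
    -- to its full size.
    LevelBound : ℕ → ℕ → Set
    LevelBound s β = ∃ λ d → ∃ λ i → d + t ≤ s × i + (d + t) ≡ k × binom s t * (k ^ d * u i) ≤ β

    level-one : LevelBound (1 + t) β₁
    level-one = 1 , 1 + q , ≤-refl , [1+q]+[1+t] refl , ≤-reflexive (trans
      (cong₂ (λ x y → x * (k ^ 1 * y)) (binom-[1+n]-n t) u-1+q) (e (1 + t) k (R * v)))
      where
      e : ∀ a b c → a * (b * 1 * c) ≡ a * b * c
      e = solve-∀

    -- Each further branching step replaces a factor r m by k, which does not pay for small m, as r
    -- 1 = 1. So only about half of the s - t - 2 additional levels are used: then every m that
    -- occurs satisfies 2 m ≥ q + 2, the range of `growth`.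
    level-two : ∀ s → 2 + t ≤ s → s ≤ k → LevelBound s β₂
    level-two s s≥ s≤ =
      let d = s ∸ (2 + t)
          s≡ : d + (2 + t) ≡ s
          s≡ = m∸n+n≡m s≥
          i , lo , hi = half d
          p = q ∸ i
          d≤q : d ≤ q
          d≤q = +-cancelʳ-≤ (2 + t) d q (≤-trans (≤-reflexive s≡) (≤-trans s≤ (≤-reflexive (sym (q+[2+t] refl)))))
          i≤q : i ≤ q
          i≤q = ≤-trans (m≤m+n i i) (≤-trans lo d≤q)
          q≡ : i + p ≡ q
          q≡ = m+[n∸m]≡n i≤q
      in 2 + i , p ,
         ≤-trans (≤-reflexive (move i t)) (≤-trans (+-monoˡ-≤ (2 + t) (≤-trans (m≤m+n i i) lo)) (≤-reflexive s≡)) ,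
         trans (rearrange p i t) (trans (cong (λ x → 2 + (t + x)) q≡) refl) ,
         ≤-trans (*-monoˡ-≤ (k ^ (2 + i) * u p) (binom-mono t (≤-trans (≤-reflexive (sym s≡)) (≤-trans (+-monoˡ-≤ (2 + t) hi) (≤-reflexive (move′ (i + i) t))))))
           (≤-trans (branching-bound i p (sym q≡) (+-cancelˡ-≤ i i p (≤-trans lo (≤-trans d≤q (≤-reflexive (sym q≡))))))
                    (≤-reflexive (sym (*-assoc H (k ^ 2) v))))
      where
      move : ∀ i t → 2 + i + t ≡ i + (2 + t)
      move = solve-∀
      move′ : ∀ d t → suc d + (2 + t) ≡ 3 + d + t
      move′ = solve-∀
      rearrange : ∀ p i t → p + (2 + i + t) ≡ 2 + (t + (i + p))
      rearrange = solve-∀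

    level : ∀ s → 1 + t ≤ s → s ≤ k → LevelBound s β₁
    level s s≥ s≤ = [ large-s , (λ e → subst (λ x → LevelBound x β₁) e level-one) ]′ (m≤n⇒m<n∨m≡n s≥)
      where
      large-s : 2 + t ≤ s → LevelBound s β₁
      large-s lt = let d , i , d≤ , e , le = level-two s lt s≤ in d , i , d≤ , e , ≤-trans le β₂≤β₁

  record CoverNumber (P : Subset b → Set) : Set where
    field
      C       : Subset b
      cover   : Cover P C
      C≥      : 1 + t ≤ ∣ C ∣
      C≤      : ∣ C ∣ ≤ k
      minimal : ∀ {B} → ∣ B ∣ < ∣ C ∣ → ¬ Cover P B

  module _ {P Q : Subset b → Set} {P? : Decidable P} {Q? : Decidable Q} (max : Maximal P? Q?) where
    open Maximal max
    private module Sd = Side P? Q? adm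

    coverNumber : CoverNumber Q
    coverNumber = build (least (λ s → anySubset? (λ C → (∣ C ∣ ≟ s) ×-dec cover? Q? C)) k
      (let F , pF = Side.nonemptyʳ Q? P? (admissible-sym adm) in F , size (cliqueˡ pF) , (λ qG → cross pF qG)))
      where
      build : (∃ λ s → (∃ λ C → ∣ C ∣ ≡ s × Cover Q C) × s ≤ k × (∀ {s′} → s′ < s → ¬ (∃ λ C → ∣ C ∣ ≡ s′ × Cover Q C))) → CoverNumber Q
      build (s , (C , refl , cov) , s≤ , min) = record
        { C = C ; cover = cov ; C≥ = Sd.cover-size C cov ; C≤ = s≤ ; minimal = λ {B} lt covB → min lt (B , refl , covB) }

    -- The binomial factor comes from the smallest cover of P and the depth from that of Q, so a
    -- bound for P alone mixes two cover numbers.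
    branching-count : (cP : CoverNumber P) (cQ : CoverNumber Q) → ∀ {d i} → d + t ≤ ∣ CoverNumber.C cQ ∣ → i + (d + t) ≡ k →
      count P? ≤ binom ∣ CoverNumber.C cP ∣ t * (k ^ d * u i)
    branching-count cP cQ {d} {i} d≤ e = Sd.branch-from-cover P? id (CoverNumber.C cP) (CoverNumber.cover cP) i d e
      (λ {F} {B} _ _ lt → CoverNumber.minimal cQ {B} (≤-trans lt d≤))

    generated-count : (cP : CoverNumber P) → ∣ CoverNumber.C cP ∣ ≡ 1 + t → count P? ≤ (count (generator? Q?) * R + E) * v
    generated-count cP e = ≤-trans (Sd.generated-bound (CoverNumber.C cP) (CoverNumber.cover cP) e)
      (≤-reflexive (trans (cong₂ (λ x y → count (generator? Q?) * x + y * (k ^ 2 * v)) u-1+q (binom-[1+n]-n t))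
                          (arith (count (generator? Q?)) R v (1 + t) (k ^ 2))))
      where
      arith : ∀ a R v s K → a * (R * v) + s * (K * v) ≡ (a * R + s * K) * v
      arith = solve-∀

    no-generators : ¬ ∃ (Generator Q) → count (generator? Q?) ≡ 0
    no-generators none = count-≡0 (generator? Q?) (λ J g → none (J , g))

    -- Without generators only the remainder E v of `generated-count` is left, and its binomial t +
    -- 1 is at most H.
    few-generators : (cP : CoverNumber P) → ∣ CoverNumber.C cP ∣ ≡ 1 + t → ¬ ∃ (Generator Q) → count P? ≤ β₂
    few-generators cP e none = ≤-trans (generated-count cP e) (≤-trans
      (≤-reflexive (cong (λ x → (x * R + E) * v) (no-generators none)))
      (*-monoˡ-≤ v (*-monoˡ-≤ (k ^ 2) (≤-trans (≤-reflexive (sym (binom-[1+n]-n t))) (binom-mono t (m≤n+m (1 + t) 2))))))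

  module Structure {P Q : Subset b → Set} {P? : Decidable P} {Q? : Decidable Q} (max : Maximal P? Q?) where
    open Maximal max

    private
      cP : CoverNumber P
      cP = coverNumber (maximal-sym max)
      cQ : CoverNumber Q
      cQ = coverNumber max
      sP sQ : ℕ
      sP = ∣ CoverNumber.C cP ∣
      sQ = ∣ CoverNumber.C cQ ∣
      bench : Benchmark (count P? * count Q?)
      bench = benchmark max
      bench′ : Benchmark (count Q? * count P?)
      bench′ = subst Benchmark (*-comm (count P?) (count Q?)) bench

      -- The binomial factors are exchanged between the two bounds.
      levels : ∀ {x y} → LevelBound sP x → LevelBound sQ y → count P? * count Q? ≤ x * y
      levels {x} {y} (d , i , d≤ , e , le) (d′ , i′ , d′≤ , e′ , le′) = begin
          count P? * count Q? ≤⟨ *-mono-≤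
            (branching-count max cP cQ d′≤ e′) (branching-count (maximal-sym max) cQ cP d≤ e) ⟩
          binom sP t * (k ^ d′ * u i′) * (binom sQ t * (k ^ d * u i)) ≡⟨ swap (binom sP t) _ (binom sQ t) _ ⟩
          binom sP t * (k ^ d * u i) * (binom sQ t * (k ^ d′ * u i′)) ≤⟨ *-mono-≤ le le′ ⟩
          x * y ∎
        where
        open ≤-Reasoning
        swap : ∀ a b c d → a * b * (c * d) ≡ a * d * (c * b)
        swap = solve-∀

      -- A cover number above t + 1 on either side puts the whole product below β₁ β₂, which is less
      -- than the benchmark.
      minimal-covers : sP ≡ 1 + t × sQ ≡ 1 + t
      minimal-covers = [ (λ lt → ⊥-elim (not-lower-order {β₁} {β₂} (weaken (subst (count P? * count Q? ≤_) (*-comm β₂ β₁) (levels (level-two sP lt (CoverNumber.C≤ cP)) (level sQ (CoverNumber.C≥ cQ) (CoverNumber.C≤ cQ))))) ≤-refl ≤-refl))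
                       , (λ eP → [ (λ lt → ⊥-elim (not-lower-order {β₁} {β₂} (weaken (levels (level sP (CoverNumber.C≥ cP) (CoverNumber.C≤ cP)) (level-two sQ lt (CoverNumber.C≤ cQ)))) ≤-refl ≤-refl))
                                 , (λ eQ → sym eP , sym eQ) ]′ (m≤n⇒m<n∨m≡n (CoverNumber.C≥ cQ))) ]′ (m≤n⇒m<n∨m≡n (CoverNumber.C≥ cP))
        where
        weaken : ∀ {x} → count P? * count Q? ≤ x → Benchmark x
        weaken le = let o , o≥ , oo≤ = bench in o , o≥ , ≤-trans oo≤ le

      P≤β₁ : count P? ≤ β₁
      P≤β₁ = let d , i , d≤ , e , le = level-one in
        ≤-trans (branching-count max cP cQ (≤-trans d≤ (≤-reflexive (sym (proj₂ minimal-covers)))) e)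
                (≤-trans (≤-reflexive (cong (λ s → binom s t * (k ^ d * u i)) (proj₁ minimal-covers))) le)
      Q≤β₁ : count Q? ≤ β₁
      Q≤β₁ = let d , i , d≤ , e , le = level-one in
        ≤-trans (branching-count (maximal-sym max) cQ cP (≤-trans d≤ (≤-reflexive (sym (proj₁ minimal-covers)))) e)
                (≤-trans (≤-reflexive (cong (λ s → binom s t * (k ^ d * u i)) (proj₂ minimal-covers))) le)

      someJ : ∃ (Generator Q)
      someJ = decidable-stable (anySubset? (generator? Q?)) (λ none →
        not-lower-order bench′ Q≤β₁ (few-generators max cP (proj₁ minimal-covers) none))
      someK : ∃ (Generator P)
      someK = decidable-stable (anySubset? (generator? P?)) (λ none →
        not-lower-order bench P≤β₁ (few-generators (maximal-sym max) cQ (proj₂ minimal-covers) none))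

      many : ManyGenerators P? Q?
      many = record { big = ≮⇒≥ (λ lt → let o , o≥ , oo≤ = bench in
        <⇒≱ (product-bound {N} {E} {R} {v} {count (generator? Q?)} {count (generator? P?)} {o = o} (u-pos q)
               (count-≥1 (generator? Q?) someJ) (count-≥1 (generator? P?) someK) lt main-term
               (generated-count max cP (proj₁ minimal-covers)) (generated-count (maximal-sym max) cQ (proj₂ minimal-covers)) o≥) oo≤) }

    structure : (2 + t ≤ 1 + q × SunflowerType P Q {P?} {Q?}) ⊎ (1 + q ≤ 2 + t × SimplexType P Q) ⊎ (N ≤ 3 × SquareType P Q)
    structure = Both.classification max someJ someK many

-- From generators to families

module Conclusion (t q : ℕ) {b : ℕ} (S : CliqueSystem b (2 + (t + q))) (1≤t : 1 ≤ t) (1≤q : 1 ≤ q) (large : Large t q S) where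
  open CliqueSystem S
  open CliqueCounts S
  open Large large using (r₂≥3; second-order; k<r)
  open ExtremalFamilies t q S 1≤t 1≤q k<r r₂≥3
  open Covers t q S 1≤t 1≤q k<r r₂≥3
  open Classification t q S 1≤t 1≤q k<r r₂≥3
  open Main t q S 1≤t 1≤q large

  infix 4 _≗_
  _≗_ : (Subset b → Set) → (Subset b → Set) → Set
  P ≗ P′ = (∀ {F} → P F → P′ F) × (∀ {F} → P′ F → P F)

  N₃ : Subset b → Subset b → Subset b → Subset b → Set
  N₃ X Y W F = Clique k F × (X ⊆ F ⊎ Y ⊆ F ⊎ W ⊆ F)

  record Form₁ (P Q : Subset b → Set) : Set where
    field
      {T L M}  : Subset b
      sL       : Sunflower T L
      sM       : Sunflower T M
      t+min≤   : t + (t ⊓ 2) ≤ ∣ L ∩ M ∣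
      P≗       : P ≗ N₁ T L M
      Q≗       : Q ≗ N₁ T M L

  record Form₂ (P Q : Subset b → Set) : Set where
    field
      {Z} : Subset b
      cZ  : Clique (2 + t) Z
      P≗  : P ≗ N₂ Z
      Q≗  : Q ≗ N₂ Z

  record Form₃ (P Q : Subset b → Set) : Set where
    field
      e₁ e₂ e₃ e₄ : Fin b
      c₁₂ : Clique (1 + t) (e₁ ∙ e₂)
      c₃₄ : Clique (1 + t) (e₃ ∙ e₄)
      c₁₃ : Clique (1 + t) (e₁ ∙ e₃)
      c₂₄ : Clique (1 + t) (e₂ ∙ e₄)
      c₁₄ : Clique (1 + t) (e₁ ∙ e₄)
      P≗  : P ≗ N₃ (e₁ ∙ e₂) (e₃ ∙ e₄) (e₁ ∙ e₄)
      Q≗  : Q ≗ N₃ (e₁ ∙ e₃) (e₂ ∙ e₄) (e₁ ∙ e₄)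

  module FromSunflower {P Q : Subset b → Set} {P? : Decidable P} {Q? : Decidable Q} (max : Maximal P? Q?)
                       (2+t≤1+q : 2 + t ≤ 1 + q) (st : SunflowerType P Q {P?} {Q?}) where
    open Maximal max
    open SunflowerType st
    private
      J₀ = count-≥1⁻ (generator? Q?) (≤-trans (s≤s z≤n) manyJ)
      K₀ = count-≥1⁻ (generator? P?) (≤-trans (s≤s z≤n) manyK)
      module PA = Side.Petals P? Q? adm ∣T∣ (proj₂ J₀) (T⊆J (proj₂ J₀))
      module PB = Side.Petals Q? P? (admissible-sym adm) ∣T∣ (proj₂ K₀) (T⊆K (proj₂ K₀))
      module AM = PA.Maximum (≤-trans manyJ (count-mono (generator? Q?) PA.through? (λ _ g → g , T⊆J g)))
      module BM = PB.Maximum (≤-trans manyK (count-mono (generator? P?) PB.through? (λ _ g → g , T⊆K g)))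

      L M : Subset b
      L = AM.L
      M = BM.L

      inP : ∀ {F} → Dec (T ⊆ F) → P F → N₁ T L M F
      inP (yes T⊆F) pF = cliqueˡ pF , inj₁ ((λ {x} → T⊆F {x}) , AM.P-meets pF T⊆F)
      inP (no  T⊈F) pF = cliqueˡ pF , inj₂ ((λ T⊆F → T⊈F T⊆F) , BM.Q-near pF T⊈F)
      inQ : ∀ {G} → Dec (T ⊆ G) → Q G → N₁ T M L G
      inQ (yes T⊆G) qG = cliqueʳ qG , inj₁ ((λ {x} → T⊆G {x}) , BM.P-meets qG T⊆G)
      inQ (no  T⊈G) qG = cliqueʳ qG , inj₂ ((λ T⊆G → T⊈G T⊆G) , AM.Q-near qG T⊈G)

      P⇒ : ∀ {F} → P F → N₁ T L M F
      P⇒ {F} = inP (T ⊆? F)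
      Q⇒ : ∀ {G} → Q G → N₁ T M L G
      Q⇒ {G} = inQ (T ⊆? G)

      P≤ν₁ : count P? ≤ ν₁
      P≤ν₁ = ≤-trans (count-mono P? (N₁? T L M) (λ _ → P⇒)) (≤-reflexive (N₁-count AM.sunflower BM.sunflower))
      Q≤ν₁ : count Q? ≤ ν₁
      Q≤ν₁ = ≤-trans (count-mono Q? (N₁? T M L) (λ _ → Q⇒)) (≤-reflexive (N₁-count BM.sunflower AM.sunflower))

      -- P and Q lie in two families of size ν₁ each, and the diagonal competitor has product ν₁².
      -- So both inclusions are equalities, although the enclosing pair is not yet known to be cross
      -- t-intersecting.
      exact : ν₁ ≤ count P? × ν₁ ≤ count Q?
      exact = tight (≤-trans (count-≥1 P? (Side.nonemptyʳ Q? P? (admissible-sym adm))) P≤ν₁)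
                    (N₁-competitor max (≤-trans (m≤n+m t 2) 2+t≤1+q)) P≤ν₁ Q≤ν₁ ≤-refl

      P⇐ : ∀ {F} → N₁ T L M F → P F
      P⇐ {F} = count-full P? (N₁? T L M) (λ _ → P⇒) (≤-trans (≤-reflexive (N₁-count AM.sunflower BM.sunflower)) (proj₁ exact)) F
      Q⇐ : ∀ {G} → N₁ T M L G → Q G
      Q⇐ {G} = count-full Q? (N₁? T M L) (λ _ → Q⇒) (≤-trans (≤-reflexive (N₁-count BM.sunflower AM.sunflower)) (proj₂ exact)) G

    form₁ : Form₁ P Q
    form₁ = record
      { sL = AM.sunflower ; sM = BM.sunflower
      ; t+min≤ = N₁-cross⇒overlap AM.sunflower BM.sunflower (λ nF nG → cross (P⇐ nF) (Q⇐ nG))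
      ; P≗ = P⇒ , P⇐ ; Q≗ = Q⇒ , Q⇐ }

    -- For k = 2t + 3 the leading terms of ∣𝒩₁∣ and ∣𝒩₂∣ agree and 𝒩₂ wins at second order.
    not-balanced : 2 ≤ t → q ≢ 1 + t
    not-balanced 2≤t refl = let o , o≥ , oo≤ = N₂-competitor max
                                ν₁<o = <-≤-trans ν₁< o≥ in
      <⇒≱ (*-mono-< ν₁<o ν₁<o) (≤-trans oo≤ (*-mono-≤ P≤ν₁ Q≤ν₁))
      where
      w-step : ∀ i z → w i (suc z) ≤ w i z
      w-step zero    z = z≤n
      w-step (suc i) z = m∸n≤m (w (suc i) z) (w i z)
      w-≤2 : ∀ i z → w i (2 + z) ≤ w i 2
      w-≤2 i zero    = ≤-refl
      w-≤2 i (suc z) = ≤-trans (w-step i (2 + z)) (w-≤2 i z)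
      m-upper : ∀ i z → m (suc i) (2 + z) ≤ u i + w i 1 + z * w i 2
      m-upper i zero    = ≤-reflexive (sym (+-identityʳ _))
      m-upper i (suc z) = ≤-trans (+-mono-≤ (m-upper i z) (w-≤2 i z)) (≤-reflexive (arith (u i + w i 1) (z * w i 2) (w i 2)))
        where
        arith : ∀ a b c → a + b + c ≡ a + (c + b)
        arith = solve-∀
      -- With A = u (2 + t), v = u (1 + t), x = u t, the left side bounds ν₁ and the right side
      -- bounds 𝒩₂ from below. All leading terms cancel and the difference is t (v - x - W).
      compare : ∀ {A v x W U} → x + U < v → W ≤ U → v + v ≤ A →
        A + (A ∸ v) + t * ((A ∸ v) ∸ (v ∸ x)) + W * t < v + (A ∸ v) * (2 + t)
      compare {A} {v} {x} {W} {U} xU<v W≤U vv≤A = begin-strict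
          A + B + t * C + W * t ≡⟨ cong (λ z → z + B + t * C + W * t) A≡ ⟩
          B + v + B + t * C + W * t <⟨ +-monoʳ-< (B + v + B + t * C) (*-monoˡ-< t ⦃ >-nonZero 1≤t ⦄ W<y) ⟩
          B + v + B + t * C + y * t ≡⟨ e₁ B v t C y ⟩
          v + (B * 2 + (C + y) * t) ≡⟨ cong (λ z → v + (B * 2 + z * t)) B≡ ⟨
          v + (B * 2 + B * t) ≡⟨ cong (v +_) (*-distribˡ-+ B 2 t) ⟨
          v + B * (2 + t) ∎
        where
        open ≤-Reasoning
        y = v ∸ x
        B = A ∸ v
        C = B ∸ y
        A≡ : A ≡ B + v
        A≡ = sym (m∸n+n≡m (≤-trans (m≤m+n v v) vv≤A))
        v≤B : v ≤ B
        v≤B = +-cancelʳ-≤ v v B (≤-trans vv≤A (≤-reflexive A≡))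
        B≡ : B ≡ C + y
        B≡ = sym (m∸n+n≡m (≤-trans (m∸n≤m v x) v≤B))
        W<y : W < y
        W<y = m+n≤o⇒m≤o∸n (suc W) (≤-trans (s≤s (≤-trans (+-monoˡ-≤ x W≤U) (≤-reflexive (+-comm U x)))) xU<v)
        e₁ : ∀ B v t C y → B + v + B + t * C + y * t ≡ v + (B * 2 + (C + y) * t)
        e₁ = solve-∀
      2v≤ : u (1 + t) + u (1 + t) ≤ u (2 + t)
      2v≤ = ≤-trans (≤-trans (≤-reflexive (cong (u (1 + t) +_) (sym (+-identityʳ _))))
        (*-monoˡ-≤ (u (1 + t)) {2} {r (2 + t)} (≤-trans (s≤s (s≤s z≤n)) (<⇒≤ k<r)))) (≤-reflexive (sym (u-suc (1 + t))))
      ν₁< : ν₁ < u (1 + t) + w (2 + t) 1 * (2 + t)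
      ν₁< = ≤-<-trans (+-monoˡ-≤ (w 2 1 * t) (m-upper (2 + t) t))
        (compare {u (2 + t)} {u (1 + t)} {u t} {w 2 1} {u 2} (second-order 2≤t refl) (m∸n≤m (u 2) (u 1)) 2v≤)

  module FromSimplex {P Q : Subset b → Set} {P? : Decidable P} {Q? : Decidable Q} (max : Maximal P? Q?) (st : SimplexType P Q) where
    open SimplexType st

    third : ∀ x y → ∃ λ z → z ∈ Z × z ∉ ⁅ x ⁆ ⊕ y
    third x y = ∣∣<⇒∃ (⁅ x ⁆ ⊕ y) Z (≤-trans (s≤s (≤-trans size≤ (s≤s 1≤t))) (≤-reflexive (sym ∣Z∣)))
      where
      size≤ : ∣ ⁅ x ⁆ ⊕ y ∣ ≤ 2
      size≤ = ≤-trans (m≤m+n _ _) (≤-trans (≤-reflexive (∣∪∣+∣∩∣ ⁅ x ⁆ ⁅ y ⁆)) (≤-reflexive (cong₂ _+_ (∣⁅x⁆∣≡1 x) (∣⁅x⁆∣≡1 y))))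

    -- Z has t + 2 ≥ 3 blocks, so some block other than x and y can be removed. Any property of
    -- pairs in Z can thus be checked inside one generator.
    face : ∀ {x y} → x ∈ Z → y ∈ Z → ∃ λ A → A ⊆ Z × ∣ A ∣ ≡ 1 + t × x ∈ A × y ∈ A
    face {x} {y} x∈ y∈ = let z , z∈ , z∉ = third x y in
      Z - z , remove-⊆ Z z , suc-injective (trans (∣remove∣ z∈) ∣Z∣) ,
      x∈p∧x≢y⇒x∈p-y x∈ (λ x≡z → z∉ (subst (_∈ ⁅ x ⁆ ⊕ y) x≡z (A⊆A⊕x ⁅ x ⁆ y (x∈⁅x⁆ x)))) ,
      x∈p∧x≢y⇒x∈p-y y∈ (λ y≡z → z∉ (subst (_∈ ⁅ x ⁆ ⊕ y) y≡z (x∈A⊕x ⁅ x ⁆ y)))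

    cZ : Clique (2 + t) Z
    cZ = (λ j j∈ → let A , A⊆ , sA , j∈A , _ = face j∈ j∈ in proj₁ (isClique (proj₁ (allJ A⊆ sA))) j j∈A)
       , (λ i j i∈ j∈ → let A , A⊆ , sA , i∈A , j∈A = face i∈ j∈ in proj₂ (isClique (proj₁ (allJ A⊆ sA))) i j i∈A j∈A)
       , ∣Z∣

    open Family₂ cZ

    -- If F missed two blocks of Z, a generator containing both would lose two blocks to F.
    sub-N₂ : ∀ {R} → (∀ {A} → A ⊆ Z → ∣ A ∣ ≡ 1 + t → Generator R A) → ∀ {F} → Clique k F → R F → N₂ Z F
    sub-N₂ {R} all {F} cF rF = N₂⁺ cF (λ x∈ x∉ y∈ y∉ → let A , A⊆ , sA , x∈A , y∈A = face x∈ y∈ in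
      generator-⊑ (all A⊆ sA) rF x∈A x∉ y∈A y∉)

    N₂-cover : ∀ {R} → (∀ {A} → A ⊆ Z → ∣ A ∣ ≡ 1 + t → Generator R A) → ∀ {F} → N₂ Z F → Cover R F
    N₂-cover all {F} nF = through (Z ⊆? F)
      where
      facet : ∀ {z} → z ∈ Z → Z - z ⊆ F → Cover _ F
      facet {z} z∈ sub = cover-⊆ sub (proj₂ (all (remove-⊆ Z z) (suc-injective (trans (∣remove∣ z∈) ∣Z∣))))
      through : Dec (Z ⊆ F) → Cover _ F
      through (yes Z⊆F) = let z , z∈ = nonempty Z (≤-trans (s≤s z≤n) (≤-reflexive (sym ∣Z∣))) in
        facet z∈ (λ x∈ → Z⊆F (remove-⊆ Z z x∈))
      through (no Z⊈F) = let z , z∈ , z∉ = ⊈⇒∃ Z⊈F in facet z∈ (⊑-remove (N₂⁻ nF) z∈ z∉)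

    form₂ : Form₂ P Q
    form₂ = record
      { cZ = cZ
      ; P≗ = (λ pF → sub-N₂ {P} allK (Maximal.cliqueˡ max pF) pF) , (λ nF → closed max (proj₁ nF) (N₂-cover {Q} allJ nF))
      ; Q≗ = (λ qG → sub-N₂ {Q} allJ (Maximal.cliqueʳ max qG) qG) , (λ nG → closed (maximal-sym max) (proj₁ nG) (N₂-cover {P} allK nG)) }

  module FromSquare {P Q : Subset b → Set} {P? : Decidable P} {Q? : Decidable Q} (max : Maximal P? Q?) (st : SquareType P Q) where
    open SquareType st

    one-of : ∀ {R x y F} → Generator R (x ∙ y) → R F → x ∉ F → y ∈ F
    one-of {R} {x} {y} {F} g rF x∉ = ∈-stable (λ y∉ → contradiction (size (proj₁ g)) (λ e → <⇒≱ (s≤s 1≤t) (≤-trans (≤-reflexive (sym e))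
      (≤-trans (p⊆q⇒∣p∣≤∣q∣ (λ z∈ → single y∉ z∈)) (≤-reflexive (∣⁅x⁆∣≡1 x))))))
      where
      single : y ∉ F → ∀ {z} → z ∈ x ∙ y → z ∈ ⁅ x ⁆
      single y∉ {z} z∈ = [ id , (λ z≡y → subst (_∈ ⁅ x ⁆)
        (trans (generator-⊑ g rF (A⊆A⊕x ⁅ x ⁆ y (x∈⁅x⁆ x)) x∉ (x∈A⊕x ⁅ x ⁆ y) y∉) (sym z≡y)) (x∈⁅x⁆ x)) ]′ (∈-⊕⁻ ⁅ x ⁆ y z∈)

    pair⊆ : ∀ {x y F} → x ∈ F → y ∈ F → x ∙ y ⊆ F
    pair⊆ {x} {y} {F} x∈ y∈ = ⊕-⊆ (λ z∈ → subst (_∈ F) (sym (x∈⁅y⁆⇒x≡y x z∈)) x∈) y∈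

    -- The three generators are the edges of the path f₁, e₁, e₄, f₂. F meets each edge, and the
    -- minimal vertex covers of this path are the three listed pairs.
    contains : ∀ {R f₁ f₂ F} → Generator R (e₁ ∙ f₁) → Generator R (f₂ ∙ e₄) → Generator R (e₁ ∙ e₄) → R F →
      e₁ ∙ f₂ ⊆ F ⊎ f₁ ∙ e₄ ⊆ F ⊎ e₁ ∙ e₄ ⊆ F
    contains {f₁ = f₁} {f₂} {F} g₁ g₂ g₃ rF = decide (e₁ ∈? F) (f₂ ∈? F)
      where
      decide : Dec (e₁ ∈ F) → Dec (f₂ ∈ F) → e₁ ∙ f₂ ⊆ F ⊎ f₁ ∙ e₄ ⊆ F ⊎ e₁ ∙ e₄ ⊆ F
      decide (yes e₁∈) (yes f₂∈) = inj₁ (pair⊆ e₁∈ f₂∈)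
      decide (yes e₁∈) (no f₂∉)  = inj₂ (inj₂ (pair⊆ e₁∈ (one-of g₂ rF f₂∉)))
      decide (no e₁∉)  _         = inj₂ (inj₁ (pair⊆ (one-of g₁ rF e₁∉) (one-of g₃ rF e₁∉)))

    covers : ∀ {R X Y W F} → Generator R X → Generator R Y → Generator R W → X ⊆ F ⊎ Y ⊆ F ⊎ W ⊆ F → Cover R F
    covers gX gY gW (inj₁ X⊆)        = cover-⊆ X⊆ (proj₂ gX)
    covers gX gY gW (inj₂ (inj₁ Y⊆)) = cover-⊆ Y⊆ (proj₂ gY)
    covers gX gY gW (inj₂ (inj₂ W⊆)) = cover-⊆ W⊆ (proj₂ gW)

    form₃ : Form₃ P Q
    form₃ = record
      { e₁ = e₁ ; e₂ = e₂ ; e₃ = e₃ ; e₄ = e₄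
      ; c₁₂ = proj₁ J₁₂ ; c₃₄ = proj₁ J₃₄ ; c₁₃ = proj₁ K₁₃ ; c₂₄ = proj₁ K₂₄ ; c₁₄ = proj₁ J₁₄
      ; P≗ = (λ pF → Maximal.cliqueˡ max pF , contains K₁₃ K₂₄ K₁₄ pF) ,
             (λ (cF , h) → closed max cF (covers J₁₂ J₃₄ J₁₄ h))
      ; Q≗ = (λ qG → Maximal.cliqueʳ max qG , contains J₁₂ J₃₄ J₁₄ qG) ,
             (λ (cG , h) → closed (maximal-sym max) cG (covers K₁₃ K₂₄ K₁₄ h)) }

  trichotomy : ∀ {P Q} {P? : Decidable P} {Q? : Decidable Q} → Maximal P? Q? →
    ((2 + t ≤ 1 + q × (2 ≤ t → q ≢ 1 + t)) × Form₁ P Q) ⊎ (1 + q ≤ 2 + t × Form₂ P Q) ⊎ (N ≤ 3 × Form₃ P Q)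
  trichotomy max = decide (Structure.structure max)
    where
    decide : _ → _
    decide (inj₁ (le , st))        = inj₁ ((le , FromSunflower.not-balanced max le st) , FromSunflower.form₁ max le st)
    decide (inj₂ (inj₁ (le , st))) = inj₂ (inj₁ (le , FromSimplex.form₂ max st))
    decide (inj₂ (inj₂ (le , st))) = inj₂ (inj₂ (le , FromSquare.form₃ max st))

-- Partitions as a clique system

index : ∀ {n} → Subset n → Fin (pow2 n)
index []                  = zero
index {suc n} (false ∷ X) = index X ↑ˡ pow2 n
index {suc n} (true ∷ X)  = pow2 n ↑ʳ index X

blk-index : ∀ {n} (X : Subset n) → blk (index X) ≡ X
blk-index []                  = refl
blk-index {suc n} (false ∷ X) = trans (lookup-++ˡ (Vec.map (false ∷_) (allSubsets n)) _ (index X))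
  (trans (lookup-map (index X) (false ∷_) (allSubsets n)) (cong (false ∷_) (blk-index X)))
blk-index {suc n} (true ∷ X)  = trans (lookup-++ʳ (Vec.map (false ∷_) (allSubsets n)) _ (index X))
  (trans (lookup-map (index X) (true ∷_) (allSubsets n)) (cong (true ∷_) (blk-index X)))

index-blk : ∀ {n} (j : Fin (pow2 n)) → index (blk {n} j) ≡ j
index-blk {zero}  zero = refl
index-blk {suc n} j with Fin.splitAt (pow2 n) j in eq
... | inj₁ i = begin
    index (blk {suc n} j) ≡⟨ cong (λ x → index (blk {suc n} x)) (Fin.splitAt⁻¹-↑ˡ eq) ⟨
    index (blk {suc n} (i ↑ˡ pow2 n)) ≡⟨ cong index (trans (lookup-++ˡ (Vec.map (false ∷_) (allSubsets n)) _ i) (lookup-map i (false ∷_) (allSubsets n))) ⟩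
    index (blk {n} i) ↑ˡ pow2 n ≡⟨ cong (_↑ˡ pow2 n) (index-blk {n} i) ⟩
    i ↑ˡ pow2 n ≡⟨ Fin.splitAt⁻¹-↑ˡ eq ⟩
    j ∎
  where open ≡-Reasoning
... | inj₂ i = begin
    index (blk {suc n} j) ≡⟨ cong (λ x → index (blk {suc n} x)) (Fin.splitAt⁻¹-↑ʳ eq) ⟨
    index (blk {suc n} (pow2 n ↑ʳ i)) ≡⟨ cong index (trans (lookup-++ʳ (Vec.map (false ∷_) (allSubsets n)) _ i) (lookup-map i (true ∷_) (allSubsets n))) ⟩
    pow2 n ↑ʳ index (blk {n} i) ≡⟨ cong (pow2 n ↑ʳ_) (index-blk {n} i) ⟩
    pow2 n ↑ʳ i ≡⟨ Fin.splitAt⁻¹-↑ʳ eq ⟩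
    j ∎
  where open ≡-Reasoning

count-blk : ∀ {n} {P : Subset n → Set} (P? : Decidable P) → count (λ j → P? (blk {n} j)) ≡ count P?
count-blk {n} {P} P? = ≤-antisym
  (≤-trans (union-bound (λ j → P? (blk {n} j)) P? (λ j X → blk {n} j ≟ˢ X) 1 (λ j p → blk {n} j , p , refl)
     (λ X _ → count-≤1 (λ j → P? (blk {n} j) ×-dec (blk {n} j ≟ˢ X)) (λ (_ , e) (_ , e′) → blk-injective (trans e (sym e′)))))
   (≤-reflexive (*-identityʳ _)))
  (≤-trans (union-bound P? (λ j → P? (blk {n} j)) (λ X j → blk {n} j ≟ˢ X) 1
     (λ X p → index X , subst P (sym (blk-index X)) p , blk-index X)
     (λ j _ → count-≤1 (λ X → P? X ×-dec (blk {n} j ≟ˢ X)) (λ (_ , e) (_ , e′) → trans (sym e) e′)))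
   (≤-reflexive (*-identityʳ _)))
  where
  blk-injective : ∀ {i j} → blk {n} i ≡ blk {n} j → i ≡ j
  blk-injective {i} {j} e = trans (sym (index-blk {n} i)) (trans (cong index e) (index-blk {n} j))

-- The subsets avoiding p are the subsets of U - p; Pascal's rule gives the others by cancellation.
count-through-point : ∀ {n} (U : Subset n) {p} → p ∈ U → ∀ c′ {s} → ∣ U ∣ ≡ suc s →
  count (λ X → ⊆₌? U (suc c′) X ×-dec (p ∈? X)) ≡ binom s c′
count-through-point U {p} p∈ c′ {s} sU = +-cancelʳ-≡ (binom s (suc c′)) _ _ (begin
    count through? + binom s (suc c′) ≡⟨ cong (count through? +_) avoid ⟨
    count through? + count (λ X → ⊆₌? U (suc c′) X ×-dec ¬? (p ∈? X))
                                                      ≡⟨ count-split (⊆₌? U (suc c′)) (p ∈?_) ⟨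
    count (⊆₌? U (suc c′)) ≡⟨ trans (count-choose U (suc c′)) (cong (λ x → binom x (suc c′)) sU) ⟩
    binom s c′ + binom s (suc c′) ∎)
  where
  open ≡-Reasoning
  through? : Decidable (λ X → (X ⊆ U × ∣ X ∣ ≡ suc c′) × p ∈ X)
  through? X = ⊆₌? U (suc c′) X ×-dec (p ∈? X)
  avoid : count (λ X → ⊆₌? U (suc c′) X ×-dec ¬? (p ∈? X)) ≡ binom s (suc c′)
  avoid = trans (count-cong (λ X → ⊆₌? U (suc c′) X ×-dec ¬? (p ∈? X)) (⊆₌? (U - p) (suc c′))
      (λ X ((X⊆U , sX) , p∉X) → (λ x∈ → x∈p∧x≢y⇒x∈p-y (X⊆U x∈) (λ { refl → p∉X x∈ })) , sX)
      (λ X (X⊆ , sX) → ((λ x∈ → proj₁ (∈-remove⁻ U p (X⊆ x∈))) , sX) , λ p∈X → proj₂ (∈-remove⁻ U p (X⊆ p∈X)) refl))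
    (trans (count-choose (U - p) (suc c′)) (cong (λ x → binom x (suc c′)) (suc-injective (trans (∣remove∣ p∈) sU))))

module Partitions (c′ k : ℕ) where

  c : ℕ
  c = suc c′

  b : ℕ
  b = pow2 (c * k)

  Valid : Fin b → Set
  Valid j = ∣ blk {c * k} j ∣ ≡ c

  Compatible : Fin b → Fin b → Set
  Compatible i j = Empty (blk {c * k} i ∩ blk {c * k} j)

  IsClique : Subset b → Set
  IsClique A = (∀ j → j ∈ A → Valid j) × (∀ i j → i ∈ A → j ∈ A → i ≢ j → Compatible i j)

  r u : ℕ → ℕ
  r i = binom (c * i ∸ 1) c′
  u zero    = 1
  u (suc i) = r (suc i) * u i

  compatible-sym : ∀ {i j} → Compatible i j → Compatible j i
  compatible-sym {i} {j} e (x , x∈) = let (x∈j , x∈i) = x∈p∩q⁻ (blk {c * k} j) (blk {c * k} i) x∈ in e (x , x∈p∩q⁺ (x∈i , x∈j))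

  same-block : ∀ {A i j p} → IsClique A → i ∈ A → j ∈ A → p ∈ blk {c * k} i → p ∈ blk {c * k} j → i ≡ j
  same-block {A} {i} {j} {p} (_ , disj) i∈ j∈ p∈i p∈j = decidable-stable (i Fin.≟ j) (λ i≢j → disj i j i∈ j∈ i≢j (p , x∈p∩q⁺ (p∈i , p∈j)))

  covered? : ∀ A → Decidable (λ p → ∃ λ j → j ∈ A × p ∈ blk {c * k} j)
  covered? A p = Fin.any? (λ j → (j ∈? A) ×-dec (p ∈? blk {c * k} j))

  covered : Subset b → Subset (c * k)
  covered A = comprehension (covered? A)

  ∣covered∣ : ∀ {A} → IsClique A → ∣ covered A ∣ ≡ c * ∣ A ∣
  ∣covered∣ {A} cl@(valid , _) = ≤-antisym
      (begin
        ∣ covered A ∣ ≡⟨ trans (*-identityˡ _) (count-∈ (covered A)) ⟨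
        1 * count (_∈? covered A) ≤⟨ double-count (_∈? covered A) (_∈? A) (λ p j → p ∈? blk {c * k} j) 1 c
                                             (λ p p∈ → count-≥1 (λ j → (j ∈? A) ×-dec (p ∈? blk {c * k} j)) (∈-comprehension⁻ (covered? A) p∈))
                                             (λ j j∈ → ≤-trans (count-mono (λ p → (p ∈? covered A) ×-dec (p ∈? blk {c * k} j)) (_∈? blk {c * k} j) (λ _ → proj₂))
                                                               (≤-reflexive (trans (count-∈ (blk {c * k} j)) (valid j j∈)))) ⟩
        c * count (_∈? A) ≡⟨ cong (c *_) (count-∈ A) ⟩
        c * ∣ A ∣ ∎)
      (begin
        c * ∣ A ∣ ≡⟨ cong (c *_) (count-∈ A) ⟨
        c * count (_∈? A) ≤⟨ double-count (_∈? A) (_∈? covered A) (λ j p → p ∈? blk {c * k} j) c 1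
                                             (λ j j∈ → ≤-trans (≤-reflexive (sym (trans (count-∈ (blk {c * k} j)) (valid j j∈))))
                                               (count-mono (_∈? blk {c * k} j) (λ p → (p ∈? covered A) ×-dec (p ∈? blk {c * k} j))
                                                 (λ p p∈ → ∈-comprehension⁺ (covered? A) (j , j∈ , p∈) , p∈)))
                                             (λ p _ → count-≤1 (λ j → (j ∈? A) ×-dec (p ∈? blk {c * k} j))
                                               (λ (i∈ , p∈i) (j∈ , p∈j) → same-block cl i∈ j∈ p∈i p∈j)) ⟩
        1 * count (_∈? covered A) ≡⟨ trans (*-identityˡ _) (count-∈ (covered A)) ⟩
        ∣ covered A ∣ ∎)
    where open ≤-Reasoning

  Containing : Subset b → Subset b → Set
  Containing A F = ((∀ j → j ∈ F → Valid j) × (∀ i j → i ∈ F → j ∈ F → i ≢ j → Compatible i j) × ∣ F ∣ ≡ k) × A ⊆ F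

  containing? : ∀ A → Decidable (Containing A)
  containing? A F =
    (Fin.all? (λ j → (j ∈? F) →-dec (∣ blk {c * k} j ∣ ≟ c)) ×-dec
     (Fin.all? (λ i → Fin.all? (λ j → (i ∈? F) →-dec ((j ∈? F) →-dec (¬? (i Fin.≟ j) →-dec
       ¬? (nonempty? (blk {c * k} i ∩ blk {c * k} j)))))) ×-dec (∣ F ∣ ≟ k))) ×-dec (A ⊆? F)

  -- Every partition extending A has exactly one block through a fixed uncovered point p.
  extensions : ∀ i A → IsClique A → i + ∣ A ∣ ≡ k → count (containing? A) ≡ u i
  extensions zero A cl e = ≤-antisym
    (count-≤1 (containing? A) (λ ((_ , _ , sF) , A⊆F) ((_ , _ , sG) , A⊆G) →
      trans (sym (⊆∧≥⇒≡ A _ A⊆F (≤-reflexive (trans sF (sym e))))) (⊆∧≥⇒≡ A _ A⊆G (≤-reflexive (trans sG (sym e))))))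
    (count-≥1 (containing? A) (A , (proj₁ cl , proj₂ cl , e) , λ x∈ → x∈))
  extensions (suc i) A cl e = trans (≤-antisym upper lower) (cong (_* u i) new-count)
    where
    open ≤-Reasoning
    bl : Fin b → Subset (c * k)
    bl = blk {c * k}
    ∣A∣<k : ∣ A ∣ < k
    ∣A∣<k = ≤-trans (s≤s (m≤n+m ∣ A ∣ i)) (≤-reflexive e)
    free : ∃ λ p → p ∈ full × p ∉ covered A
    free = ∣∣<⇒∃ (covered A) full (≤-trans (s≤s (≤-reflexive (∣covered∣ cl)))
      (≤-trans (*-monoʳ-< c ∣A∣<k) (≤-reflexive (sym (∣⊤∣≡n (c * k))))))
    p : Fin (c * k)
    p = proj₁ free
    p∉ : p ∉ covered A
    p∉ = proj₂ (proj₂ free)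
    U : Subset (c * k)
    U = ∁ (covered A)
    p∈U : p ∈ U
    p∈U = x∉p⇒x∈∁p p∉
    ∣U∣ : ∣ U ∣ ≡ c * suc i
    ∣U∣ = begin-equality
      ∣ U ∣ ≡⟨ ∣∁p∣≡n∸∣p∣ (covered A) ⟩
      c * k ∸ ∣ covered A ∣ ≡⟨ cong₂ _∸_ (cong (c *_) (sym e)) (∣covered∣ cl) ⟩
      c * (suc i + ∣ A ∣) ∸ c * ∣ A ∣ ≡⟨ *-distribˡ-∸ c (suc i + ∣ A ∣) ∣ A ∣ ⟨
      c * (suc i + ∣ A ∣ ∸ ∣ A ∣) ≡⟨ cong (c *_) (m+n∸n≡m (suc i) ∣ A ∣) ⟩
      c * suc i ∎
    New : Subset (c * k) → Set
    New X = (X ⊆ U × ∣ X ∣ ≡ c) × p ∈ X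
    new? : Decidable New
    new? X = ⊆₌? U c X ×-dec (p ∈? X)
    newBlock? : Decidable (λ j → New (bl j))
    newBlock? j = new? (bl j)
    new-count : count newBlock? ≡ r (suc i)
    new-count = trans (count-blk new?) (count-through-point U p∈U c′ ∣U∣)
    not-in-A : ∀ {j} → New (bl j) → j ∉ A
    not-in-A {j} (_ , p∈) j∈ = p∉ (∈-comprehension⁺ (covered? A) (j , j∈ , p∈))
    clique⁺ : ∀ {j} → New (bl j) → IsClique (A ⊕ j)
    clique⁺ {j} ((X⊆U , sX) , _) =
      (λ x x∈ → [ proj₁ cl x , (λ { refl → sX }) ]′ (∈-⊕⁻ A j x∈)) ,
      (λ x y x∈ y∈ x≢y → pairwise (∈-⊕⁻ A j x∈) (∈-⊕⁻ A j y∈) x≢y)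
      where
      new-old : ∀ {x} → x ∈ A → Compatible j x
      new-old {x} x∈ (z , z∈) = let (z∈j , z∈x) = x∈p∩q⁻ (bl j) (bl x) z∈ in
        x∈∁p⇒x∉p (X⊆U z∈j) (∈-comprehension⁺ (covered? A) (x , x∈ , z∈x))
      pairwise : ∀ {x y} → x ∈ A ⊎ x ≡ j → y ∈ A ⊎ y ≡ j → x ≢ y → Compatible x y
      pairwise (inj₁ x∈)   (inj₁ y∈)   x≢y = proj₂ cl _ _ x∈ y∈ x≢y
      pairwise (inj₁ x∈)   (inj₂ refl) x≢y = compatible-sym (new-old x∈)
      pairwise (inj₂ refl) (inj₁ y∈)   x≢y = new-old y∈
      pairwise (inj₂ refl) (inj₂ refl) x≢y = contradiction refl x≢y
    per-block : ∀ j → New (bl j) → count (λ F → containing? A F ×-dec (j ∈? F)) ≡ u i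
    per-block j new = trans
      (count-cong (λ F → containing? A F ×-dec (j ∈? F)) (containing? (A ⊕ j))
        (λ F ((cF , A⊆F) , j∈F) → cF , ⊕-⊆ A⊆F j∈F)
        (λ F (cF , A⊆F) → (cF , λ x∈ → A⊆F (A⊆A⊕x A j x∈)) , A⊆F (x∈A⊕x A j)))
      (extensions i (A ⊕ j) (clique⁺ new) (trans (cong (i +_) (∣⊕∣ (not-in-A new))) (trans (+-suc i ∣ A ∣) e)))
    block-through-p : ∀ F → Containing A F → ∃ λ j → New (bl j) × j ∈ F
    block-through-p F ((vF , dF , sF) , A⊆F) =
      let full⊆ : full ⊆ covered F
          full⊆ = ⊆∧≥⇒⊇ (covered F) full ⊆⊤ (≤-trans (≤-reflexive (∣⊤∣≡n (c * k)))
                    (≤-reflexive (sym (trans (∣covered∣ (vF , dF)) (cong (c *_) sF)))))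
          j , j∈F , p∈j = ∈-comprehension⁻ (covered? F) (full⊆ ∈⊤)
      in j , (((λ {x} x∈j → x∉p⇒x∈∁p (λ x∈cov →
            let a , a∈A , x∈a = ∈-comprehension⁻ (covered? A) x∈cov
                a≡j = same-block (vF , dF) (A⊆F a∈A) j∈F x∈a x∈j
            in p∉ (∈-comprehension⁺ (covered? A) (j , subst (_∈ A) a≡j a∈A , p∈j)))) , vF j j∈F) , p∈j) , j∈F
    upper : count (containing? A) ≤ count newBlock? * u i
    upper = union-bound (containing? A) newBlock? (λ F j → j ∈? F) (u i) block-through-p (λ j new → ≤-reflexive (per-block j new))
    lower : count newBlock? * u i ≤ count (containing? A)
    lower = begin
      count newBlock? * u i ≡⟨ *-comm (count newBlock?) (u i) ⟩
      u i * count newBlock? ≤⟨ double-count newBlock? (containing? A) (λ j F → j ∈? F) (u i) 1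
                                     (λ j new → ≤-reflexive (sym (per-block j new)))
                                     (λ F ((vF , dF , _) , _) → count-≤1 (λ j → newBlock? j ×-dec (j ∈? F))
                                       (λ ((_ , p∈i) , i∈F) ((_ , p∈j) , j∈F) → same-block (vF , dF) i∈F j∈F p∈i p∈j)) ⟩
      1 * count (containing? A) ≡⟨ *-identityˡ _ ⟩
      count (containing? A) ∎

  r-mono : ∀ {i j} → i ≤ j → r i ≤ r j
  r-mono i≤j = binom-mono c′ (∸-monoˡ-≤ 1 (*-monoʳ-≤ c i≤j))

  r-one : r 1 ≡ 1
  r-one = trans (cong (λ x → binom x c′) (cong (_∸ 1) (*-identityʳ c))) (binom-n-n c′)

  system : CliqueSystem b k
  system = record
    { Valid = Valid ; valid? = λ j → ∣ blk {c * k} j ∣ ≟ c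
    ; Compatible = Compatible ; compatible? = λ i j → ¬? (nonempty? (blk {c * k} i ∩ blk {c * k} j))
    ; compatible-sym = λ {i} {j} → compatible-sym {i} {j}
    ; u = u ; r = r ; u-zero = refl ; u-suc = λ _ → refl ; r-one = r-one
    ; r-pos = λ i → ≤-trans (≤-reflexive (sym r-one)) (r-mono {1} {suc i} (s≤s z≤n))
    ; extensions = λ i A cl e → trans (count-cong _ (containing? A) (λ _ h → h) (λ _ h → h)) (extensions i A cl e)
    }

-- Lower bounds for r and the numerical conditions

-- 1716 = C(13, 6)
central-binom : ∀ d → 1716 * 3 ^ d ≤ binom (suc ((6 + d) * 2)) (6 + d)
central-binom zero    = ≤-reflexive refl
central-binom (suc d) = begin
    1716 * (3 * 3 ^ d) ≡⟨ swap 1716 3 (3 ^ d) ⟩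
    3 * (1716 * 3 ^ d) ≤⟨ *-monoʳ-≤ 3 (central-binom d) ⟩
    3 * binom (suc (m * 2)) m ≤⟨ triple m ⟩
    binom (3 + m * 2) (suc m) ∎
  where
  open ≤-Reasoning
  m = 6 + d
  swap : ∀ a b c → a * (b * c) ≡ b * (a * c)
  swap = solve-∀
  -- Two applications of Pascal's rule and the symmetry of row 2m + 1 give the factor 3. It must
  -- exceed 8^(1/2), because t⁴ ≤ 2^d is to be turned into t⁶ ≤ 3^d.
  triple : ∀ m → 3 * binom (suc (m * 2)) m ≤ binom (3 + m * 2) (suc m)
  triple m = begin
    3 * Y ≡⟨ split Y ⟩
    Y + (Y + Y) ≤⟨ +-mono-≤ (binom-mono m (n≤1+n X)) (≤-reflexive (cong (Y +_) (sym symmetric))) ⟩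
    binom (suc X) m + (Y + binom X (suc m)) ∎
    where
    X = suc (m * 2)
    Y = binom X m
    split : ∀ Y → 3 * Y ≡ Y + (Y + Y)
    split = solve-∀
    X≡ : suc m + m ≡ X
    X≡ = double m
      where
      double : ∀ m → suc m + m ≡ suc (m * 2)
      double = solve-∀
    symmetric : binom X (suc m) ≡ Y
    symmetric = *-cancelˡ-≡ (binom X (suc m)) Y (suc m)
      (subst (λ x → suc m * binom x (suc m) ≡ suc m * binom x m) X≡ (binom-next (suc m) m))

-- After squaring: t¹² ≤ 8^d ≤ 9^d.
sixth-power : ∀ t d → t ^ 4 ≤ 2 ^ d → t * t * t * (t * t * t) ≤ 3 ^ d
sixth-power t d le = ≮⇒≥ (λ lt → <⇒≱ (*-mono-< lt lt) (begin
    t⁶ * t⁶ ≡⟨ e t ⟩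
    t ^ 4 * t ^ 4 * t ^ 4 ≤⟨ *-mono-≤ (*-mono-≤ le le) le ⟩
    2 ^ d * 2 ^ d * 2 ^ d ≤⟨ powers d ⟩
    3 ^ d * 3 ^ d ∎))
  where
  open ≤-Reasoning
  t⁶ = t * t * t * (t * t * t)
  e : ∀ t → t * t * t * (t * t * t) * (t * t * t * (t * t * t)) ≡ t * (t * (t * (t * 1))) * (t * (t * (t * (t * 1)))) * (t * (t * (t * (t * 1))))
  e = solve-∀
  powers : ∀ d → 2 ^ d * 2 ^ d * 2 ^ d ≤ 3 ^ d * 3 ^ d
  powers zero    = ≤-refl
  powers (suc d) = begin
    2 * 2 ^ d * (2 * 2 ^ d) * (2 * 2 ^ d) ≡⟨ e₁ (2 ^ d) ⟩
    8 * (2 ^ d * 2 ^ d * 2 ^ d) ≤⟨ *-mono-≤ (n≤1+n 8) (powers d) ⟩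
    9 * (3 ^ d * 3 ^ d) ≡⟨ e₂ (3 ^ d) ⟩
    3 * 3 ^ d * (3 * 3 ^ d) ∎
    where
    e₁ : ∀ x → 2 * x * (2 * x) * (2 * x) ≡ 8 * (x * x * x)
    e₁ = solve-∀
    e₂ : ∀ x → 9 * (x * x) ≡ 3 * x * (3 * x)
    e₂ = solve-∀

fifth : ℕ → ℕ
fifth m = m * m * m * m * m

-- With m = p + 2 the five factors 6m - 1, ..., 6m - 5 are at least 5m, 5m, 4m, 4m, 3m, all valid
-- from m = 2 on; and 5 · 5 · 4 · 4 · 3 = 1200 = 120 · 10.
binom-five : ∀ p → 10 * fifth (2 + p) ≤ binom (11 + 6 * p) 5
binom-five p = *-cancelˡ-≤ 120 (begin
    120 * (10 * fifth m) ≡⟨ e₁ m ⟩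
    5 * m * (5 * m * (4 * m * (4 * m * (3 * m)))) ≤⟨
      *-mono-≤ (factor 5 1 (m≤m+n 10 1)) (*-mono-≤ (factor 5 1 ≤-refl) (*-mono-≤ (factor 4 2 (m≤m+n 8 1)) (*-mono-≤ (factor 4 2 ≤-refl) (factor 3 3 (m≤m+n 6 1))))) ⟩
    (11 + 6 * p) * ((10 + 6 * p) * ((9 + 6 * p) * ((8 + 6 * p) * (7 + 6 * p)))) ≡⟨ falling ⟨
    120 * binom (11 + 6 * p) 5 ∎)
  where
  open ≤-Reasoning
  m = 2 + p
  e₁ : ∀ m → 120 * (10 * (m * m * m * m * m)) ≡ 5 * m * (5 * m * (4 * m * (4 * m * (3 * m))))
  e₁ = solve-∀
  factor : ∀ a s {f} → a * 2 ≤ f → ⦃ a + s ≡ 6 ⦄ → a * m ≤ f + 6 * p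
  factor a s {f} le ⦃ e ⦄ = begin
    a * (2 + p) ≡⟨ *-distribˡ-+ a 2 p ⟩
    a * 2 + a * p ≤⟨ +-mono-≤ le (*-monoˡ-≤ p (≤-trans (m≤m+n a s) (≤-reflexive e))) ⟩
    f + 6 * p ∎
  falling : 120 * binom (11 + 6 * p) 5 ≡ (11 + 6 * p) * ((10 + 6 * p) * ((9 + 6 * p) * ((8 + 6 * p) * (7 + 6 * p))))
  falling = begin-equality
    120 * binom (5 + x) 5 ≡⟨ g₁ (binom (5 + x) 5) ⟩
    24 * (5 * binom (5 + x) 5) ≡⟨ cong (24 *_) (binom-absorb (4 + x) 4) ⟩
    24 * ((5 + x) * binom (4 + x) 4) ≡⟨ g₂ (5 + x) (binom (4 + x) 4) ⟩
    (5 + x) * (6 * (4 * binom (4 + x) 4)) ≡⟨ cong (λ z → (5 + x) * (6 * z)) (binom-absorb (3 + x) 3) ⟩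
    (5 + x) * (6 * ((4 + x) * binom (3 + x) 3)) ≡⟨ g₃ (5 + x) (4 + x) (binom (3 + x) 3) ⟩
    (5 + x) * ((4 + x) * (2 * (3 * binom (3 + x) 3))) ≡⟨ cong (λ z → (5 + x) * ((4 + x) * (2 * z))) (binom-absorb (2 + x) 2) ⟩
    (5 + x) * ((4 + x) * (2 * ((3 + x) * binom (2 + x) 2))) ≡⟨ g₄ (5 + x) (4 + x) (3 + x) (binom (2 + x) 2) ⟩
    (5 + x) * ((4 + x) * ((3 + x) * (2 * binom (2 + x) 2))) ≡⟨ cong (λ z → (5 + x) * ((4 + x) * ((3 + x) * z))) (binom-absorb (1 + x) 1) ⟩
    (5 + x) * ((4 + x) * ((3 + x) * ((2 + x) * binom (1 + x) 1))) ≡⟨ cong (λ z → (5 + x) * ((4 + x) * ((3 + x) * ((2 + x) * z)))) (trans (sym (*-identityˡ _)) (trans (binom-absorb x 0) (*-identityʳ (1 + x)))) ⟩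
    (5 + x) * ((4 + x) * ((3 + x) * ((2 + x) * (1 + x)))) ∎
    where
    x = 6 + 6 * p
    g₁ : ∀ a → 120 * a ≡ 24 * (5 * a)
    g₁ = solve-∀
    g₂ : ∀ a b → 24 * (a * b) ≡ a * (6 * (4 * b))
    g₂ = solve-∀
    g₃ : ∀ a b c → a * (6 * (b * c)) ≡ a * (b * (2 * (3 * c)))
    g₃ = solve-∀
    g₄ : ∀ a b c d → a * (b * (2 * (c * d))) ≡ a * (b * (c * (2 * d)))
    g₄ = solve-∀

module BlockNumerics (c′ k : ℕ) (5≤c′ : 5 ≤ c′) where
  open Partitions c′ k

  -- A larger block size raises the lower entry of the binomial by one and the upper entry by at
  -- least one, so c = 6 is the smallest case.
  r≥fifth : ∀ m → 2 ≤ m → 10 * fifth m ≤ r m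
  r≥fifth (suc (suc p)) (s≤s (s≤s z≤n)) = begin
      10 * fifth (2 + p) ≤⟨ binom-five p ⟩
      binom (11 + 6 * p) 5 ≡⟨ cong (λ x → binom x 5) (eq p) ⟩
      binom (6 * m ∸ 1) 5 ≤⟨ more-points (c′ ∸ 5) ⟩
      binom (suc (c′ ∸ 5 + 5) * m ∸ 1) (c′ ∸ 5 + 5) ≡⟨ cong (λ x → binom (suc x * m ∸ 1) x) (m∸n+n≡m 5≤c′) ⟩
      r m ∎
    where
    open ≤-Reasoning
    m = 2 + p
    eq : ∀ p → 11 + 6 * p ≡ 1 + p + 5 * (2 + p)
    eq = solve-∀
    more-points : ∀ e → binom (6 * m ∸ 1) 5 ≤ binom (suc (e + 5) * m ∸ 1) (e + 5)
    more-points zero    = ≤-refl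
    more-points (suc e) = begin
      binom (6 * m ∸ 1) 5 ≤⟨ more-points e ⟩
      binom x (e + 5) ≤⟨ m≤m+n _ _ ⟩
      binom (suc x) (suc e + 5) ≤⟨ binom-mono (suc e + 5) (m≤n+m (suc x) (1 + p)) ⟩
      binom (1 + p + suc x) (suc e + 5) ∎
      where x = suc (e + 5) * m ∸ 1

  r-pos : ∀ i → 1 ≤ r (suc i)
  r-pos i = ≤-trans (≤-reflexive (sym r-one)) (r-mono {1} {suc i} (s≤s z≤n))

  u-pos : ∀ i → 1 ≤ u i
  u-pos zero    = ≤-refl
  u-pos (suc i) = *-mono-≤ (r-pos i) (u-pos i)

  u-mono : ∀ {i j} → i ≤ j → u i ≤ u j
  u-mono {i} {j} i≤j = subst (λ x → u i ≤ u x) (m∸n+n≡m i≤j) (go (j ∸ i))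
    where
    go : ∀ d → u i ≤ u (d + i)
    go zero    = ≤-refl
    go (suc d) = ≤-trans (go d) (≤-trans (≤-reflexive (sym (*-identityˡ _))) (*-monoˡ-≤ (u (d + i)) (r-pos (d + i))))

  r≥3 : ∀ m → 2 ≤ m → 3 ≤ r m
  r≥3 m 2≤m = ≤-trans (m≤m+n 3 7) (≤-trans (*-monoʳ-≤ 10 (*-mono-≤ (*-mono-≤ (*-mono-≤ (*-mono-≤ 1≤m 1≤m) 1≤m) 1≤m) 1≤m)) (r≥fifth m 2≤m))
    where
    1≤m : 1 ≤ m
    1≤m = ≤-trans (s≤s z≤n) 2≤m

  second-order : ∀ t → 2 ≤ t → u t + u 2 < u (1 + t)
  second-order t 2≤t = begin-strict
      u t + u 2 ≤⟨ +-monoʳ-≤ (u t) (u-mono 2≤t) ⟩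
      u t + u t <⟨ m<m+n (u t + u t) (u-pos t) ⟩
      u t + u t + u t ≡⟨ e (u t) ⟩
      3 * u t ≤⟨ *-monoˡ-≤ (u t) (r≥3 (1 + t) (m≤n⇒m≤1+n 2≤t)) ⟩
      r (1 + t) * u t ∎
    where
    open ≤-Reasoning
    e : ∀ x → x + x + x ≡ 3 * x
    e = solve-∀

six-binom : ∀ t → 6 * binom (3 + t) t ≡ (3 + t) * ((2 + t) * (1 + t))
six-binom t = begin
    6 * binom (3 + t) t ≡⟨ e₁ (binom (3 + t) t) ⟩
    2 * (3 * binom (3 + t) t) ≡⟨ cong (2 *_) (binom-up 2 t) ⟩
    2 * ((3 + t) * binom (2 + t) t) ≡⟨ e₂ (3 + t) (binom (2 + t) t) ⟩
    (3 + t) * (2 * binom (2 + t) t) ≡⟨ cong ((3 + t) *_) (trans (binom-up 1 t) (cong ((2 + t) *_) (binom-[1+n]-n t))) ⟩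
    (3 + t) * ((2 + t) * (1 + t)) ∎
  where
  open ≡-Reasoning
  e₁ : ∀ x → 6 * x ≡ 2 * (3 * x)
  e₁ = solve-∀
  e₂ : ∀ a x → 2 * (a * x) ≡ a * (2 * x)
  e₂ = solve-∀

-- The case k ≥ 2t + 3, i.e. q > t: here r(m) grows like m⁵.
module ManyBlocks (c′ t q : ℕ) (5≤c′ : 5 ≤ c′) (1≤t : 1 ≤ t) (t<q : t < q) where
  open Partitions c′ (2 + (t + q)) using (r; u; system)
  open BlockNumerics c′ (2 + (t + q)) 5≤c′
  open ≤-Reasoning

  k : ℕ
  k = 2 + (t + q)

  2≤1+q : 2 ≤ 1 + q
  2≤1+q = s≤s (≤-trans 1≤t (<⇒≤ t<q))

  k≤ : k ≤ 1 + (q + q)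
  k≤ = s≤s (+-monoˡ-≤ q t<q)

  N≡ : (2 + t) ⊔ (1 + q) ≡ 1 + q
  N≡ = m≤n⇒m⊔n≡n (s≤s t<q)

  main-term : (1 + t) * k ^ 2 * (((2 + t) ⊔ (1 + q)) * ((2 + t) ⊔ (1 + q) + 2)) < r (1 + q)
  main-term = begin-strict
      (1 + t) * k ^ 2 * (((2 + t) ⊔ (1 + q)) * ((2 + t) ⊔ (1 + q) + 2)) ≡⟨ cong (λ x → (1 + t) * k ^ 2 * (x * (x + 2))) N≡ ⟩
      (1 + t) * k ^ 2 * ((1 + q) * (1 + q + 2)) ≤⟨ *-monoˡ-≤ ((1 + q) * (1 + q + 2)) (*-mono-≤ t<q (*-mono-≤ k≤ (*-monoˡ-≤ 1 k≤))) ⟩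
      q * (1 + (q + q)) ^ 2 * ((1 + q) * (1 + q + 2)) <⟨ s≤s (m≤m+n _ _) ⟩
      suc (q * (1 + (q + q)) ^ 2 * ((1 + q) * (1 + q + 2)) + rest q) ≡⟨ expand q ⟩
      10 * fifth (1 + q) ≤⟨ r≥fifth (1 + q) 2≤1+q ⟩
      r (1 + q) ∎
    where
    -- The gap between the two sides less one, expanded in q. Its coefficients being natural numbers
    -- is what proves the strict inequality.
    rest : ℕ → ℕ
    rest q = 9 + q * 47 + q * q * 84 + q * q * q * 71 + q * q * q * q * 30 + q * q * q * q * q * 6
    expand : ∀ q → suc (q * ((1 + (q + q)) * ((1 + (q + q)) * 1)) * ((1 + q) * (1 + q + 2)) +
        (9 + q * 47 + q * q * 84 + q * q * q * 71 + q * q * q * q * 30 + q * q * q * q * q * 6)) ≡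
        10 * ((1 + q) * (1 + q) * (1 + q) * (1 + q) * (1 + q))
    expand = solve-∀

  lower-order : (1 + t) * k * (binom (3 + t) t * k ^ 2) < r (1 + q) * (((1 + t) ⊔ q) * ((1 + t) ⊔ q))
  lower-order = *-cancelˡ-< 6 _ _ (begin-strict
      6 * ((1 + t) * k * (binom (3 + t) t * k ^ 2)) ≡⟨ e₁ (1 + t) k (binom (3 + t) t) ⟩
      (1 + t) * (k * k * k) * (6 * binom (3 + t) t) ≡⟨ cong ((1 + t) * (k * k * k) *_) (six-binom t) ⟩
      (1 + t) * (k * k * k) * ((3 + t) * ((2 + t) * (1 + t))) ≤⟨ *-mono-≤ (*-mono-≤ t<q (*-mono-≤ (*-mono-≤ k≤ k≤) k≤)) (*-mono-≤ (s≤s (s≤s t<q)) (*-mono-≤ (s≤s t<q) t<q)) ⟩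
      q * (K * K * K) * ((2 + q) * ((1 + q) * q)) ≡⟨ e₂ q K ⟩
      q * q * (K * K * K * (2 + q) * (1 + q)) <⟨ *-monoʳ-< (q * q) ⦃ >-nonZero (*-mono-≤ 1≤q 1≤q) ⦄ (s≤s (m≤m+n _ (rest q))) ⟩
      q * q * suc (K * K * K * (2 + q) * (1 + q) + rest q) ≡⟨ cong (q * q *_) (expand q) ⟩
      q * q * (6 * (10 * fifth (1 + q))) ≤⟨ *-monoʳ-≤ (q * q) (*-monoʳ-≤ 6 (r≥fifth (1 + q) 2≤1+q)) ⟩
      q * q * (6 * r (1 + q)) ≡⟨ e₃ q (r (1 + q)) ⟩
      6 * (r (1 + q) * (q * q)) ≡⟨ cong (λ x → 6 * (r (1 + q) * (x * x))) (m≤n⇒m⊔n≡n t<q) ⟨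
      6 * (r (1 + q) * (((1 + t) ⊔ q) * ((1 + t) ⊔ q))) ∎)
    where
    K = 1 + (q + q)
    1≤q : 1 ≤ q
    1≤q = ≤-trans 1≤t (<⇒≤ t<q)
    rest : ℕ → ℕ
    rest q = 57 + q * 285 + q * q * 557 + q * q * q * 542 + q * q * q * q * 264 + q * q * q * q * q * 52
    e₁ : ∀ a k B → 6 * (a * k * (B * (k * (k * 1)))) ≡ a * (k * k * k) * (6 * B)
    e₁ = solve-∀
    e₂ : ∀ q K → q * (K * K * K) * ((2 + q) * ((1 + q) * q)) ≡ q * q * (K * K * K * (2 + q) * (1 + q))
    e₂ = solve-∀
    e₃ : ∀ q R → q * q * (6 * R) ≡ 6 * (R * (q * q))
    e₃ = solve-∀
    expand : ∀ q → suc ((1 + (q + q)) * (1 + (q + q)) * (1 + (q + q)) * (2 + q) * (1 + q) +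
        (57 + q * 285 + q * q * 557 + q * q * q * 542 + q * q * q * q * 264 + q * q * q * q * q * 52)) ≡
        6 * (10 * ((1 + q) * (1 + q) * (1 + q) * (1 + q) * (1 + q)))
    expand = solve-∀

  growth : ∀ m → 2 ≤ m → 2 + q ≤ m + m → k * ((4 + t) * (5 + t)) ≤ 20 * r m
  growth m 2≤m q≤ = begin
      k * ((4 + t) * (5 + t)) ≤⟨ *-mono-≤ k≤4m (*-mono-≤ 4+t≤ 5+t≤) ⟩
      4 * m * (3 * m * (3 * m)) ≡⟨ e₁ m ⟩
      36 * (m * m * m) * 1 ≤⟨ *-mono-≤ (*-monoˡ-≤ (m * m * m) (m≤m+n 36 164)) (*-mono-≤ 1≤m 1≤m) ⟩
      200 * (m * m * m) * (m * m) ≡⟨ e₂ m ⟩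
      20 * (10 * fifth m) ≤⟨ *-monoʳ-≤ 20 (r≥fifth m 2≤m) ⟩
      20 * r m ∎
    where
    e₁ : ∀ m → 4 * m * (3 * m * (3 * m)) ≡ 36 * (m * m * m) * 1
    e₁ = solve-∀
    e₂ : ∀ m → 200 * (m * m * m) * (m * m) ≡ 20 * (10 * (m * m * m * m * m))
    e₂ = solve-∀
    1≤m : 1 ≤ m
    1≤m = ≤-trans (s≤s z≤n) 2≤m
    q≤2m : q ≤ m + m
    q≤2m = ≤-trans (m≤n+m q 2) q≤
    k≤4m : k ≤ 4 * m
    k≤4m = ≤-trans k≤ (≤-trans (n≤1+n _) (≤-trans (+-mono-≤ q≤ q≤2m) (≤-reflexive (e m))))
      where
      e : ∀ m → m + m + (m + m) ≡ 4 * m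
      e = solve-∀
    3+t≤2m : 3 + t ≤ m + m
    3+t≤2m = ≤-trans (s≤s (s≤s t<q)) q≤
    5+t≤ : 5 + t ≤ 3 * m
    5+t≤ = ≤-trans (≤-reflexive (e₃ t)) (≤-trans (+-mono-≤ 3+t≤2m 2≤m) (≤-reflexive (e₄ m)))
      where
      e₃ : ∀ t → 5 + t ≡ 3 + t + 2
      e₃ = solve-∀
      e₄ : ∀ m → m + m + m ≡ 3 * m
      e₄ = solve-∀
    4+t≤ : 4 + t ≤ 3 * m
    4+t≤ = ≤-trans (n≤1+n _) 5+t≤

  large : Large t q system
  large = record { main-term = main-term ; lower-order = lower-order ; growth = growth
                 ; r₂≥3 = r≥3 2 ≤-refl ; second-order = λ { 2≤t refl → second-order t 2≤t } }

-- The case k ≤ 2t + 2, i.e. q ≤ t: here r(2) already exceeds t⁶.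
module FewBlocks (d t q : ℕ) (1≤t : 1 ≤ t) (1≤q : 1 ≤ q) (q≤t : q ≤ t) (t⁴≤ : t ^ 4 ≤ 2 ^ d) where
  open Partitions (6 + d) (2 + (t + q)) using (r; u; system; r-mono)
  open BlockNumerics (6 + d) (2 + (t + q)) (s≤s (s≤s (s≤s (s≤s (s≤s z≤n)))))
  open ≤-Reasoning

  k : ℕ
  k = 2 + (t + q)

  t³ : ℕ
  t³ = t * t * t

  1≤t³ : 1 ≤ t³
  1≤t³ = *-mono-≤ (*-mono-≤ 1≤t 1≤t) 1≤t

  -- Of the 1716 in `central-binom`, 600 is enough: `main-term` asks for 480 and `lower-order` for
  -- 768 ≤ 6 · 600.
  r≥t⁶ : ∀ m → 2 ≤ m → 600 * (t³ * t³) ≤ r m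
  r≥t⁶ m 2≤m = ≤-trans (≤-trans (*-mono-≤ (m≤m+n 600 1116) (sixth-power t d t⁴≤)) (central-binom d)) (r-mono 2≤m)

  +≤* : ∀ a → a + t ≤ suc a * t
  +≤* a = ≤-trans (≤-reflexive (+-comm a t)) (+-monoʳ-≤ t (≤-trans (≤-reflexive (sym (*-identityʳ a))) (*-monoʳ-≤ a 1≤t)))

  k≤4t : k ≤ 4 * t
  k≤4t = ≤-trans (s≤s (s≤s (+-monoʳ-≤ t q≤t))) (≤-trans (≤-reflexive (e t)) (≤-trans (+-monoˡ-≤ t (+≤* 2)) (≤-reflexive (e′ t))))
    where
    e : ∀ t → 2 + (t + t) ≡ 2 + t + t
    e = solve-∀
    e′ : ∀ t → 3 * t + t ≡ 4 * t
    e′ = solve-∀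

  N≡ : (2 + t) ⊔ (1 + q) ≡ 2 + t
  N≡ = m≥n⇒m⊔n≡m (m≤n⇒m≤1+n (s≤s q≤t))

  main-term : (1 + t) * k ^ 2 * (((2 + t) ⊔ (1 + q)) * ((2 + t) ⊔ (1 + q) + 2)) < r (1 + q)
  main-term = begin-strict
      (1 + t) * k ^ 2 * (((2 + t) ⊔ (1 + q)) * ((2 + t) ⊔ (1 + q) + 2)) ≡⟨ cong (λ x → (1 + t) * k ^ 2 * (x * (x + 2))) N≡ ⟩
      (1 + t) * k ^ 2 * ((2 + t) * (2 + t + 2)) ≤⟨ *-mono-≤ (*-mono-≤ (+≤* 1) (*-mono-≤ k≤4t (*-monoˡ-≤ 1 k≤4t))) (*-mono-≤ (+≤* 2) (≤-trans (≤-reflexive (+-comm (2 + t) 2)) (+≤* 4))) ⟩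
      2 * t * (4 * t) ^ 2 * (3 * t * (5 * t)) ≡⟨ e₁ t ⟩
      480 * (t * t * t * (t * t * 1)) ≤⟨ *-monoʳ-≤ 480 (*-monoʳ-≤ (t * t * t) (*-monoʳ-≤ (t * t) 1≤t)) ⟩
      480 * (t³ * t³) <⟨ *-monoˡ-< (t³ * t³) ⦃ >-nonZero (*-mono-≤ 1≤t³ 1≤t³) ⦄ (m≤m+n 481 119) ⟩
      600 * (t³ * t³) ≤⟨ r≥t⁶ (1 + q) (s≤s 1≤q) ⟩
      r (1 + q) ∎
    where
    e₁ : ∀ t → 2 * t * (4 * t * (4 * t * 1)) * (3 * t * (5 * t)) ≡ 480 * (t * t * t * (t * t * 1))
    e₁ = solve-∀

  lower-order : (1 + t) * k * (binom (3 + t) t * k ^ 2) < r (1 + q) * (((1 + t) ⊔ q) * ((1 + t) ⊔ q))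
  lower-order = *-cancelˡ-< 6 _ _ (begin-strict
      6 * ((1 + t) * k * (binom (3 + t) t * k ^ 2)) ≡⟨ e₁ (1 + t) k (binom (3 + t) t) ⟩
      (1 + t) * (k * k * k) * (6 * binom (3 + t) t) ≡⟨ cong ((1 + t) * (k * k * k) *_) (six-binom t) ⟩
      (1 + t) * (k * k * k) * ((3 + t) * ((2 + t) * (1 + t))) ≤⟨ *-mono-≤ (*-monoʳ-≤ (1 + t) (*-mono-≤ (*-mono-≤ k≤4t k≤4t) k≤4t)) (*-mono-≤ (+≤* 3) (*-monoˡ-≤ (1 + t) (+≤* 2))) ⟩
      (1 + t) * (4 * t * (4 * t) * (4 * t)) * (4 * t * (3 * t * (1 + t))) ≡⟨ e₂ t (1 + t) ⟩
      (1 + t) * (1 + t) * (768 * (t * t * t * (t * t * 1))) ≤⟨ *-monoʳ-≤ ((1 + t) * (1 + t)) (*-monoʳ-≤ 768 (*-monoʳ-≤ (t * t * t) (*-monoʳ-≤ (t * t) 1≤t))) ⟩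
      (1 + t) * (1 + t) * (768 * (t³ * t³)) <⟨ *-monoʳ-< ((1 + t) * (1 + t)) (*-monoˡ-< (t³ * t³) ⦃ >-nonZero (*-mono-≤ 1≤t³ 1≤t³) ⦄ (m≤m+n 769 2831)) ⟩
      (1 + t) * (1 + t) * (3600 * (t³ * t³)) ≡⟨ e₃ (1 + t) (t³ * t³) ⟩
      6 * (600 * (t³ * t³) * ((1 + t) * (1 + t))) ≤⟨ *-monoʳ-≤ 6 (*-monoˡ-≤ ((1 + t) * (1 + t)) (r≥t⁶ (1 + q) (s≤s 1≤q))) ⟩
      6 * (r (1 + q) * ((1 + t) * (1 + t))) ≡⟨ cong (λ x → 6 * (r (1 + q) * (x * x))) (m≥n⇒m⊔n≡m (m≤n⇒m≤1+n q≤t)) ⟨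
      6 * (r (1 + q) * (((1 + t) ⊔ q) * ((1 + t) ⊔ q))) ∎)
    where
    e₁ : ∀ a k B → 6 * (a * k * (B * (k * (k * 1)))) ≡ a * (k * k * k) * (6 * B)
    e₁ = solve-∀
    e₂ : ∀ t s → s * (4 * t * (4 * t) * (4 * t)) * (4 * t * (3 * t * s)) ≡ s * s * (768 * (t * t * t * (t * t * 1)))
    e₂ = solve-∀
    e₃ : ∀ s x → s * s * (3600 * x) ≡ 6 * (600 * x * (s * s))
    e₃ = solve-∀

  growth : ∀ m → 2 ≤ m → 2 + q ≤ m + m → k * ((4 + t) * (5 + t)) ≤ 20 * r m
  growth m 2≤m _ = begin
      k * ((4 + t) * (5 + t)) ≤⟨ *-mono-≤ k≤4t (*-mono-≤ (+≤* 4) (+≤* 5)) ⟩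
      4 * t * (5 * t * (6 * t)) ≡⟨ e₁ t ⟩
      20 * (6 * (t * t * t * 1)) ≤⟨ *-monoʳ-≤ 20 (*-mono-≤ (m≤m+n 6 594) (*-monoʳ-≤ (t * t * t) 1≤t³)) ⟩
      20 * (600 * (t³ * t³)) ≤⟨ *-monoʳ-≤ 20 (r≥t⁶ m 2≤m) ⟩
      20 * r m ∎
    where
    e₁ : ∀ t → 4 * t * (5 * t * (6 * t)) ≡ 20 * (6 * (t * t * t * 1))
    e₁ = solve-∀

  large : Large t q system
  large = record { main-term = main-term ; lower-order = lower-order ; growth = growth
                 ; r₂≥3 = r≥3 2 ≤-refl ; second-order = λ 2≤t _ → second-order t 2≤t }

-- Transfer between predicates on block sets and families of members

open import Defs hiding (pow2; allSubsets; blk)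

does-true⁻ : {P : Set} (d : Dec P) → does d ≡ true → P
does-true⁻ (yes p) _ = p

-- The recursion on the first coordinate mirrors `count-∷`. Proofs of an equation between Booleans
-- are unique, so the elements of the sum type are exactly the selected subsets.
Fin-count : ∀ {b} (f : Subset b → Bool) → Fin (count (λ A → f A Bool.≟ true)) ↔ Σ (Subset b) (λ A → f A ≡ true)
Fin-count {zero} f with f [] in eq
... | true  = subst (λ x → Fin x ↔ Σ (Subset 0) (λ A → f A ≡ true))
    (≤-antisym (count-≥1 (λ A → f A Bool.≟ true) ([] , eq)) (count-≤1 (λ A → f A Bool.≟ true) (λ { {[]} {[]} _ _ → refl })))
    (mk↔ₛ′ (λ _ → [] , eq) (λ _ → zero) (λ { ([] , e) → cong ([] ,_) (Decidable⇒UIP.≡-irrelevant Bool._≟_ eq e) }) (λ { zero → refl }))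
... | false = subst (λ x → Fin x ↔ Σ (Subset 0) (λ A → f A ≡ true)) (sym (count-≡0 (λ A → f A Bool.≟ true) none))
    (mk↔ₛ′ (λ ()) (λ { (A , e) → ⊥-elim (none A e) }) (λ { (A , e) → ⊥-elim (none A e) }) (λ ()))
  where
  none : ∀ A → f A ≢ true
  none [] e = case trans (sym eq) e of λ ()
Fin-count {suc b} f = subst (λ x → Fin x ↔ Σ (Subset (suc b)) (λ A → f A ≡ true)) (sym (count-∷ (λ A → f A Bool.≟ true)))
  (join ↔-∘ ((Fin-count (f ∘ (outside ∷_)) ⊎-↔ Fin-count (f ∘ (inside ∷_))) ↔-∘ Fin.+↔⊎))
  where
  to : Σ (Subset b) (λ A → f (outside ∷ A) ≡ true) ⊎ Σ (Subset b) (λ A → f (inside ∷ A) ≡ true) → Σ (Subset (suc b)) (λ A → f A ≡ true)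
  to (inj₁ (A , e)) = outside ∷ A , e
  to (inj₂ (A , e)) = inside ∷ A , e
  from : Σ (Subset (suc b)) (λ A → f A ≡ true) → Σ (Subset b) (λ A → f (outside ∷ A) ≡ true) ⊎ Σ (Subset b) (λ A → f (inside ∷ A) ≡ true)
  from (outside ∷ A , e) = inj₁ (A , e)
  from (inside ∷ A , e)  = inj₂ (A , e)
  join = mk↔ₛ′ to from (λ { (outside ∷ A , e) → refl ; (inside ∷ A , e) → refl }) (λ { (inj₁ _) → refl ; (inj₂ _) → refl })

module _ {n : ℕ} (𝓕 : Family n) where

  member? : Decidable (λ A → ⟨ A ⟩ ∈ᶠ 𝓕)
  member? A = 𝓕 ⟨ A ⟩ Bool.≟ true

  hasSize-count : HasSize 𝓕 (count member?)
  hasSize-count = mk↔ₛ′ (λ (A , e) → ⟨ A ⟩ , e) (λ (A , e) → blocks A , e) (λ _ → refl) (λ _ → refl) ↔-∘ Fin-count (λ A → 𝓕 ⟨ A ⟩)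

  hasSize-unique : ∀ {m} → HasSize 𝓕 m → m ≡ count member?
  hasSize-unique h = ↔⇒≡ (↔-sym hasSize-count ↔-∘ h)

module Translation (c′ t q : ℕ) (1≤t : 1 ≤ t) (1≤q : 1 ≤ q)
  (large : Large t q (Partitions.system c′ (2 + (t + q)))) where
  c k : ℕ
  c = suc c′
  k = 2 + (t + q)
  open Partitions c′ k using (b; system)
  open CliqueSystem system using (Clique)
  open Large large using (k<r; r₂≥3)
  private
    module Ext = ExtremalFamilies t q system 1≤t 1≤q k<r r₂≥3
    module Cov = Covers t q system 1≤t 1≤q k<r r₂≥3
  open Conclusion t q system 1≤t 1≤q large

  In : Family (c * k) → Subset b → Set
  In 𝓕 A = ⟨ A ⟩ ∈ᶠ 𝓕

  -- Membership in all members is decidable, so the full set of common blocks exists as a member,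
  -- and the hypothesis on it bounds every smaller set.
  common-bound : (𝓕 : Family (c * k)) → (∀ S → IsCommonBlocks 𝓕 S → # S < t) →
    ∀ A → (∀ {F} → In 𝓕 F → A ⊆ F) → ∣ A ∣ < t
  common-bound 𝓕 small A A⊆ = ≤-<-trans (p⊆q⇒∣p∣≤∣q∣ sub) (small ⟨ comprehension everywhere? ⟩ isCommon)
    where
    everywhere? : Decidable (λ j → ∀ B → B ∈ᶠ 𝓕 → j ∈ᴹ B)
    everywhere? j = map′ (λ none B e → ∈-stable (λ j∉ → none (blocks B , e , j∉))) (λ all (B , e , j∉) → j∉ (all ⟨ B ⟩ e))
      (¬? (anySubset? (λ B → member? 𝓕 B ×-dec ¬? (j ∈? B))))
    isCommon : IsCommonBlocks 𝓕 ⟨ comprehension everywhere? ⟩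
    isCommon j = mk⇔ (∈-comprehension⁻ everywhere?) (∈-comprehension⁺ everywhere?)
    sub : A ⊆ comprehension everywhere?
    sub x∈ = ∈-comprehension⁺ everywhere? (λ B e → A⊆ e x∈)

  admissible : ∀ {𝓕 𝓖} → Admissible c k t 𝓕 𝓖 → Ext.AdmissiblePair (In 𝓕) (In 𝓖)
  admissible {𝓕} {𝓖} (𝓕⊆U , 𝓖⊆U , cross , comF , comG) = record
    { cliqueˡ = λ {F} → 𝓕⊆U ⟨ F ⟩ ; cliqueʳ = λ {G} → 𝓖⊆U ⟨ G ⟩
    ; cross = λ {F} {G} → cross ⟨ F ⟩ ⟨ G ⟩
    ; commonˡ = common-bound 𝓕 comF ; commonʳ = common-bound 𝓖 comG }

  family : {P : Subset b → Set} → Decidable P → Family (c * k)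
  family P? A = does (P? (blocks A))

  family-size : {P : Subset b → Set} (P? : Decidable P) → HasSize (family P?) (count P?)
  family-size P? = subst (HasSize (family P?))
    (count-cong (member? (family P?)) P? (λ A → does-true⁻ (P? A)) (λ A → dec-true (P? A))) (hasSize-count (family P?))

  family-admissible : ∀ {P Q} (P? : Decidable P) (Q? : Decidable Q) → Ext.AdmissiblePair P Q →
    Admissible c k t (family P?) (family Q?)
  family-admissible P? Q? adm =
    (λ A e → cliqueˡ (does-true⁻ (P? (blocks A)) e)) , (λ A e → cliqueʳ (does-true⁻ (Q? (blocks A)) e)) ,
    (λ A B e e′ → cross (does-true⁻ (P? (blocks A)) e) (does-true⁻ (Q? (blocks B)) e′)) ,
    (λ S isCommon → commonˡ (blocks S) (λ {F} pF {j} j∈ → Equivalence.to (isCommon j) j∈ ⟨ F ⟩ (dec-true (P? F) pF))) ,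
    (λ S isCommon → commonʳ (blocks S) (λ {G} qG {j} j∈ → Equivalence.to (isCommon j) j∈ ⟨ G ⟩ (dec-true (Q? G) qG)))
    where open Ext.AdmissiblePair adm

  module _ (𝓕 𝓖 : Family (c * k)) {m₁ m₂ : ℕ} (size₁ : HasSize 𝓕 m₁) (size₂ : HasSize 𝓖 m₂)
    (adm : Admissible c k t 𝓕 𝓖)
    (maximal : ∀ 𝓕′ 𝓖′ x y → Admissible c k t 𝓕′ 𝓖′ → HasSize 𝓕′ x → HasSize 𝓖′ y → x * y ≤ m₁ * m₂) where

    maximalPair : Cov.Maximal (member? 𝓕) (member? 𝓖)
    maximalPair = record
      { adm = admissible {𝓕} {𝓖} adm
      ; maximal = λ P? Q? adm′ → ≤-trans
          (maximal (family P?) (family Q?) _ _ (family-admissible P? Q? adm′) (family-size P?) (family-size Q?))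
          (≤-reflexive (cong₂ _*_ (hasSize-unique 𝓕 size₁) (hasSize-unique 𝓖 size₂))) }

    ≗⇒≐ : ∀ {𝓗 : Family (c * k)} {P : Subset b → Set} → In 𝓗 ≗ P → 𝓗 ≐ (λ A → P (blocks A))
    ≗⇒≐ (to , from) A = mk⇔ to from

    case₁ : Form₁ (In 𝓕) (In 𝓖) → Case1 c k t 𝓕 𝓖
    case₁ f = ⟨ T ⟩ , ⟨ L ⟩ , ⟨ M ⟩ , L.cT , L.cL , M.cL ,
        (λ x∈ → x∈p∩q⁺ (L.T⊆L x∈ , M.T⊆L x∈)) , t+min≤ , ≗⇒≐ {𝓕} P≗ , ≗⇒≐ {𝓖} Q≗
      where
      open Form₁ f
      module L = Ext.Sunflower sL
      module M = Ext.Sunflower sM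

    case₂ : Form₂ (In 𝓕) (In 𝓖) → Case2 c k t 𝓕 𝓖
    case₂ f = ⟨ Z ⟩ , subst (λ ℓ → Clique ℓ Z) (+-comm 2 t) cZ , ≗⇒≐ {𝓕} P≗ , ≗⇒≐ {𝓖} Q≗
      where open Form₂ f

    case₃ : t ≡ 1 → Form₃ (In 𝓕) (In 𝓖) → Case3 c k t 𝓕 𝓖
    case₃ t≡1 f = e₁ , e₂ , e₃ , e₄ , two c₁₂ , two c₃₄ , two c₁₃ , two c₂₄ , two c₁₄ , ≗⇒≐ {𝓕} P≗ , ≗⇒≐ {𝓖} Q≗
      where
      open Form₃ f
      two : ∀ {A} → Clique (1 + t) A → Clique 2 A
      two {A} = subst (λ ℓ → Clique ℓ A) (cong suc t≡1)

    cases : ((2 + t ≤ 1 + q × (2 ≤ t → q ≢ 1 + t)) × Case1 c k t 𝓕 𝓖) ⊎ (1 + q ≤ 2 + t × Case2 c k t 𝓕 𝓖) ⊎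
            ((t ≡ 1 × q ≤ 2) × Case3 c k t 𝓕 𝓖)
    cases = decide (trichotomy maximalPair)
      where
      decide : _ → _
      decide (inj₁ (le , f))        = inj₁ (le , case₁ f)
      decide (inj₂ (inj₁ (le , f))) = inj₂ (inj₁ (le , case₂ f))
      decide (inj₂ (inj₂ (le , f))) = inj₂ (inj₂ ((t≡1 , ≤-pred (≤-trans (m≤n⊔m (2 + t) (1 + q)) le)) , case₃ t≡1 f))
        where
        t≡1 : t ≡ 1
        t≡1 = ≤-antisym (≤-pred (≤-pred (≤-trans (m≤m⊔n (2 + t) (1 + q)) le))) 1≤t

-- The ranges of c, k and t

-- t⁴ ≤ 2^(c - 7) with c ≥ 7 is c ≥ 4 log₂ t + 7 without logarithms. The split is on q ≤ t, that is
-- k ≤ 2t + 2: there the alternative k ≥ 2t + 3 is impossible, and otherwise k ≥ 2t + 3 holds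
-- whichever alternative is given.
large-partitions : ∀ c′ t q → 5 ≤ c′ → 1 ≤ t → 1 ≤ q →
  (7 ≤ suc c′ × t ^ 4 ≤ 2 ^ (suc c′ ∸ 7)) ⊎ 2 * t + 3 ≤ 2 + (t + q) → Large t q (Partitions.system c′ (2 + (t + q)))
large-partitions c′ t q 5≤c′ 1≤t 1≤q hyp =
  [ (λ q≤t → [ (λ (7≤c , le) → few q≤t (c′ ∸ 6) (sym (m+[n∸m]≡n (≤-pred 7≤c))) le)
             , (λ le → contradiction q≤t (<⇒≱ (+-cancelˡ-≤ (2 + t) (suc t) q (≤-trans (≤-reflexive (arith t)) le)))) ]′ hyp)
  , ManyBlocks.large c′ t q 5≤c′ 1≤t ]′ (≤-<-connex q t)
  where
  few : q ≤ t → ∀ d → c′ ≡ 6 + d → t ^ 4 ≤ 2 ^ d → Large t q (Partitions.system c′ (2 + (t + q)))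
  few q≤t d refl le = FewBlocks.large d t q 1≤t 1≤q q≤t le
  arith : ∀ t → 2 + t + suc t ≡ 2 * t + 3
  arith = solve-∀

private
  Conclusions : (c k t : ℕ) → Family (c * k) → Family (c * k) → Set
  Conclusions c k t 𝓕 𝓖 =
    (Case1 c k t 𝓕 𝓖 ⊎ Case2 c k t 𝓕 𝓖 ⊎ Case3 c k t 𝓕 𝓖) ×
    (((k ≡ 4 × t ≡ 1) ⊎ (k ≡ 5 × t ≡ 1)) →
    Case1 c k t 𝓕 𝓖 ⊎ Case2 c k t 𝓕 𝓖 ⊎ Case3 c k t 𝓕 𝓖) ×
    (k ≡ t + 3 → 2 ≤ t → Case1 c k t 𝓕 𝓖 ⊎ Case2 c k t 𝓕 𝓖) ×
    (t + 4 ≤ k → k ≤ 2 * t + 3 → ¬ (k ≡ 5 × t ≡ 1) → Case2 c k t 𝓕 𝓖) ×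
    (2 * t + 4 ≤ k → Case1 c k t 𝓕 𝓖)

-- (i) comes with k ≥ 2t + 3, (ii) with k ≤ 2t + 3 and (iii) with t = 1, k ≤ 5. The ranges of (i)
-- and (ii) overlap only at k = 2t + 3, where t ≥ 2 excludes (i); for t = 1 this is the exceptional
-- pair (5,1).
conclusions : ∀ {X₁ X₂ X₃ : Set} t q → 1 ≤ t →
  ((2 + t ≤ 1 + q × (2 ≤ t → q ≢ 1 + t)) × X₁) ⊎ (1 + q ≤ 2 + t × X₂) ⊎ ((t ≡ 1 × q ≤ 2) × X₃) →
  let k = 2 + (t + q) in
  (X₁ ⊎ X₂ ⊎ X₃) × (((k ≡ 4 × t ≡ 1) ⊎ (k ≡ 5 × t ≡ 1)) → X₁ ⊎ X₂ ⊎ X₃) × (k ≡ t + 3 → 2 ≤ t → X₁ ⊎ X₂) ×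
  (t + 4 ≤ k → k ≤ 2 * t + 3 → ¬ (k ≡ 5 × t ≡ 1) → X₂) × (2 * t + 4 ≤ k → X₁)
conclusions t q 1≤t (inj₁ ((t+2≤ , unbalanced) , x₁)) =
  inj₁ x₁ , (λ _ → inj₁ x₁) , (λ _ _ → inj₁ x₁) , middle , (λ _ → x₁)
  where
  middle : t + 4 ≤ 2 + (t + q) → 2 + (t + q) ≤ 2 * t + 3 → ¬ (2 + (t + q) ≡ 5 × t ≡ 1) → _
  middle _ k≤ k≢5 = ⊥-elim ([ (λ 2≤t → unbalanced 2≤t q≡1+t) , (λ 1≡t → k≢5 (five (sym 1≡t) , sym 1≡t)) ]′ (m≤n⇒m<n∨m≡n 1≤t))
    where
    arith : ∀ t → 2 * t + 3 ≡ 2 + (t + (1 + t))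
    arith = solve-∀
    q≡1+t : q ≡ 1 + t
    q≡1+t = ≤-antisym (+-cancelˡ-≤ t q (1 + t) (≤-pred (≤-pred (≤-trans k≤ (≤-reflexive (arith t)))))) (≤-pred t+2≤)
    five : t ≡ 1 → 2 + (t + q) ≡ 5
    five refl = cong (3 +_) q≡1+t
conclusions t q 1≤t (inj₂ (inj₁ (q≤ , x₂))) =
  inj₂ (inj₁ x₂) , (λ _ → inj₂ (inj₁ x₂)) , (λ _ _ → inj₂ x₂) , (λ _ _ _ → x₂) ,
  (λ k≥ → contradiction (≤-pred q≤) (<⇒≱ (+-cancelˡ-≤ (2 + t) (2 + t) q (≤-trans (≤-reflexive (arith t)) k≥))))
  where
  arith : ∀ t → 2 + t + (2 + t) ≡ 2 * t + 4
  arith = solve-∀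
conclusions t q 1≤t (inj₂ (inj₂ ((refl , q≤2) , x₃))) =
  inj₂ (inj₂ x₃) , (λ _ → inj₂ (inj₂ x₃)) , (λ { _ (s≤s ()) }) ,
  (λ k≥5 _ k≢5 → contradiction (cong (3 +_) (≤-antisym q≤2 (≤-pred (≤-pred (≤-pred k≥5)))) , refl) k≢5) ,
  (λ k≥6 → contradiction (≤-trans (≤-pred (≤-pred (≤-pred k≥6))) q≤2) λ { (s≤s (s≤s ())) })

private
  -- k is a variable with an equation, so that matching on the equation also rewrites the ground set
  -- c k in the types of the families.
  core : ∀ c′ k t q → k ≡ 2 + (t + q) → 1 ≤ t → 1 ≤ q → 5 ≤ c′ →
    ((7 ≤ suc c′ × t ^ 4 ≤ 2 ^ (suc c′ ∸ 7)) ⊎ 2 * t + 3 ≤ k) →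
    (𝓕 𝓖 : Family (suc c′ * k)) → (m₁ m₂ : ℕ) → HasSize 𝓕 m₁ → HasSize 𝓖 m₂ →
    Admissible (suc c′) k t 𝓕 𝓖 →
    (∀ 𝓕′ 𝓖′ a b → Admissible (suc c′) k t 𝓕′ 𝓖′ → HasSize 𝓕′ a → HasSize 𝓖′ b → a * b ≤ m₁ * m₂) →
    Conclusions (suc c′) k t 𝓕 𝓖
  core c′ _ t q refl 1≤t 1≤q 5≤c′ hyp 𝓕 𝓖 m₁ m₂ size₁ size₂ adm maximal = conclusions t q 1≤t
    (Translation.cases c′ t q 1≤t 1≤q (large-partitions c′ t q 5≤c′ 1≤t 1≤q hyp) 𝓕 𝓖 size₁ size₂ adm maximal)

theorem1p2 : (c k t : ℕ) → 1 ≤ t → 6 ≤ c → t + 3 ≤ k →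
    ((7 ≤ c × t ^ 4 ≤ 2 ^ (c ∸ 7)) ⊎ 2 * t + 3 ≤ k) →
    (𝓕 𝓖 : Family (c * k)) → (m₁ m₂ : ℕ) → HasSize 𝓕 m₁ → HasSize 𝓖 m₂ →
    Admissible c k t 𝓕 𝓖 →
    (∀ 𝓕′ 𝓖′ a b → Admissible c k t 𝓕′ 𝓖′ → HasSize 𝓕′ a → HasSize 𝓖′ b →
    a * b ≤ m₁ * m₂) →
    (Case1 c k t 𝓕 𝓖 ⊎ Case2 c k t 𝓕 𝓖 ⊎ Case3 c k t 𝓕 𝓖) ×
    (((k ≡ 4 × t ≡ 1) ⊎ (k ≡ 5 × t ≡ 1)) →
    Case1 c k t 𝓕 𝓖 ⊎ Case2 c k t 𝓕 𝓖 ⊎ Case3 c k t 𝓕 𝓖) ×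
    (k ≡ t + 3 → 2 ≤ t → Case1 c k t 𝓕 𝓖 ⊎ Case2 c k t 𝓕 𝓖) ×
    (t + 4 ≤ k → k ≤ 2 * t + 3 → ¬ (k ≡ 5 × t ≡ 1) → Case2 c k t 𝓕 𝓖) ×
    (2 * t + 4 ≤ k → Case1 c k t 𝓕 𝓖)
theorem1p2 (suc c′) k t 1≤t (s≤s 5≤c′) t+3≤k = core c′ k t (k ∸ (2 + t)) (sym k≡) 1≤t 1≤q 5≤c′
  where
  3+t≤k : 3 + t ≤ k
  3+t≤k = ≤-trans (≤-reflexive (+-comm 3 t)) t+3≤k
  k≡ : 2 + (t + (k ∸ (2 + t))) ≡ k
  k≡ = m+[n∸m]≡n (≤-trans (n≤1+n _) 3+t≤k)
  1≤q : 1 ≤ k ∸ (2 + t)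
  1≤q = m+n≤o⇒m≤o∸n 1 3+t≤k
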